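{- Let $A$ be a $d\times n$ integer matrix of rank $d$ with columns $\mathbf{a}_1,\dots,\mathbf{a}_n$ and $\ker(A)\cap\mathbb{R}^n_{\ge0}=\{\mathbf{0}\}$. Let $\gamma$ be an external chamber of $A$ with external facet $f$, and let $\boldsymbol{\iota}$ be the minimal inner facet normal of $f$. Suppose the external columns of $\gamma$ are $\mathbf{a}_1,\dots,\mathbf{a}_{d-1}$, and let $\mathbf{a}_{d+\ell}$ be a column of $A$ for some $\ell\in\{0,\dots,n-d\}$. Assume $\mathcal{S}(\mathbf{a}_1,\dots,\mathbf{a}_{d-1})$ is saturated in $\mathcal{L}(A)$. Then $p_A^\gamma$ is a polynomial on $\gamma\cap\mathcal{S}(A)$ if and only if there is a positive integer $\beta$ such that for each $j=1,\dots,n$, $$\boldsymbol{\iota}\cdot\mathbf{a}_j=\begin{cases}0 & \text{if }\mathbf{a}_j\in f,\\ \beta & \text{if }\mathbf{a}_j\notin f.\end{cases}$$ Moreover, if $p_A^\gamma$ is a polynomial on $\mathcal{S}(A)$, then for each $\mathbf{b}\in\gamma\cap\mathcal{S}(A)$, $$p_A^\gamma(\mathbf{b})=\binom{\frac{\boldsymbol{\iota}\cdot\mathbf{b}}{\beta}+n-d}{n-d}=\binom{\frac{\det(\mathbf{a}_1,\dots,\mathbf{a}_{d-1},\mathbf{b})}{\det(\mathbf{a}_1,\dots,\mathbf{a}_{d-1},\mathbf{a}_{d+\ell})}+n-d}{n-d}.$$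
   Context: $\operatorname{pos}_{\mathbb{R}}(\cdot)$ is the cone of nonnegative real combinations. A simplicial cone of $A$ is $\operatorname{pos}_{\mathbb{R}}(A_s)$ for a set $s$ of columns with $|s|=\operatorname{rank}(A_s)=d$. The chamber complex of $A$ is the fan formed by the cones $\bigcap\{\text{simplicial cones of }A\text{ containing }\mathbf{b}\}$, $\mathbf{b}\in\operatorname{pos}_{\mathbb{R}}(A)$, with their faces; its $d$-dimensional cones are chambers. $p_A(\mathbf{b})=\#\{\mathbf{x}\in\mathbb{N}^n:A\mathbf{x}=\mathbf{b}\}$ and $p_A^\gamma$ is the quasi-polynomial agreeing with $p_A$ on $\gamma\cap\mathbb{Z}^d$. A column is external if it is not in the cone generated by the other columns. A chamber is external if all but exactly one of its rays are generated by external columns of $A$; the cone generated by its external ray generators is its external facet. A minimal inner facet normal of a facet of a cone is the primitive integer vector normal to the facet and pointing into the cone. $\mathcal{L}(\cdot)$, $\mathcal{S}(\cdot)$ are the lattice and $\mathbb{N}$-semigroup generated; $\mathcal{S}(A_s)$ is saturated in $\mathcal{L}(A)$ if $\mathcal{S}(A_s)=\mathcal{L}(A)\cap\operatorname{pos}_{\mathbb{R}}(A_s)$. -}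

module Defs where

open import Data.Nat as N using (ℕ; zero; suc; _∸_)
open import Data.Nat.Divisibility using (_∣_)
open import Data.Integer as Z using (ℤ; +_)
open import Data.Rational as Q using (ℚ; 0ℚ; 1ℚ)
open import Data.Fin as F using (Fin; toℕ)
open import Data.Vec as V using (Vec)
open import Data.List using (List)
open import Data.List.Membership.Propositional using (_∈_)
open import Data.List.Relation.Unary.Unique.Propositional using (Unique)
open import Data.Maybe using (Maybe; just; nothing)
import Data.Maybe as M
open import Data.Product using (Σ; ∃; _×_; _,_)
open import Function.Bundles using (_⇔_)
open import Relation.Binary.PropositionalEquality using (_≡_; _≢_)
open import Relation.Nullary using (¬_)

ℤtoℚ : ℤ → ℚ
ℤtoℚ z = z Q./ 1

sumℤ : ∀ {m} → (Fin m → ℤ) → ℤ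
sumℤ {zero}  f = + 0
sumℤ {suc m} f = f F.zero Z.+ sumℤ (λ i → f (F.suc i))

sumℚ : ∀ {m} → (Fin m → ℚ) → ℚ
sumℚ {zero}  f = 0ℚ
sumℚ {suc m} f = f F.zero Q.+ sumℚ (λ i → f (F.suc i))

Mat : ℕ → ℕ → Set
Mat d n = Fin d → Fin n → ℤ

col : ∀ {d n} → Mat d n → Fin n → Fin d → ℤ
col A j r = A r j

toℚv : ∀ {d} → (Fin d → ℤ) → Fin d → ℚ
toℚv v r = ℤtoℚ (v r)

_≈v_ : ∀ {d} {A : Set} → (Fin d → A) → (Fin d → A) → Set
u ≈v v = ∀ r → u r ≡ v r

lincomb : ∀ {m d} → (Fin m → ℚ) → (Fin m → Fin d → ℚ) → Fin d → ℚ
lincomb c g r = sumℚ (λ i → c i Q.* g i r)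

dotℤ : ∀ {d} → (Fin d → ℤ) → (Fin d → ℤ) → ℤ
dotℤ u v = sumℤ (λ r → u r Z.* v r)

dotℚ : ∀ {d} → (Fin d → ℚ) → (Fin d → ℚ) → ℚ
dotℚ u v = sumℚ (λ r → u r Q.* v r)

-- linear independence over ℚ (equivalently over ℝ, for rational vectors)
LinIndep : ∀ {m d} → (Fin m → Fin d → ℚ) → Set
LinIndep g = ∀ c → lincomb c g ≈v (λ _ → 0ℚ) → ∀ i → c i ≡ 0ℚ

-- Cones.  A rational polyhedral cone pos_ℝ(g) is represented by its
-- rational points: x ∈ pos(g) iff x is a nonnegative combination of g.

InCone : ∀ {m d} → (Fin m → Fin d → ℚ) → (Fin d → ℚ) → Set
InCone g x = ∃ λ c → (∀ i → 0ℚ Q.≤ c i) × (lincomb c g ≈v x)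

colsℚ : ∀ {d n} → Mat d n → Fin n → Fin d → ℚ
colsℚ A j = toℚv (col A j)

-- a set s of columns with |s| = rank(A_s) = d (given by an injective
-- indexing; linear independence of d columns gives |s| = rank = d)
Simplicial : ∀ {d n} → Mat d n → (Fin d → Fin n) → Set
Simplicial A s = LinIndep (λ i → colsℚ A (s i))

SimpCone : ∀ {d n} → Mat d n → (Fin d → Fin n) → (Fin d → ℚ) → Set
SimpCone A s = InCone (λ i → colsℚ A (s i))

-- the cone of the chamber complex determined by b ∈ pos(A):
-- intersection of all simplicial cones of A containing b
ChamberOf : ∀ {d n} → Mat d n → (Fin d → ℚ) → (Fin d → ℚ) → Set
ChamberOf A b x = ∀ s → Simplicial A s → SimpCone A s b → SimpCone A s x

FullDim : ∀ {d} → ((Fin d → ℚ) → Set) → Set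
FullDim {d} γ = ∃ λ (v : Fin d → Fin d → ℚ) → LinIndep v × (∀ i → γ (v i))

IsChamberPoint : ∀ {d n} → Mat d n → (Fin d → ℚ) → Set
IsChamberPoint A b = InCone (colsℚ A) b × FullDim (ChamberOf A b)

External : ∀ {d n} → Mat d n → Fin n → Set
External A j = ¬ (∃ λ c → (∀ i → 0ℚ Q.≤ c i) × (c j ≡ 0ℚ)
                         × (lincomb c (colsℚ A) ≈v colsℚ A j))

ExtremeRay : ∀ {d} → ((Fin d → ℚ) → Set) → (Fin d → ℚ) → Set
ExtremeRay γ v = γ v × ¬ (v ≈v (λ _ → 0ℚ))
  × (∀ x y → γ x → γ y → (λ r → x r Q.+ y r) ≈v v
       → ∃ λ t → (0ℚ Q.≤ t) × (x ≈v (λ r → t Q.* v r)))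

SameRay : ∀ {d} → (Fin d → ℚ) → (Fin d → ℚ) → Set
SameRay u v = ∃ λ t → (0ℚ Q.< t) × (u ≈v (λ r → t Q.* v r))

InSemigroup : ∀ {d n} → Mat d n → (Fin d → ℤ) → Set
InSemigroup A b = ∃ λ (x : Fin _ → ℕ) → (λ r → sumℤ (λ j → A r j Z.* + x j)) ≈v b

InLattice : ∀ {d n} → Mat d n → (Fin d → ℤ) → Set
InLattice A b = ∃ λ (x : Fin _ → ℤ) → (λ r → sumℤ (λ j → A r j Z.* x j)) ≈v b

Saturated : ∀ {d n m} → Mat d n → (Fin m → Fin n) → Set
Saturated {d} {n} {m} A s = ∀ (b : Fin d → ℤ) →
  InSemigroup (λ r i → A r (s i)) b ⇔
    (InLattice A b × InCone (λ i → colsℚ A (s i)) (toℚv b))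

SolvesVec : ∀ {d n} → Mat d n → (Fin d → ℤ) → Vec ℕ n → Set
SolvesVec A b x = (λ r → sumℤ (λ j → A r j Z.* + V.lookup x j)) ≈v b

CountSol : ∀ {d n} → Mat d n → (Fin d → ℤ) → ℕ → Set
CountSol {d} {n} A b k = ∃ λ (xs : List (Vec ℕ n)) →
  Unique xs × (Data.List.length xs ≡ k) × (∀ x → (x ∈ xs) ⇔ SolvesVec A b x)
  where import Data.List

Poly : ℕ → Set
Poly d = List (ℚ × (Fin d → ℕ))

powℚ : ℚ → ℕ → ℚ
powℚ q zero    = 1ℚ
powℚ q (suc e) = q Q.* powℚ q e

prodℚ : ∀ {m} → (Fin m → ℚ) → ℚ
prodℚ {zero}  f = 1ℚ
prodℚ {suc m} f = f F.zero Q.* prodℚ (λ i → f (F.suc i))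

evalPoly : ∀ {d} → Poly d → (Fin d → ℚ) → ℚ
evalPoly List.[] x = 0ℚ
evalPoly ((c , e) List.∷ p) x = c Q.* prodℚ (λ r → powℚ (x r) (e r)) Q.+ evalPoly p x

binomℚ : ℚ → ℕ → ℚ
binomℚ x zero    = 1ℚ
binomℚ x (suc r) = binomℚ x r Q.* ((x Q.- ((+ r) Q./ 1)) Q.* ((+ 1) Q./ suc r))

det : ∀ {d} → (Fin d → Fin d → ℤ) → ℤ
det {zero}  M = + 1
det {suc d} M = sumℤ (λ i → sgn (toℕ i) Z.* (M i F.zero Z.* det (λ r c → M (F.punchIn i r) (F.suc c))))
  where
  sgn : ℕ → ℤ
  sgn zero          = + 1
  sgn (suc zero)    = Z.- (+ 1)
  sgn (suc (suc k)) = sgn k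

lastSplit : ∀ {k} → Fin (suc k) → Maybe (Fin k)
lastSplit {zero}  F.zero    = nothing
lastSplit {suc k} F.zero    = just F.zero
lastSplit {suc k} (F.suc i) = M.map F.suc (lastSplit i)

detCols : ∀ {k} → (Fin k → Fin (suc k) → ℤ) → (Fin (suc k) → ℤ) → ℤ
detCols {k} u v = det (λ r c → M.maybe (λ c' → u c' r) (v r) (lastSplit c))

Primitive : ∀ {d} → (Fin d → ℤ) → Set
Primitive ι = ∀ (g : ℕ) → (∀ r → g ∣ Z.∣ ι r ∣) → g ≡ 1

PolyOnPts : ∀ {d n} → Mat d n → ((Fin d → ℤ) → Set) → Set
PolyOnPts {d} A P = ∃ λ (p : Poly d) →
  ∀ b c → P b → CountSol A b c → evalPoly p (toℚv b) ≡ ℤtoℚ (+ c)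

{-# OPTIONS --safe #-}
module Submission where

-- Let a_1, …, a_k be the external columns of γ and a_u (u > k) the remaining ones.  Pivoting as in the
-- simplex method shows that each (a_1, …, a_k, a_u) is a simplicial basis whose cone contains γ: a pivot
-- that drops some a_i would yield a simplicial cone containing γ but not the external ray a_i, and a pivot
-- that drops nothing contradicts pointedness.  Hence w_u = ι · a_u > 0 for all u > k.
--
-- Let b ∈ γ ∩ S(A).  If y ∈ ℕ^{m+1} satisfies Σ w_u y_u = ι · b, then b − Σ y_u a_u is a convex combination
-- of points of the facet, so by saturation it is a unique ℕ-combination of a_1, …, a_k.  Therefore p_A(b)
-- is the number of y with Σ w_u y_u = ι · b.  If all w_u equal β, this is the binomial coefficient.
-- Conversely, if p_A is polynomial on γ ∩ S(A), differencing in the directions a_u' (u' ≠ u), moved into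
-- γ by multiples of a_1, …, a_k, leaves the indicator of w_u ∣ ι · b, which is then polynomial along each
-- line; as it is 1 at infinitely many points it is constant, and this gives w_u ∣ w_v for all u and v.

-- No column `a_u` need lie in γ, since the remaining ray of γ may be generated by no column at all;
-- hence `b - a_u` and `b + a_u` may both leave γ. This is why every `a_u` is made part of a
-- simplicial basis around γ. Each basis writes the same `b` as `t_u a_u + f_u` with `f_u` in the
-- facet, and applying ι gives `t_u w_u = ι · b` for all `u`. Weighting these identities by
-- `y_u w_u` and adding yields `Σ y_u w_u f_u = (ι · b) (b - Σ y_u a_u)`, so the remainder lies in
-- the facet cone although the partial differences are not controlled. For the converse, the count
-- depends on `b` only through the integer `ι · b`, so the question becomes one about a single
-- variable. Once only `w_u` is left, starting points and parameters that are multiples of `w_u`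
-- make the indicator equal to 1. With step `w_v` and parameter 1 the constant value 1 then says
-- that `w_u` divides a multiple of itself plus `w_v`.

open import Defs
open import Algebra.Bundles using (AbelianGroup; CommutativeRing)
import Algebra.Properties.CommutativeMonoid.Sum as MonoidSum
import Algebra.Properties.Semiring.Sum as SemiringSum
open import Data.Empty using (⊥)
open import Data.Fin as F using (Fin; zero; suc; _↑ˡ_; _↑ʳ_)
import Data.Fin.Permutation as Perm
import Data.Fin.Properties as FP
open import Data.Integer as Z using (ℤ; +_; -[1+_])
import Data.Integer.Properties as ZP
import Data.Integer.Tactic.RingSolver as ℤSolver
open import Data.List using (List; []; _∷_; map; length; _++_)
open import Data.List.Membership.Propositional using (_∈_)
open import Data.List.Membership.Propositional.Properties using (∈-map⁻; ∈-++⁺ˡ; ∈-++⁺ʳ; ∈-++⁻)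
open import Data.List.Membership.Propositional.Properties.WithK using (unique∧set⇒bag)
import Data.List.Properties as LP
open import Data.List.Relation.Binary.BagAndSetEquality using (∼bag⇒↭)
open import Data.List.Relation.Binary.Permutation.Propositional.Properties using (↭-length)
open import Data.List.Relation.Unary.All as All using (All; []; _∷_)
open import Data.List.Relation.Unary.AllPairs using ([]; _∷_)
open import Data.List.Relation.Unary.Any using (here)
open import Data.List.Relation.Unary.Unique.Propositional using (Unique)
import Data.List.Relation.Unary.Unique.Propositional.Properties as UniqueP
open import Data.Maybe as Maybe using (Maybe; just; nothing)
open import Data.Nat as N using (ℕ; zero; suc)
open import Data.Nat.Divisibility using (_∣_; _∣0; divides; ∣-antisym; ∣m+n∣m⇒∣n; m∣m*n)
open import Data.Nat.Induction using (<-rec)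
import Data.Nat.Properties as NP
import Data.Nat.Tactic.RingSolver as ℕSolver
open import Data.Product using (∃; ∃₂; _×_; _,_; proj₁; proj₂)
open import Data.Rational as Q using (ℚ; 0ℚ; 1ℚ)
import Data.Rational.Properties as QP
open import Data.Rational.Unnormalised as U using (mkℚᵘ)
import Data.Rational.Unnormalised.Properties as UP
open import Data.Sum using (_⊎_; inj₁; inj₂)
open import Data.Vec as V using (Vec; []; _∷_)
import Data.Vec.Functional as VF
import Data.Vec.Functional.Properties as VFP
import Data.Vec.Properties as VP
open import Function using (_∘_; id; const)
open import Function.Bundles using (_⇔_; mk⇔; Equivalence)
open import Function.Definitions using (Injective)
open import Level using (0ℓ)
open import Relation.Binary.PropositionalEquality using (_≡_; _≢_; refl; sym; trans; cong; cong₂; subst; module ≡-Reasoning)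
open import Relation.Nullary using (¬_; Dec; yes; no; contradiction)
open import Relation.Nullary.Decidable using (dec⇒maybe; ¬?; decidable-stable)
open import Tactic.RingSolver using (solve-∀)
open import Tactic.RingSolver.Core.AlmostCommutativeRing using (AlmostCommutativeRing; fromCommutativeRing)

-- Finite sums and rational arithmetic

ℚring : AlmostCommutativeRing 0ℓ 0ℓ
ℚring = fromCommutativeRing QP.+-*-commutativeRing (λ x → dec⇒maybe (0ℚ QP.≟ x))

-- Pigeonhole: if `y` were missed, punching it out of the codomain would inject `Fin (suc n)` into
-- `Fin n`.
injective⇒surjective : ∀ {n} (φ : Fin n → Fin n) → Injective _≡_ _≡_ φ → ∀ y → ∃ λ i → φ i ≡ y
injective⇒surjective {suc n} φ inj y with FP.any? (λ i → φ i FP.≟ y)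
... | yes hit = hit
... | no miss = contradiction
  (FP.injective⇒≤ {f = λ i → F.punchOut {i = y} (λ y≡φi → miss (i , sym y≡φi))}
    (λ {i} {j} eq → inj (FP.punchOut-injective (λ e → miss (i , sym e)) (λ e → miss (j , sym e)) eq)))
  NP.1+n≰n

injective⇒permutation : ∀ {n} (φ : Fin n → Fin n) → Injective _≡_ _≡_ φ → Perm.Permutation n n
injective⇒permutation φ inj = Perm.permutation φ ψ (λ y → proj₂ (surj y)) (λ i → inj (proj₂ (surj (φ i))))
  where
  surj = injective⇒surjective φ inj
  ψ = λ y → proj₁ (surj y)

-- `sumℚ` and `sumℤ` are separate recursions. Both satisfy the two equations assumed here, which
-- identify them with the library sum `C.sum`, so each fact is proved once for both rings.
module Summation
  (R : CommutativeRing 0ℓ 0ℓ)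
  (sum : ∀ {m} → (Fin m → CommutativeRing.Carrier R) → CommutativeRing.Carrier R)
  (sum-[] : ∀ f → CommutativeRing._≈_ R (sum {0} f) (CommutativeRing.0# R))
  (sum-∷ : ∀ {m} (f : Fin (suc m) → CommutativeRing.Carrier R) →
     CommutativeRing._≈_ R (sum f) (CommutativeRing._+_ R (f zero) (sum (λ i → f (suc i)))))
  where

  open CommutativeRing R hiding (zero) renaming (refl to ≈-refl; sym to ≈-sym; trans to ≈-trans)
  module C = MonoidSum +-commutativeMonoid
  module S = SemiringSum semiring
  open import Relation.Binary.Reasoning.Setoid setoid

  sum≈∑ : ∀ {m} (f : Fin m → Carrier) → sum f ≈ C.sum f
  sum≈∑ {zero}  f = sum-[] f
  sum≈∑ {suc m} f = ≈-trans (sum-∷ f) (+-congˡ (sum≈∑ (λ i → f (suc i))))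

  sum-cong : ∀ {m} {f g : Fin m → Carrier} → (∀ i → f i ≈ g i) → sum f ≈ sum g
  sum-cong {f = f} {g} f≈g = begin
    sum f    ≈⟨ sum≈∑ f ⟩
    C.sum f  ≈⟨ C.sum-cong-≋ f≈g ⟩
    C.sum g  ≈⟨ sum≈∑ g ⟨
    sum g    ∎

  sum-zero : ∀ {m} {f : Fin m → Carrier} → (∀ i → f i ≈ 0#) → sum f ≈ 0#
  sum-zero {m} {f} f≈0 = begin
    sum f                ≈⟨ sum-cong f≈0 ⟩
    sum {m} (λ _ → 0#)   ≈⟨ sum≈∑ _ ⟩
    C.sum {m} (λ _ → 0#) ≈⟨ C.sum-replicate-zero m ⟩
    0#                   ∎

  sum-+ : ∀ {m} (f g : Fin m → Carrier) → sum (λ i → f i + g i) ≈ sum f + sum g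
  sum-+ f g = begin
    sum (λ i → f i + g i)   ≈⟨ sum≈∑ _ ⟩
    C.sum (λ i → f i + g i) ≈⟨ C.∑-distrib-+ f g ⟩
    C.sum f + C.sum g       ≈⟨ +-cong (sum≈∑ f) (sum≈∑ g) ⟨
    sum f + sum g           ∎

  sum-* : ∀ {m} x (f : Fin m → Carrier) → sum (λ i → x * f i) ≈ x * sum f
  sum-* x f = begin
    sum (λ i → x * f i)   ≈⟨ sum≈∑ _ ⟩
    C.sum (λ i → x * f i) ≈⟨ S.*-distribˡ-sum x f ⟨
    x * C.sum f           ≈⟨ *-congˡ (sum≈∑ f) ⟨
    x * sum f             ∎

  sum-comm : ∀ {m n} (f : Fin m → Fin n → Carrier) →
    sum (λ i → sum (λ j → f i j)) ≈ sum (λ j → sum (λ i → f i j))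
  sum-comm f = begin
    sum (λ i → sum (f i))                   ≈⟨ sum-cong (λ i → sum≈∑ (f i)) ⟩
    sum (λ i → C.sum (f i))                 ≈⟨ sum≈∑ _ ⟩
    C.sum (λ i → C.sum (f i))               ≈⟨ C.∑-comm f ⟩
    C.sum (λ j → C.sum (λ i → f i j))       ≈⟨ sum≈∑ _ ⟨
    sum (λ j → C.sum (λ i → f i j))         ≈⟨ sum-cong (λ j → sum≈∑ _) ⟨
    sum (λ j → sum (λ i → f i j))           ∎

  sum-remove : ∀ {m} (i : Fin (suc m)) f → sum f ≈ f i + sum (λ j → f (F.punchIn i j))
  sum-remove i f = begin
    sum f                                    ≈⟨ sum≈∑ f ⟩
    C.sum f                                  ≈⟨ C.sum-remove {i = i} f ⟩
    f i + C.sum (λ j → f (F.punchIn i j))    ≈⟨ +-congˡ (sum≈∑ _) ⟨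
    f i + sum (λ j → f (F.punchIn i j))      ∎

  sum-reindex : ∀ {m} (φ : Fin m → Fin m) → Injective _≡_ _≡_ φ →
    ∀ f → sum f ≈ sum (λ i → f (φ i))
  sum-reindex φ inj f = begin
    sum f                   ≈⟨ sum≈∑ f ⟩
    C.sum f                 ≈⟨ C.sum-permute f (injective⇒permutation φ inj) ⟩
    C.sum (λ i → f (φ i))   ≈⟨ sum≈∑ _ ⟨
    sum (λ i → f (φ i))     ∎

  sum-single : ∀ {m} (i : Fin m) {f : Fin m → Carrier} → (∀ j → j ≢ i → f j ≈ 0#) → sum f ≈ f i
  sum-single {suc m} i {f} f≈0 = begin
    sum f                                 ≈⟨ sum-remove i f ⟩
    f i + sum (λ j → f (F.punchIn i j))   ≈⟨ +-congˡ (sum-zero (λ j → f≈0 _ (FP.punchInᵢ≢i i j))) ⟩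
    f i + 0#                              ≈⟨ +-identityʳ (f i) ⟩
    f i                                   ∎

  sum-++ : ∀ m {n} (f : Fin (m N.+ n) → Carrier) →
    sum f ≈ sum (λ i → f (i ↑ˡ n)) + sum (λ j → f (m ↑ʳ j))
  sum-++ zero    f = begin
    sum f            ≈⟨ +-identityˡ _ ⟨
    0# + sum f       ≈⟨ +-congʳ (sum-[] _) ⟨
    _ + sum f        ∎
  sum-++ (suc m) f = begin
    sum f                                 ≈⟨ sum-∷ f ⟩
    f zero + sum (λ i → f (suc i))        ≈⟨ +-congˡ (sum-++ m _) ⟩
    f zero + (_ + _)                      ≈⟨ +-assoc _ _ _ ⟨
    f zero + _ + _                        ≈⟨ +-congʳ (sum-∷ _) ⟨
    _ + _                                 ∎

  dot-comb : ∀ {m n} (u : Fin n → Carrier) (c : Fin m → Carrier) (g : Fin m → Fin n → Carrier) →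
    sum (λ r → u r * sum (λ i → c i * g i r)) ≈ sum (λ i → c i * sum (λ r → u r * g i r))
  dot-comb u c g = begin
    sum (λ r → u r * sum (λ i → c i * g i r))      ≈⟨ sum-cong (λ r → sum-* _ _) ⟨
    sum (λ r → sum (λ i → u r * (c i * g i r)))    ≈⟨ sum-comm _ ⟩
    sum (λ i → sum (λ r → u r * (c i * g i r)))    ≈⟨ sum-cong (λ i → sum-cong (λ r → x∙yz≈y∙xz (u r) (c i) (g i r))) ⟩
    sum (λ i → sum (λ r → c i * (u r * g i r)))    ≈⟨ sum-cong (λ i → sum-* _ _) ⟩
    sum (λ i → c i * sum (λ r → u r * g i r))      ∎
    where open import Algebra.Properties.CommutativeSemigroup *-commutativeSemigroup using (x∙yz≈y∙xz)

module Σℚ = Summation QP.+-*-commutativeRing sumℚ (λ _ → refl) (λ _ → refl)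
module Σℤ = Summation ZP.+-*-commutativeRing sumℤ (λ _ → refl) (λ _ → refl)

module _ where
  open Q

  -- `ℤtoℚ` normalises its fraction and so does not reduce on a variable. Identities about it are
  -- checked on unnormalised rationals, where they become integer identities.
  ℤtoℚ≃ : ∀ z → toℚᵘ (ℤtoℚ z) U.≃ mkℚᵘ z 0
  ℤtoℚ≃ z = QP.toℚᵘ-fromℚᵘ (mkℚᵘ z 0)

  ℤtoℚ-+ : ∀ x y → ℤtoℚ (x Z.+ y) ≡ ℤtoℚ x + ℤtoℚ y
  ℤtoℚ-+ x y = QP.toℚᵘ-injective (UP.≃-trans (ℤtoℚ≃ (x Z.+ y)) (UP.≃-sym
    (UP.≃-trans (QP.toℚᵘ-homo-+ (ℤtoℚ x) (ℤtoℚ y))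
    (UP.≃-trans (UP.+-cong (ℤtoℚ≃ x) (ℤtoℚ≃ y)) (U.*≡* (eq x y))))))
    where
    eq : ∀ x y → (x Z.* + 1 Z.+ y Z.* + 1) Z.* + 1 ≡ (x Z.+ y) Z.* + 1
    eq = ℤSolver.solve-∀

  ℤtoℚ-* : ∀ x y → ℤtoℚ (x Z.* y) ≡ ℤtoℚ x * ℤtoℚ y
  ℤtoℚ-* x y = QP.toℚᵘ-injective (UP.≃-trans (ℤtoℚ≃ (x Z.* y)) (UP.≃-sym
    (UP.≃-trans (QP.toℚᵘ-homo-* (ℤtoℚ x) (ℤtoℚ y))
      (UP.*-cong (ℤtoℚ≃ x) (ℤtoℚ≃ y)))))

  ℤtoℚ-injective : ∀ {x y} → ℤtoℚ x ≡ ℤtoℚ y → x ≡ y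
  ℤtoℚ-injective {x} {y} eq with UP.≃-trans (UP.≃-sym (ℤtoℚ≃ x)) (UP.≃-trans (UP.≃-reflexive (cong toℚᵘ eq)) (ℤtoℚ≃ y))
  ... | U.*≡* e = ZP.*-cancelʳ-≡ x y (+ 1) e

  ℤtoℚ-sum : ∀ {m} (f : Fin m → ℤ) → ℤtoℚ (sumℤ f) ≡ sumℚ (λ i → ℤtoℚ (f i))
  ℤtoℚ-sum {zero}  f = refl
  ℤtoℚ-sum {suc m} f = trans (ℤtoℚ-+ (f zero) _) (cong (λ s → ℤtoℚ (f zero) + s) (ℤtoℚ-sum (λ i → f (suc i))))

  ℤtoℚ-dot : ∀ {d} (u v : Fin d → ℤ) → ℤtoℚ (dotℤ u v) ≡ dotℚ (toℚv u) (toℚv v)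
  ℤtoℚ-dot u v = trans (ℤtoℚ-sum (λ r → u r Z.* v r)) (Σℚ.sum-cong (λ r → ℤtoℚ-* (u r) (v r)))

  ℤtoℚ-nonNeg : ∀ n → 0ℚ ≤ ℤtoℚ (+ n)
  ℤtoℚ-nonNeg n = QP.toℚᵘ-cancel-≤ (UP.≤-respʳ-≃ (UP.≃-sym (ℤtoℚ≃ (+ n)))
    (U.*≤* (ZP.*-monoʳ-≤-nonNeg (+ 1) {x = + 0} {y = + n} (Z.+≤+ N.z≤n))))

  ℤtoℚ-pos⁻ : ∀ z → 0ℚ < ℤtoℚ z → ∃ λ n → z ≡ + suc n
  ℤtoℚ-pos⁻ (+ zero)    0<z = contradiction refl (QP.<⇒≢ 0<z)
  ℤtoℚ-pos⁻ (+ suc n)   0<z = n , refl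
  ℤtoℚ-pos⁻ (-[1+ n ])  0<z with UP.<-respʳ-≃ (ℤtoℚ≃ -[1+ n ]) (QP.toℚᵘ-mono-< 0<z)
  ... | U.*<* ()

  /-*-cancel : ∀ z n → (z / suc n) * ℤtoℚ (+ suc n) ≡ ℤtoℚ z
  /-*-cancel z n = QP.toℚᵘ-injective
    (UP.≃-trans (QP.toℚᵘ-homo-* (z / suc n) (ℤtoℚ (+ suc n)))
    (UP.≃-trans (UP.*-cong (QP.toℚᵘ-fromℚᵘ (mkℚᵘ z n)) (ℤtoℚ≃ (+ suc n)))
    (UP.≃-trans (U.*≡* (eq z (+ suc n))) (UP.≃-sym (ℤtoℚ≃ z)))))
    where
    eq : ∀ z s → z Z.* s Z.* + 1 ≡ z Z.* (s Z.* + 1)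
    eq = ℤSolver.solve-∀

  inverse : ∀ {q} → q ≢ 0ℚ → ∃ λ r → q * r ≡ 1ℚ
  inverse {q} q≢0 = (1/ q) {{≢-nonZero q≢0}} , QP.*-inverseʳ q {{≢-nonZero q≢0}}

  *-cancelˡ-0 : ∀ {p q} → p ≢ 0ℚ → p * q ≡ 0ℚ → q ≡ 0ℚ
  *-cancelˡ-0 {p} {q} p≢0 pq≡0 with inverse p≢0
  ... | r , pr≡1 = begin
    q              ≡⟨ QP.*-identityˡ q ⟨
    1ℚ * q         ≡⟨ cong (_* q) pr≡1 ⟨
    p * r * q      ≡⟨ eq p q r ⟩
    r * (p * q)    ≡⟨ cong (r *_) pq≡0 ⟩
    r * 0ℚ         ≡⟨ QP.*-zeroʳ r ⟩
    0ℚ             ∎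
    where
    open ≡-Reasoning
    eq : ∀ p q r → p * r * q ≡ r * (p * q)
    eq = solve-∀ ℚring

  *-nonNeg : ∀ {p q} → 0ℚ ≤ p → 0ℚ ≤ q → 0ℚ ≤ p * q
  *-nonNeg {p} {q} 0≤p 0≤q = subst (_≤ p * q) (QP.*-zeroʳ p) (QP.*-monoˡ-≤-nonNeg p {{nonNegative 0≤p}} 0≤q)

  +-nonNeg : ∀ {p q} → 0ℚ ≤ p → 0ℚ ≤ q → 0ℚ ≤ p + q
  +-nonNeg 0≤p 0≤q = QP.+-mono-≤ 0≤p 0≤q

  inverse-pos : ∀ {q} → 0ℚ < q → ∃ λ r → (0ℚ < r) × (q * r ≡ 1ℚ)
  inverse-pos {q} 0<q = r , QP.positive⁻¹ r {{QP.1/pos⇒pos q {{positive 0<q}}}} , QP.*-inverseʳ q {{nz}}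
    where
    nz = QP.pos⇒nonZero q {{positive 0<q}}
    r = (1/ q) {{nz}}

  ≤⇒0≤- : ∀ {p q} → p ≤ q → 0ℚ ≤ q - p
  ≤⇒0≤- {p} {q} p≤q = subst (_≤ q - p) (QP.+-inverseʳ p) (QP.+-monoˡ-≤ (- p) p≤q)

  neg-nonNeg : ∀ {p} → p ≤ 0ℚ → 0ℚ ≤ - p
  neg-nonNeg p≤0 = QP.neg-antimono-≤ p≤0

  sum-nonNeg : ∀ {m} {f : Fin m → ℚ} → (∀ i → 0ℚ ≤ f i) → 0ℚ ≤ sumℚ f
  sum-nonNeg {zero}  0≤f = QP.≤-refl
  sum-nonNeg {suc m} 0≤f = +-nonNeg (0≤f zero) (sum-nonNeg (λ i → 0≤f (suc i)))

-- Linear algebra over ℚ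

module _ where
  open Q

  lincomb-+ : ∀ {m d} (c c′ : Fin m → ℚ) (g : Fin m → Fin d → ℚ) r →
    lincomb (λ i → c i + c′ i) g r ≡ lincomb c g r + lincomb c′ g r
  lincomb-+ c c′ g r = trans
    (Σℚ.sum-cong (λ i → QP.*-distribʳ-+ (g i r) (c i) (c′ i)))
    (Σℚ.sum-+ (λ i → c i * g i r) (λ i → c′ i * g i r))

  lincomb-* : ∀ {m d} t (c : Fin m → ℚ) (g : Fin m → Fin d → ℚ) r →
    lincomb (λ i → t * c i) g r ≡ t * lincomb c g r
  lincomb-* t c g r = trans
    (Σℚ.sum-cong (λ i → QP.*-assoc t (c i) (g i r)))
    (Σℚ.sum-* t (λ i → c i * g i r))

  lincomb-linear : ∀ {m d} t (c c′ : Fin m → ℚ) (g : Fin m → Fin d → ℚ) r →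
    lincomb (λ i → c i + t * c′ i) g r ≡ lincomb c g r + t * lincomb c′ g r
  lincomb-linear t c c′ g r = trans (lincomb-+ c (λ i → t * c′ i) g r)
    (cong (λ q → lincomb c g r + q) (lincomb-* t c′ g r))

  lincomb-zero : ∀ {m d} {c : Fin m → ℚ} (g : Fin m → Fin d → ℚ) →
    (∀ i → c i ≡ 0ℚ) → ∀ r → lincomb c g r ≡ 0ℚ
  lincomb-zero g c≡0 r = Σℚ.sum-zero (λ i → trans (cong (_* g i r) (c≡0 i)) (QP.*-zeroˡ (g i r)))

  dot-lincomb : ∀ {m d} (u : Fin d → ℚ) (c : Fin m → ℚ) (g : Fin m → Fin d → ℚ) {x} →
    lincomb c g ≈v x → dotℚ u x ≡ sumℚ (λ i → c i * dotℚ u (g i))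
  dot-lincomb u c g cg≈x = trans
    (Σℚ.sum-cong (λ r → cong (u r *_) (sym (cg≈x r)))) (Σℚ.dot-comb u c g)

  -- Gaussian elimination on the first coordinate. If every first coordinate is 0, one vector is set
  -- aside and the coordinate is dropped. Otherwise some `v i` has first coordinate `a` different
  -- from 0, and the vectors `a * y j - y j zero * v i` vanish there, so induction applies to them.
  dependent : ∀ d (v : Fin (suc d) → Fin d → ℚ) →
    ∃ λ c → (∃ λ i → c i ≢ 0ℚ) × lincomb c v ≈v (λ _ → 0ℚ)
  dependent zero    v = (λ _ → 1ℚ) , (zero , λ ()) , λ ()
  dependent (suc d) v with FP.any? (λ i → ¬? (v i zero QP.≟ 0ℚ))
  ... | no none = (0ℚ VF.∷ c′) , (suc i , c′i≢0) , rel
    where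
    ih = dependent d (λ i r → v (suc i) (suc r))
    c′ = proj₁ ih
    i = proj₁ (proj₁ (proj₂ ih))
    c′i≢0 = proj₂ (proj₁ (proj₂ ih))
    v0≡0 : ∀ j → v j zero ≡ 0ℚ
    v0≡0 j = decidable-stable (v j zero QP.≟ 0ℚ) (λ ≢0 → none (j , ≢0))
    rel : lincomb (0ℚ VF.∷ c′) v ≈v (λ _ → 0ℚ)
    rel zero    = Σℚ.sum-zero (λ j → trans (cong ((0ℚ VF.∷ c′) j *_) (v0≡0 j)) (QP.*-zeroʳ ((0ℚ VF.∷ c′) j)))
    rel (suc r) = cong₂ _+_ (QP.*-zeroˡ (v zero (suc r))) (proj₂ (proj₂ ih) r)
  ... | yes (i , a≢0) = c , (F.punchIn i j , cj≢0) , rel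
    where
    a = v i zero
    y : Fin (suc d) → Fin (suc d) → ℚ
    y j = v (F.punchIn i j)
    ih = dependent d (λ j r → a * y j (suc r) - y j zero * v i (suc r))
    c′ = proj₁ ih
    j = proj₁ (proj₁ (proj₂ ih))
    -- Undoing the elimination collects the multiples of `v i` from all the `y j`; their total
    -- coefficient is `- σ`.
    σ = sumℚ (λ j → c′ j * y j zero)
    c = VF.insertAt (λ j → c′ j * a) i (- σ)
    cj≢0 : c (F.punchIn i j) ≢ 0ℚ
    cj≢0 eq = proj₂ (proj₁ (proj₂ ih)) (*-cancelˡ-0 a≢0
      (trans (QP.*-comm a (c′ j)) (trans (sym (VFP.insertAt-punchIn (λ j → c′ j * a) i (- σ) j)) eq)))
    term : ∀ a c x y z → c * a * y + (- x) * (c * z) ≡ c * (a * y - z * x)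
    term = solve-∀ ℚring
    swap : ∀ s x q → - s * x + q ≡ q + - x * s
    swap = solve-∀ ℚring
    open ≡-Reasoning
    elim : ∀ r → lincomb c v r ≡ sumℚ (λ j → c′ j * (a * y j r - y j zero * v i r))
    elim r = begin
      sumℚ (λ j → c j * v j r)
        ≡⟨ Σℚ.sum-remove i (λ j → c j * v j r) ⟩
      c i * v i r + sumℚ (λ j → c (F.punchIn i j) * y j r)
        ≡⟨ cong₂ (λ p q → p * v i r + q) (VFP.insertAt-lookup (λ j → c′ j * a) i (- σ))
             (Σℚ.sum-cong (λ j → cong (_* y j r) (VFP.insertAt-punchIn (λ j → c′ j * a) i (- σ) j))) ⟩
      - σ * v i r + sumℚ (λ j → c′ j * a * y j r)
        ≡⟨ swap σ (v i r) _ ⟩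
      sumℚ (λ j → c′ j * a * y j r) + - v i r * σ
        ≡⟨ cong (λ q → sumℚ (λ j → c′ j * a * y j r) + q) (Σℚ.sum-* (- v i r) (λ j → c′ j * y j zero)) ⟨
      sumℚ (λ j → c′ j * a * y j r) + sumℚ (λ j → - v i r * (c′ j * y j zero))
        ≡⟨ Σℚ.sum-+ (λ j → c′ j * a * y j r) (λ j → - v i r * (c′ j * y j zero)) ⟨
      sumℚ (λ j → c′ j * a * y j r + - v i r * (c′ j * y j zero))
        ≡⟨ Σℚ.sum-cong (λ j → term a (c′ j) (v i r) (y j r) (y j zero)) ⟩
      sumℚ (λ j → c′ j * (a * y j r - y j zero * v i r)) ∎
    cancel : ∀ a c z → c * (a * z - z * a) ≡ 0ℚ
    cancel = solve-∀ ℚring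
    rel : lincomb c v ≈v (λ _ → 0ℚ)
    rel zero    = trans (elim zero) (Σℚ.sum-zero (λ j → cancel a (c′ j) (y j zero)))
    rel (suc r) = trans (elim (suc r)) (proj₂ (proj₂ ih) r)

  -- Among `x` and the `d` vectors there is a dependence. Its coefficient at `x` cannot be 0, as `v`
  -- is independent, so it can be solved for `x`.
  LinIndep⇒spans : ∀ {d} (v : Fin d → Fin d → ℚ) → LinIndep v → ∀ x → ∃ λ c → lincomb c v ≈v x
  LinIndep⇒spans {d} v indep x with dependent d (x VF.∷ v)
  ... | c , (i , ci≢0) , rel with c zero QP.≟ 0ℚ
  ...   | yes c0≡0 = contradiction (c≡0 i) ci≢0
    where
    c≡0 : ∀ j → c j ≡ 0ℚ
    c≡0 zero    = c0≡0
    c≡0 (suc j) = indep (λ j → c (suc j)) (λ r → begin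
      lincomb (λ j → c (suc j)) v r                  ≡⟨ QP.+-identityˡ _ ⟨
      0ℚ + lincomb (λ j → c (suc j)) v r             ≡⟨ cong (_+ lincomb (λ j → c (suc j)) v r)
                                                           (trans (cong (_* x r) c0≡0) (QP.*-zeroˡ (x r))) ⟨
      c zero * x r + lincomb (λ j → c (suc j)) v r   ≡⟨ rel r ⟩
      0ℚ                                             ∎) j
      where open ≡-Reasoning
  ...   | no c0≢0 with inverse c0≢0
  ...     | t , c0t≡1 = (λ j → - t * c (suc j)) , λ r → begin
    lincomb (λ j → - t * c (suc j)) v r          ≡⟨ lincomb-* (- t) (λ j → c (suc j)) v r ⟩
    - t * L r                                    ≡⟨ eq t (c zero) (x r) (L r) ⟩
    c zero * t * x r - t * (c zero * x r + L r)  ≡⟨ cong₂ (λ p q → p * x r - t * q) c0t≡1 (rel r) ⟩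
    1ℚ * x r - t * 0ℚ                            ≡⟨ simp t (x r) ⟩
    x r                                          ∎
    where
    open ≡-Reasoning
    L = lincomb (λ j → c (suc j)) v
    eq : ∀ t c x l → - t * l ≡ c * t * x - t * (c * x + l)
    eq = solve-∀ ℚring
    simp : ∀ t x → 1ℚ * x - t * 0ℚ ≡ x
    simp = solve-∀ ℚring

  LinIndep⇒unique : ∀ {m d} (v : Fin m → Fin d → ℚ) → LinIndep v → ∀ c c′ →
    lincomb c v ≈v lincomb c′ v → ∀ i → c i ≡ c′ i
  LinIndep⇒unique v indep c c′ eq i = begin
    c i                              ≡⟨ split (c i) (c′ i) ⟩
    c i + - 1ℚ * c′ i + c′ i         ≡⟨ cong (_+ c′ i) (indep (λ i → c i + - 1ℚ * c′ i) diff≡0 i) ⟩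
    0ℚ + c′ i                        ≡⟨ QP.+-identityˡ (c′ i) ⟩
    c′ i                             ∎
    where
    open ≡-Reasoning
    split : ∀ x y → x ≡ x + - 1ℚ * y + y
    split = solve-∀ ℚring
    cancel : ∀ y → y + - 1ℚ * y ≡ 0ℚ
    cancel = solve-∀ ℚring
    diff≡0 : ∀ r → lincomb (λ i → c i + - 1ℚ * c′ i) v r ≡ 0ℚ
    diff≡0 r = trans (lincomb-linear (- 1ℚ) c c′ v r)
      (trans (cong (_+ - 1ℚ * lincomb c′ v r) (eq r)) (cancel (lincomb c′ v r)))

  lincomb-updateAt-coeff : ∀ {m d} (c : Fin m → ℚ) (h : Fin m → Fin d → ℚ) i t r →
    lincomb (VF.updateAt c i (const t)) h r ≡ lincomb c h r + (t - c i) * h i r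
  lincomb-updateAt-coeff {suc m} c h i t r = begin
    lincomb c′ h r
      ≡⟨ Σℚ.sum-remove i (λ j → c′ j * h j r) ⟩
    c′ i * h i r + sumℚ (λ j → c′ (F.punchIn i j) * h (F.punchIn i j) r)
      ≡⟨ cong₂ (λ p q → p * h i r + q) (VFP.updateAt-updates i c)
           (Σℚ.sum-cong (λ j → cong (_* h (F.punchIn i j) r)
             (VFP.updateAt-minimal (F.punchIn i j) i c (FP.punchInᵢ≢i i j)))) ⟩
    t * h i r + rest
      ≡⟨ eq t (c i) (h i r) rest ⟩
    c i * h i r + rest + (t - c i) * h i r
      ≡⟨ cong (_+ (t - c i) * h i r) (Σℚ.sum-remove i (λ j → c j * h j r)) ⟨
    lincomb c h r + (t - c i) * h i r ∎
    where
    open ≡-Reasoning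
    c′ = VF.updateAt c i (const t)
    rest = sumℚ (λ j → c (F.punchIn i j) * h (F.punchIn i j) r)
    eq : ∀ t c h s → t * h + s ≡ c * h + s + (t - c) * h
    eq = solve-∀ ℚring

  module _ {m n d} (g : Fin n → Fin d → ℚ) (s : Fin m → Fin n) (i : Fin m) (u : Fin n) where

    lincomb-exchange : ∀ c r →
      lincomb c (λ j → g (VF.updateAt s i (const u) j)) r ≡
      lincomb c (λ j → g (s j)) r + c i * (g u r - g (s i) r)
    lincomb-exchange c r = go s i c
      where
      open ≡-Reasoning
      eq : ∀ c x y s → c * x + s ≡ c * y + s + c * (x - y)
      eq = solve-∀ ℚring
      go : ∀ {m} (s : Fin m → Fin n) i (c : Fin m → ℚ) →
        lincomb c (λ j → g (VF.updateAt s i (const u) j)) r ≡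
        lincomb c (λ j → g (s j)) r + c i * (g u r - g (s i) r)
      go {suc m} s i c = begin
        lincomb c (λ j → g (s′ j)) r
          ≡⟨ Σℚ.sum-remove i (λ j → c j * g (s′ j) r) ⟩
        c i * g (s′ i) r + sumℚ (λ j → c (F.punchIn i j) * g (s′ (F.punchIn i j)) r)
          ≡⟨ cong₂ (λ p q → c i * g p r + q) (VFP.updateAt-updates i s)
               (Σℚ.sum-cong (λ j → cong (λ p → c (F.punchIn i j) * g p r)
                 (VFP.updateAt-minimal (F.punchIn i j) i s (FP.punchInᵢ≢i i j)))) ⟩
        c i * g u r + rest
          ≡⟨ eq (c i) (g u r) (g (s i) r) rest ⟩
        c i * g (s i) r + rest + c i * (g u r - g (s i) r)
          ≡⟨ cong (_+ c i * (g u r - g (s i) r)) (Σℚ.sum-remove i (λ j → c j * g (s j) r)) ⟨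
        lincomb c (λ j → g (s j)) r + c i * (g u r - g (s i) r) ∎
        where
        s′ = VF.updateAt s i (const u)
        rest = sumℚ (λ j → c (F.punchIn i j) * g (s (F.punchIn i j)) r)

    -- Substituting `g u = Σ p j g (s j)` turns a relation among the new vectors into one among the
    -- old ones. Its coefficient at `i` is `c i * p i`, which forces `c i` to vanish, and then the
    -- others vanish too.
    exchange-LinIndep : ∀ p → LinIndep (λ j → g (s j)) → lincomb p (λ j → g (s j)) ≈v g u →
      p i ≢ 0ℚ → LinIndep (λ j → g (VF.updateAt s i (const u) j))
    exchange-LinIndep p indep pg≈u pi≢0 c rel = c≡0
      where
      open ≡-Reasoning
      h : Fin m → Fin d → ℚ
      h j = g (s j)
      c₀ = VF.updateAt c i (const 0ℚ)
      eq : ∀ l c h u → l + (0ℚ - c) * h + c * u ≡ l + c * (u - h)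
      eq = solve-∀ ℚring
      rel′ : ∀ r → lincomb (λ j → c₀ j + c i * p j) h r ≡ 0ℚ
      rel′ r = begin
        lincomb (λ j → c₀ j + c i * p j) h r
          ≡⟨ lincomb-linear (c i) c₀ p h r ⟩
        lincomb c₀ h r + c i * lincomb p h r
          ≡⟨ cong₂ (λ a b → a + c i * b) (lincomb-updateAt-coeff c h i 0ℚ r) (pg≈u r) ⟩
        lincomb c h r + (0ℚ - c i) * h i r + c i * g u r
          ≡⟨ eq (lincomb c h r) (c i) (h i r) (g u r) ⟩
        lincomb c h r + c i * (g u r - h i r)
          ≡⟨ lincomb-exchange c r ⟨
        lincomb c (λ j → g (VF.updateAt s i (const u) j)) r
          ≡⟨ rel r ⟩
        0ℚ ∎
      coeff≡0 : ∀ j → c₀ j + c i * p j ≡ 0ℚ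
      coeff≡0 = indep _ rel′
      ci≡0 : c i ≡ 0ℚ
      ci≡0 = *-cancelˡ-0 pi≢0 (begin
        p i * c i            ≡⟨ QP.*-comm (p i) (c i) ⟩
        c i * p i            ≡⟨ QP.+-identityˡ _ ⟨
        0ℚ + c i * p i       ≡⟨ cong (_+ c i * p i) (VFP.updateAt-updates i c) ⟨
        c₀ i + c i * p i     ≡⟨ coeff≡0 i ⟩
        0ℚ                   ∎)
      c≡0 : ∀ j → c j ≡ 0ℚ
      c≡0 j with j FP.≟ i
      ... | yes refl = ci≡0
      ... | no j≢i = begin
        c j                ≡⟨ VFP.updateAt-minimal j i c j≢i ⟨
        c₀ j               ≡⟨ pad (c₀ j) (p j) ⟩
        c₀ j + 0ℚ * p j    ≡⟨ cong (λ q → c₀ j + q * p j) ci≡0 ⟨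
        c₀ j + c i * p j   ≡⟨ coeff≡0 j ⟩
        0ℚ                 ∎
        where
        pad : ∀ x y → x ≡ x + 0ℚ * y
        pad = solve-∀ ℚring

    -- A generator with coefficient 0 leaves its slot free for the term `τ * g u`.
    exchange-InCone : ∀ {c τ x} → (∀ j → 0ℚ ≤ c j) → 0ℚ ≤ τ → c i ≡ 0ℚ →
      (∀ r → lincomb c (λ j → g (s j)) r + τ * g u r ≡ x r) →
      InCone (λ j → g (VF.updateAt s i (const u) j)) x
    exchange-InCone {c} {τ} {x} 0≤c 0≤τ ci≡0 cg≈x = c′ , 0≤c′ , λ r → begin
      lincomb c′ (λ j → g (VF.updateAt s i (const u) j)) r
        ≡⟨ lincomb-exchange c′ r ⟩
      lincomb c′ h r + c′ i * (g u r - h i r)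
        ≡⟨ cong₂ (λ a b → a + b * (g u r - h i r)) (lincomb-updateAt-coeff c h i τ r) (VFP.updateAt-updates i c) ⟩
      lincomb c h r + (τ - c i) * h i r + τ * (g u r - h i r)
        ≡⟨ cong (λ q → lincomb c h r + (τ - q) * h i r + τ * (g u r - h i r)) ci≡0 ⟩
      lincomb c h r + (τ - 0ℚ) * h i r + τ * (g u r - h i r)
        ≡⟨ eq (lincomb c h r) τ (h i r) (g u r) ⟩
      lincomb c h r + τ * g u r
        ≡⟨ cg≈x r ⟩
      x r ∎
      where
      open ≡-Reasoning
      h : Fin m → Fin d → ℚ
      h j = g (s j)
      c′ = VF.updateAt c i (const τ)
      0≤c′ : ∀ j → 0ℚ ≤ c′ j
      0≤c′ j with j FP.≟ i
      ... | yes refl = subst (0ℚ ≤_) (sym (VFP.updateAt-updates i c)) 0≤τ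
      ... | no j≢i   = subst (0ℚ ≤_) (sym (VFP.updateAt-minimal j i c j≢i)) (0≤c j)
      eq : ∀ l t h u → l + (t - 0ℚ) * h + t * (u - h) ≡ l + t * u
      eq = solve-∀ ℚring

  -- The minimum ratio rule of the simplex method without division: ρ is the least `b j / p j` over
  -- the positive `p j`, attained at `i`, and so the largest step for which `b - ρ p` stays
  -- nonnegative. The first alternative is the unbounded case.
  RatioTest : ∀ {m} (b p : Fin m → ℚ) → Set
  RatioTest b p = (∀ j → p j ≤ 0ℚ) ⊎
    (∃₂ λ i ρ → (0ℚ < p i) × (0ℚ ≤ ρ) × (b i ≡ ρ * p i) × (∀ j → ρ * p j ≤ b j))

  ratio-test : ∀ {m} (b p : Fin m → ℚ) → (∀ j → 0ℚ ≤ b j) → RatioTest b p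
  ratio-test {zero}  b p 0≤b = inj₁ λ ()
  ratio-test {suc m} b p 0≤b = step (0ℚ QP.<? p zero) (ratio-test (b ∘ suc) (p ∘ suc) (0≤b ∘ suc))
    where
    ≤0-bound : ∀ ρ j → 0ℚ ≤ ρ → p j ≤ 0ℚ → ρ * p j ≤ b j
    ≤0-bound ρ j 0≤ρ pj≤0 = QP.≤-trans
      (subst (ρ * p j ≤_) (QP.*-zeroʳ ρ) (QP.*-monoˡ-≤-nonNeg ρ {{nonNegative 0≤ρ}} pj≤0)) (0≤b j)

    smaller : ∀ ρ ρ′ j → 0ℚ ≤ ρ′ → ρ′ ≤ ρ → ρ * p j ≤ b j → ρ′ * p j ≤ b j
    smaller ρ ρ′ j 0≤ρ′ ρ′≤ρ ρp≤b with QP.≤-total (p j) 0ℚ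
    ... | inj₁ pj≤0 = ≤0-bound ρ′ j 0≤ρ′ pj≤0
    ... | inj₂ 0≤pj = QP.≤-trans (QP.*-monoʳ-≤-nonNeg (p j) {{nonNegative 0≤pj}} ρ′≤ρ) ρp≤b

    ρ₀ : 0ℚ < p zero → ∃ λ ρ → (0ℚ ≤ ρ) × (b zero ≡ ρ * p zero)
    ρ₀ 0<p = let t , 0<t , pt≡1 = inverse-pos 0<p in
      b zero * t , *-nonNeg (0≤b zero) (QP.<⇒≤ 0<t) ,
      sym (trans (eq (b zero) t (p zero)) (trans (cong (b zero *_) pt≡1) (QP.*-identityʳ _)))
      where
      eq : ∀ b t p → b * t * p ≡ b * (p * t)
      eq = solve-∀ ℚring

    step : Dec (0ℚ < p zero) → RatioTest (b ∘ suc) (p ∘ suc) → RatioTest b p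
    step (no 0≮p) (inj₁ p≤0) = inj₁ λ { zero → QP.≮⇒≥ 0≮p ; (suc j) → p≤0 j }
    step (yes 0<p) (inj₁ p≤0) = let ρ , 0≤ρ , b≡ρp = ρ₀ 0<p in
      inj₂ (zero , ρ , 0<p , 0≤ρ , b≡ρp ,
        λ { zero → QP.≤-reflexive (sym b≡ρp) ; (suc j) → ≤0-bound ρ (suc j) 0≤ρ (p≤0 j) })
    step (no 0≮p) (inj₂ (i , ρ , 0<pi , 0≤ρ , b≡ρp , ρp≤b)) =
      inj₂ (suc i , ρ , 0<pi , 0≤ρ , b≡ρp , λ { zero → ≤0-bound ρ zero 0≤ρ (QP.≮⇒≥ 0≮p) ; (suc j) → ρp≤b j })
    step (yes 0<p) (inj₂ (i , ρ , 0<pi , 0≤ρ , b≡ρp , ρp≤b)) = compare (QP.≤-total (ρ * p zero) (b zero))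
      where
      compare : ρ * p zero ≤ b zero ⊎ b zero ≤ ρ * p zero → RatioTest b p
      compare (inj₁ ρp₀≤b₀) = inj₂ (suc i , ρ , 0<pi , 0≤ρ , b≡ρp , λ { zero → ρp₀≤b₀ ; (suc j) → ρp≤b j })
      -- The ratio at `zero` is at most the previous minimum ρ, so it takes over; the bounds at the
      -- other indices survive when ρ decreases.
      compare (inj₂ b₀≤ρp₀) = let ρ′ , 0≤ρ′ , b≡ρ′p = ρ₀ 0<p in
        inj₂ (zero , ρ′ , 0<p , 0≤ρ′ , b≡ρ′p , λ
          { zero    → QP.≤-reflexive (sym b≡ρ′p)
          ; (suc j) → smaller ρ ρ′ (suc j) 0≤ρ′
              (QP.*-cancelʳ-≤-pos (p zero) {{positive 0<p}} (subst (_≤ ρ * p zero) b≡ρ′p b₀≤ρp₀)) (ρp≤b j) })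

-- Cones and pivoting

module _ where
  open Q
  open ≡-Reasoning

  when : ∀ {P : Set} → Dec P → ℚ → ℚ
  when (yes _) q = q
  when (no  _) q = 0ℚ

  -- Coefficients on the same column are added, since `s` may repeat columns:
  -- `inner u VF.∷ frame u₀` does so when `u` is `u₀`.
  push : ∀ {m n} → (Fin m → Fin n) → (Fin m → ℚ) → Fin n → ℚ
  push s c j = sumℚ (λ i → when (s i FP.≟ j) (c i))

  push-miss : ∀ {m n} (s : Fin m → Fin n) c {j} → (∀ i → s i ≢ j) → push s c j ≡ 0ℚ
  push-miss s c {j} miss = Σℚ.sum-zero (λ i → go i (s i FP.≟ j))
    where
    go : ∀ i (e : Dec (s i ≡ j)) → when e (c i) ≡ 0ℚ
    go i (yes si≡j) = contradiction si≡j (miss i)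
    go i (no _)     = refl

  push-nonNeg : ∀ {m n} (s : Fin m → Fin n) c → (∀ i → 0ℚ ≤ c i) → ∀ j → 0ℚ ≤ push s c j
  push-nonNeg s c 0≤c j = sum-nonNeg (λ i → go i (s i FP.≟ j))
    where
    go : ∀ i (e : Dec (s i ≡ j)) → 0ℚ ≤ when e (c i)
    go i (yes _) = 0≤c i
    go i (no _)  = QP.≤-refl

  lincomb-push : ∀ {m n d} (s : Fin m → Fin n) c (g : Fin n → Fin d → ℚ) r →
    lincomb (push s c) g r ≡ lincomb c (λ i → g (s i)) r
  lincomb-push s c g r = begin
    sumℚ (λ j → push s c j * g j r)
      ≡⟨ Σℚ.sum-cong (λ j → trans (QP.*-comm (push s c j) (g j r)) (sym (Σℚ.sum-* (g j r) (λ i → when (s i FP.≟ j) (c i))))) ⟩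
    sumℚ (λ j → sumℚ (λ i → g j r * when (s i FP.≟ j) (c i)))
      ≡⟨ Σℚ.sum-comm (λ j i → g j r * when (s i FP.≟ j) (c i)) ⟩
    sumℚ (λ i → sumℚ (λ j → g j r * when (s i FP.≟ j) (c i)))
      ≡⟨ Σℚ.sum-cong (λ i → Σℚ.sum-single (s i) (λ j j≢si → off i j j≢si (s i FP.≟ j))) ⟩
    sumℚ (λ i → g (s i) r * when (s i FP.≟ s i) (c i))
      ≡⟨ Σℚ.sum-cong (λ i → on i (s i FP.≟ s i)) ⟩
    sumℚ (λ i → c i * g (s i) r) ∎
    where
    off : ∀ i j → j ≢ s i → (e : Dec (s i ≡ j)) → g j r * when e (c i) ≡ 0ℚ
    off i j j≢si (yes si≡j) = contradiction (sym si≡j) j≢si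
    off i j j≢si (no _)     = QP.*-zeroʳ (g j r)
    on : ∀ i (e : Dec (s i ≡ s i)) → g (s i) r * when e (c i) ≡ c i * g (s i) r
    on i (yes _) = QP.*-comm (g (s i) r) (c i)
    on i (no ≢)  = contradiction refl ≢

  LinIndep⇒injective : ∀ {m n d} (g : Fin n → Fin d → ℚ) (s : Fin m → Fin n) →
    LinIndep (λ i → g (s i)) → Injective _≡_ _≡_ s
  LinIndep⇒injective {m} {d = d} g s indep {i} {j} si≡sj =
    decidable-stable (i FP.≟ j) (λ i≢j → contradiction (trans (sym (ci≡1 i≢j)) (indep c rel i)) λ ())
    where
    h : Fin m → Fin d → ℚ
    h i = g (s i)
    c₀ c₁ c : Fin m → ℚ
    c₀ _ = 0ℚ
    c₁ = VF.updateAt c₀ j (const (- 1ℚ))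
    -- The new coefficient is written relative to `c₁ i`, so that the change is exactly 1 and `rel`
    -- holds even for `i = j`; only `ci≡1` needs the indices to differ.
    c = VF.updateAt c₁ i (const (1ℚ + c₁ i))
    ci≡1 : i ≢ j → c i ≡ 1ℚ
    ci≡1 i≢j = trans (VFP.updateAt-updates i c₁) (cong (λ q → 1ℚ + q) (VFP.updateAt-minimal i j c₀ i≢j))
    eq : ∀ x y → 0ℚ + (- 1ℚ - 0ℚ) * x + (1ℚ + y - y) * x ≡ 0ℚ
    eq = solve-∀ ℚring
    rel : ∀ r → lincomb c h r ≡ 0ℚ
    rel r = begin
      lincomb c h r
        ≡⟨ lincomb-updateAt-coeff c₁ h i (1ℚ + c₁ i) r ⟩
      lincomb c₁ h r + (1ℚ + c₁ i - c₁ i) * h i r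
        ≡⟨ cong₂ (λ p q → p + (1ℚ + c₁ i - c₁ i) * g q r) (lincomb-updateAt-coeff c₀ h j (- 1ℚ) r) si≡sj ⟩
      lincomb c₀ h r + (- 1ℚ - 0ℚ) * h j r + (1ℚ + c₁ i - c₁ i) * h j r
        ≡⟨ cong (λ p → p + (- 1ℚ - 0ℚ) * h j r + (1ℚ + c₁ i - c₁ i) * h j r) (lincomb-zero h (λ _ → refl) r) ⟩
      0ℚ + (- 1ℚ - 0ℚ) * h j r + (1ℚ + c₁ i - c₁ i) * h j r
        ≡⟨ eq (h j r) (c₁ i) ⟩
      0ℚ ∎

  LinIndep-resp : ∀ {m d} {g h : Fin m → Fin d → ℚ} → (∀ i r → g i r ≡ h i r) → LinIndep g → LinIndep h
  LinIndep-resp g≈h indep c rel = indep c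
    (λ r → trans (Σℚ.sum-cong (λ i → cong (c i *_) (g≈h i r))) (rel r))

  InCone-resp : ∀ {m d} {g h : Fin m → Fin d → ℚ} {x} → (∀ i r → g i r ≡ h i r) → InCone g x → InCone h x
  InCone-resp g≈h (c , 0≤c , cg≈x) = c , 0≤c ,
    λ r → trans (Σℚ.sum-cong (λ i → cong (c i *_) (sym (g≈h i r)))) (cg≈x r)

  InCone-resp-≈v : ∀ {m d} {g : Fin m → Fin d → ℚ} {x y} → x ≈v y → InCone g x → InCone g y
  InCone-resp-≈v x≈y (c , 0≤c , cg≈x) = c , 0≤c , λ r → trans (cg≈x r) (x≈y r)

  LinIndep-reindex : ∀ {m d} (g : Fin m → Fin d → ℚ) (φ : Fin m → Fin m) → Injective _≡_ _≡_ φ →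
    LinIndep g → LinIndep (λ i → g (φ i))
  LinIndep-reindex g φ inj indep c rel i = trans (cong c (sym (ψφ i))) (indep (λ y → c (ψ y)) rel′ (φ i))
    where
    surj = injective⇒surjective φ inj
    ψ = λ y → proj₁ (surj y)
    φψ : ∀ y → φ (ψ y) ≡ y
    φψ y = proj₂ (surj y)
    ψφ : ∀ i → ψ (φ i) ≡ i
    ψφ i = inj (φψ (φ i))
    rel′ : ∀ r → lincomb (λ y → c (ψ y)) g r ≡ 0ℚ
    rel′ r = begin
      sumℚ (λ y → c (ψ y) * g y r)            ≡⟨ Σℚ.sum-reindex φ inj (λ y → c (ψ y) * g y r) ⟩
      sumℚ (λ i → c (ψ (φ i)) * g (φ i) r)    ≡⟨ Σℚ.sum-cong (λ i → cong (λ j → c j * g (φ i) r) (ψφ i)) ⟩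
      sumℚ (λ i → c i * g (φ i) r)            ≡⟨ rel r ⟩
      0ℚ                                      ∎

  InCone-reindex : ∀ {m d} (g : Fin m → Fin d → ℚ) (φ : Fin m → Fin m) → Injective _≡_ _≡_ φ →
    ∀ {x} → InCone g x → InCone (λ i → g (φ i)) x
  InCone-reindex g φ inj (c , 0≤c , cg≈x) = (λ i → c (φ i)) , (λ i → 0≤c (φ i)) ,
    λ r → trans (sym (Σℚ.sum-reindex φ inj (λ y → c y * g y r))) (cg≈x r)

  InCone-+ : ∀ {m d} (g : Fin m → Fin d → ℚ) {x y} → InCone g x → InCone g y → InCone g (λ r → x r + y r)
  InCone-+ g (c , 0≤c , cg≈x) (c′ , 0≤c′ , c′g≈y) =
    (λ i → c i + c′ i) , (λ i → +-nonNeg (0≤c i) (0≤c′ i)) ,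
    λ r → trans (lincomb-+ c c′ g r) (cong₂ _+_ (cg≈x r) (c′g≈y r))

  InCone-* : ∀ {m d} (g : Fin m → Fin d → ℚ) {t x} → 0ℚ ≤ t → InCone g x → InCone g (λ r → t * x r)
  InCone-* g {t} 0≤t (c , 0≤c , cg≈x) =
    (λ i → t * c i) , (λ i → *-nonNeg 0≤t (0≤c i)) ,
    λ r → trans (lincomb-* t c g r) (cong (t *_) (cg≈x r))

  InCone-lincomb : ∀ {m m′ d} (g : Fin m → Fin d → ℚ) (c : Fin m′ → ℚ) (x : Fin m′ → Fin d → ℚ) →
    (∀ i → 0ℚ ≤ c i) → (∀ i → InCone g (x i)) → InCone g (lincomb c x)
  InCone-lincomb {m′ = zero}   g c x 0≤c x∈g = (λ _ → 0ℚ) , (λ _ → QP.≤-refl) , lincomb-zero g (λ _ → refl)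
  InCone-lincomb {m′ = suc m′} g c x 0≤c x∈g = InCone-+ g (InCone-* g (0≤c zero) (x∈g zero))
    (InCone-lincomb g (c ∘ suc) (x ∘ suc) (0≤c ∘ suc) (x∈g ∘ suc))

  module _ {d n} (A : Mat d n) where

    -- If `j` were missed by `s`, the pushed coefficients would write column `j` as a nonnegative
    -- combination with coefficient 0 at `j`, against externality. The index is found by a finite
    -- search, so the argument by contradiction still yields a witness.
    External⇒generator : ∀ {m j} (s : Fin m → Fin n) → External A j →
      InCone (λ i → colsℚ A (s i)) (colsℚ A j) → ∃ λ i → s i ≡ j
    External⇒generator {j = j} s ext (c , 0≤c , cg≈j) = decidable-stable (FP.any? (λ i → s i FP.≟ j))
      (λ miss → ext (push s c , push-nonNeg s c 0≤c , push-miss s c (λ i si≡j → miss (i , si≡j)) ,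
        λ r → trans (lincomb-push s c (colsℚ A) r) (cg≈j r)))

    -- Follow the segment from `x` in the direction of column `u`. Either the coefficients `b + τ p`
    -- are still nonnegative at its end, or some coefficient `l` reaches 0 at a first parameter ρ;
    -- then `u` replaces `s l` and takes up the remaining length `τ - ρ`.
    grow-cone : ∀ {s x τ} u → Simplicial A s → SimpCone A s x → 0ℚ ≤ τ →
      ∃ λ s′ → Simplicial A s′ × SimpCone A s′ (λ r → x r + τ * colsℚ A u r)
    grow-cone {s} {x} {τ} u indep (b , 0≤b , bh≈x) 0≤τ = decide (FP.all? (λ i → 0ℚ QP.≤? b i + τ * p i))
      where
      h : Fin d → Fin d → ℚ
      h i = colsℚ A (s i)
      a = colsℚ A u
      y = λ r → x r + τ * a r
      p = proj₁ (LinIndep⇒spans h indep a)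
      ph≈a = proj₂ (LinIndep⇒spans h indep a)
      Goal = ∃ λ s′ → Simplicial A s′ × SimpCone A s′ y

      decide : Dec (∀ i → 0ℚ ≤ b i + τ * p i) → Goal
      decide (yes 0≤b+τp) = s , indep , (λ i → b i + τ * p i) , 0≤b+τp ,
        λ r → trans (lincomb-linear τ b p h r) (cong₂ (λ a b → a + τ * b) (bh≈x r) (ph≈a r))
      decide (no ¬all) = leave (ratio-test b (λ j → - p j) 0≤b)
        where
        i = proj₁ (FP.¬∀⟶∃¬ d _ (λ i → 0ℚ QP.≤? b i + τ * p i) ¬all)
        fails : ¬ 0ℚ ≤ b i + τ * p i
        fails = proj₂ (FP.¬∀⟶∃¬ d _ (λ i → 0ℚ QP.≤? b i + τ * p i) ¬all)
        negneg : ∀ b t p → b - t * - p ≡ b + t * p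
        negneg = solve-∀ ℚring
        double-neg : ∀ q → - - q ≡ q
        double-neg = solve-∀ ℚring
        -pi≰0 : ¬ - p i ≤ 0ℚ
        -pi≰0 -pi≤0 = fails (+-nonNeg (0≤b i) (*-nonNeg 0≤τ
          (subst (0ℚ ≤_) (double-neg (p i)) (neg-nonNeg -pi≤0))))

        leave : RatioTest b (λ j → - p j) → Goal
        leave (inj₁ -p≤0) = contradiction (-p≤0 i) -pi≰0
        leave (inj₂ (l , ρ , 0<-pl , 0≤ρ , b≡ρ-p , ρ-p≤b)) =
          VF.updateAt s l (const u) ,
          exchange-LinIndep (colsℚ A) s l u p indep ph≈a
            (λ pl≡0 → QP.<⇒≢ 0<-pl (sym (cong -_ pl≡0))) ,
          exchange-InCone (colsℚ A) s l u 0≤c (≤⇒0≤- ρ≤τ) cl≡0 rel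
          where
          0≤c : ∀ j → 0ℚ ≤ b j + ρ * p j
          0≤c j = subst (0ℚ ≤_) (negneg (b j) ρ (p j)) (≤⇒0≤- (ρ-p≤b j))
          cl≡0 : b l + ρ * p l ≡ 0ℚ
          cl≡0 = trans (cong (_+ ρ * p l) b≡ρ-p) (cancel ρ (p l))
            where
            cancel : ∀ t p → t * - p + t * p ≡ 0ℚ
            cancel = solve-∀ ℚring
          -- The segment leaves the old cone before τ, because coefficient `i` is negative at τ but
          -- nonnegative up to ρ.
          by-total : ρ ≤ τ ⊎ τ ≤ ρ → ρ ≤ τ
          by-total (inj₁ ρ≤τ) = ρ≤τ
          by-total (inj₂ τ≤ρ) = contradiction
            (subst (0ℚ ≤_) (negneg (b i) τ (p i)) (≤⇒0≤- (QP.≤-trans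
              (QP.*-monoʳ-≤-nonNeg (- p i) {{nonNegative (QP.<⇒≤ (QP.≰⇒> -pi≰0))}} τ≤ρ) (ρ-p≤b i)))) fails
          ρ≤τ = by-total (QP.≤-total ρ τ)
          eq : ∀ x a t s → x + s * a + (t - s) * a ≡ x + t * a
          eq = solve-∀ ℚring
          rel : ∀ r → lincomb (λ j → b j + ρ * p j) h r + (τ - ρ) * a r ≡ y r
          rel r = begin
            lincomb (λ j → b j + ρ * p j) h r + (τ - ρ) * a r
              ≡⟨ cong (_+ (τ - ρ) * a r) (lincomb-linear ρ b p h r) ⟩
            lincomb b h r + ρ * lincomb p h r + (τ - ρ) * a r
              ≡⟨ cong₂ (λ q q′ → q + ρ * q′ + (τ - ρ) * a r) (bh≈x r) (ph≈a r) ⟩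
            x r + ρ * a r + (τ - ρ) * a r
              ≡⟨ eq (x r) (a r) τ ρ ⟩
            x r + τ * a r ∎

    -- The origin lies in the cone of the given basis, and each further term of the combination is
    -- absorbed by `grow-cone`.
    carathéodory : ∃ (Simplicial A) → ∀ {N} (t : Fin N → Fin n) c → (∀ i → 0ℚ ≤ c i) →
      ∃ λ s → Simplicial A s × SimpCone A s (lincomb c (λ i → colsℚ A (t i)))
    carathéodory (s , indep) {zero}  t c 0≤c =
      s , indep , (λ _ → 0ℚ) , (λ _ → QP.≤-refl) , lincomb-zero (λ i → colsℚ A (s i)) (λ _ → refl)
    carathéodory basis {suc N} t c 0≤c =
      let s , indep , x∈s = carathéodory basis (t ∘ suc) (c ∘ suc) (0≤c ∘ suc)
          s′ , indep′ , x∈s′ = grow-cone (t zero) indep x∈s (0≤c zero)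
      in s′ , indep′ , InCone-resp-≈v (λ r → QP.+-comm (lincomb (c ∘ suc) (λ i → colsℚ A (t (suc i))) r) _) x∈s′

    -- Here `x` is fixed and the basis changes: with `a_u = Σ p h` one has
    -- `x = Σ (b - ρ p) h + ρ a_u`, and the ratio test chooses ρ so that one coefficient becomes 0
    -- while the rest stay nonnegative. Without a positive `p i` no such choice exists, which is the
    -- first alternative.
    pivot : ∀ {s x} u → Simplicial A s → SimpCone A s x →
      (∃ λ p → lincomb p (λ i → colsℚ A (s i)) ≈v colsℚ A u × (∀ i → p i ≤ 0ℚ)) ⊎
      (∃ λ i → Simplicial A (VF.updateAt s i (const u)) × SimpCone A (VF.updateAt s i (const u)) x)
    pivot {s} {x} u indep (b , 0≤b , bh≈x) = leave (ratio-test b p 0≤b)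
      where
      h : Fin d → Fin d → ℚ
      h i = colsℚ A (s i)
      a = colsℚ A u
      p = proj₁ (LinIndep⇒spans h indep a)
      ph≈a = proj₂ (LinIndep⇒spans h indep a)
      sub : ∀ b t p → b - t * p ≡ b + - t * p
      sub = solve-∀ ℚring
      cancel : ∀ t p → t * p + - t * p ≡ 0ℚ
      cancel = solve-∀ ℚring
      eq : ∀ x a t → x + - t * a + t * a ≡ x
      eq = solve-∀ ℚring
      leave : RatioTest b p → _
      leave (inj₁ p≤0) = inj₁ (p , ph≈a , p≤0)
      leave (inj₂ (l , ρ , 0<pl , 0≤ρ , b≡ρp , ρp≤b)) = inj₂ (l ,
        exchange-LinIndep (colsℚ A) s l u p indep ph≈a (λ pl≡0 → QP.<⇒≢ 0<pl (sym pl≡0)) ,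
        exchange-InCone (colsℚ A) s l u {c = λ j → b j + - ρ * p j}
          (λ j → subst (0ℚ ≤_) (sub (b j) ρ (p j)) (≤⇒0≤- (ρp≤b j))) 0≤ρ
          (trans (cong (_+ - ρ * p l) b≡ρp) (cancel ρ (p l)))
          (λ r → begin
            lincomb (λ j → b j + - ρ * p j) h r + ρ * a r
              ≡⟨ cong (_+ ρ * a r) (lincomb-linear (- ρ) b p h r) ⟩
            lincomb b h r + - ρ * lincomb p h r + ρ * a r
              ≡⟨ cong₂ (λ q q′ → q + - ρ * q′ + ρ * a r) (bh≈x r) (ph≈a r) ⟩
            x r + - ρ * a r + ρ * a r
              ≡⟨ eq (x r) (a r) ρ ⟩
            x r ∎))

-- Pointedness, and vectors orthogonal to a basis

module _ where
  open Q

  term≤sum : ∀ {m} (i : Fin m) {f : Fin m → ℚ} → (∀ j → 0ℚ ≤ f j) → f i ≤ sumℚ f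
  term≤sum {suc m} zero    {f} 0≤f = subst (_≤ sumℚ f) (QP.+-identityʳ (f zero))
    (QP.+-monoʳ-≤ (f zero) (sum-nonNeg (λ j → 0≤f (suc j))))
  term≤sum {suc m} (suc i) {f} 0≤f = subst (_≤ sumℚ f) (QP.+-identityˡ (f (suc i)))
    (QP.+-mono-≤ (0≤f zero) (term≤sum i (λ j → 0≤f (suc j))))

  push-hit : ∀ {m n} (s : Fin m → Fin n) c → (∀ i → 0ℚ ≤ c i) → ∀ i → c i ≤ push s c (s i)
  push-hit s c 0≤c i = subst (_≤ push s c (s i)) (on (s i FP.≟ s i))
    (term≤sum i (λ j → off j (s j FP.≟ s i)))
    where
    on : (e : Dec (s i ≡ s i)) → when e (c i) ≡ c i
    on (yes _) = refl
    on (no ≢)  = contradiction refl ≢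
    off : ∀ j (e : Dec (s j ≡ s i)) → 0ℚ ≤ when e (c j)
    off j (yes _) = 0≤c j
    off j (no _)  = QP.≤-refl

  Pointed : ∀ {d n} → Mat d n → Set
  Pointed {n = n} A = ∀ (x : Fin n → ℚ) → (∀ j → 0ℚ ≤ x j) →
    (λ r → sumℚ (λ j → ℤtoℚ (A r j) * x j)) ≈v (λ _ → 0ℚ) → ∀ j → x j ≡ 0ℚ

  -- The family `t` may repeat columns. Nothing cancels when nonnegative coefficients are added up,
  -- so each `c i` is bounded by the pushed coefficient, which is 0.
  pointed-relation : ∀ {d n} {A : Mat d n} → Pointed A → ∀ {m} (t : Fin m → Fin n) c →
    (∀ i → 0ℚ ≤ c i) → lincomb c (λ i → colsℚ A (t i)) ≈v (λ _ → 0ℚ) → ∀ i → c i ≡ 0ℚ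
  pointed-relation {A = A} pointed t c 0≤c rel i =
    QP.≤-antisym (subst (c i ≤_) (pointed (push t c) (push-nonNeg t c 0≤c) rel′ (t i)) (push-hit t c 0≤c i)) (0≤c i)
    where
    rel′ : ∀ r → sumℚ (λ j → ℤtoℚ (A r j) * push t c j) ≡ 0ℚ
    rel′ r = trans (Σℚ.sum-cong (λ j → QP.*-comm (ℤtoℚ (A r j)) (push t c j)))
      (trans (lincomb-push t c (colsℚ A) r) (rel r))

  dot-unit : ∀ {d} (u : Fin d → ℚ) r → dotℚ u (λ j → when (j FP.≟ r) 1ℚ) ≡ u r
  dot-unit u r = trans (Σℚ.sum-single r (λ j j≢r → off j j≢r (j FP.≟ r))) (on (r FP.≟ r))
    where
    off : ∀ j → j ≢ r → (e : Dec (j ≡ r)) → u j * when e 1ℚ ≡ 0ℚ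
    off j j≢r (yes j≡r) = contradiction j≡r j≢r
    off j j≢r (no _)    = QP.*-zeroʳ (u j)
    on : (e : Dec (r ≡ r)) → u r * when e 1ℚ ≡ u r
    on (yes _) = QP.*-identityʳ (u r)
    on (no ≢)  = contradiction refl ≢

  dot-basis-zero : ∀ {d} (u : Fin d → ℚ) (v : Fin d → Fin d → ℚ) → LinIndep v →
    (∀ i → dotℚ u (v i) ≡ 0ℚ) → ∀ r → u r ≡ 0ℚ
  dot-basis-zero {d} u v indep u⊥v r = trans (sym (dot-unit u r))
    (trans (dot-lincomb u c v cv≈e) (Σℚ.sum-zero (λ i → trans (cong (c i *_) (u⊥v i)) (QP.*-zeroʳ (c i)))))
    where
    c = proj₁ (LinIndep⇒spans v indep (λ j → when (j FP.≟ r) 1ℚ))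
    cv≈e = proj₂ (LinIndep⇒spans v indep (λ j → when (j FP.≟ r) 1ℚ))

  -- 2 would be a common divisor of the entries of the zero vector.
  Primitive⇒≢0 : ∀ {d} (ι : Fin d → ℤ) → Primitive ι → ¬ (∀ r → ι r ≡ + 0)
  Primitive⇒≢0 ι prim ι≡0 = contradiction (prim 2 (λ r → subst (λ z → 2 ∣ Z.∣ z ∣) (sym (ι≡0 r)) (2 ∣0))) λ ()

-- Counting solutions of one linear equation

module _ where
  open Equivalence using (to; from)
  open N

  -- `CountSol A b` unfolds to `Count (SolvesVec A b)`. The general predicate allows counts to be
  -- transported between `A x = b` and the weight equation.
  Count : ∀ {X : Set} → (X → Set) → ℕ → Set
  Count {X} P c = ∃ λ (xs : List X) → Unique xs × (length xs ≡ c) × (∀ x → (x ∈ xs) ⇔ P x)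

  -- Two lists without repetitions and with the same members are permutations of each other.
  Count-unique : ∀ {X : Set} {P : X → Set} {c c′} → Count P c → Count P c′ → c ≡ c′
  Count-unique (xs , uxs , refl , xs⇔P) (ys , uys , refl , ys⇔P) =
    ↭-length (∼bag⇒↭ (unique∧set⇒bag uxs uys
      (λ {x} → mk⇔ (λ x∈xs → from (ys⇔P x) (to (xs⇔P x) x∈xs)) (λ x∈ys → from (xs⇔P x) (to (ys⇔P x) x∈ys)))))

  Count-resp : ∀ {X : Set} {P Q : X → Set} {c} → (∀ x → P x → Q x) → (∀ x → Q x → P x) → Count P c → Count Q c
  Count-resp P⇒Q Q⇒P (xs , uxs , len , xs⇔P) = xs , uxs , len ,
    λ x → mk⇔ (λ x∈xs → P⇒Q x (to (xs⇔P x) x∈xs)) (λ q → from (xs⇔P x) (Q⇒P x q))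

  Count-⊎ : ∀ {X : Set} {P Q : X → Set} {a b} → (∀ x → P x → Q x → ⊥) →
    Count P a → Count Q b → Count (λ x → P x ⊎ Q x) (a + b)
  Count-⊎ {P = P} {Q} disjoint (xs , uxs , refl , xs⇔P) (ys , uys , refl , ys⇔Q) =
    xs ++ ys ,
    UniqueP.++⁺ uxs uys (λ {x} (x∈xs , x∈ys) → disjoint x (to (xs⇔P x) x∈xs) (to (ys⇔Q x) x∈ys)) ,
    LP.length-++ xs ,
    λ x → mk⇔ (λ x∈ → forth x (∈-++⁻ xs x∈)) (back x)
    where
    forth : ∀ x → x ∈ xs ⊎ x ∈ ys → P x ⊎ Q x
    forth x (inj₁ x∈xs) = inj₁ (to (xs⇔P x) x∈xs)
    forth x (inj₂ x∈ys) = inj₂ (to (ys⇔Q x) x∈ys)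
    back : ∀ x → P x ⊎ Q x → x ∈ xs ++ ys
    back x (inj₁ p) = ∈-++⁺ˡ (from (xs⇔P x) p)
    back x (inj₂ q) = ∈-++⁺ʳ xs (from (ys⇔Q x) q)

  -- The enumeration of `Q` is pulled back by choosing a preimage of each entry. No inverse function
  -- on all of `Y` is required; injectivity serves to show that every solution of `P` is among the
  -- chosen preimages.
  Count-bijection : ∀ {X Y : Set} {P : X → Set} {Q : Y → Set} {c} (f : X → Y) →
    (∀ x → P x → Q (f x)) → (∀ y → Q y → ∃ λ x → P x × f x ≡ y) →
    (∀ x x′ → P x → P x′ → f x ≡ f x′ → x ≡ x′) → Count Q c → Count P c
  Count-bijection {X} {Y} {P} {Q} f P⇒Q surj inj (ys , uys , refl , ys⇔Q) =
    xs , UniqueP.map⁻ (subst Unique (sym fxs≡ys) uys) ,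
    trans (sym (LP.length-map f xs)) (cong length fxs≡ys) ,
    λ x → mk⇔ (All.lookup Pxs) (back x)
    where
    lift : (ys : List Y) → All Q ys → ∃ λ xs → map f xs ≡ ys × All P xs
    lift []       []         = [] , refl , []
    lift (y ∷ ys) (qy ∷ qys) =
      let x , px , fx≡y = surj y qy
          xs , fxs≡ys , pxs = lift ys qys
      in x ∷ xs , cong₂ _∷_ fx≡y fxs≡ys , px ∷ pxs
    lifted = lift ys (All.tabulate (λ {y} → to (ys⇔Q y)))
    xs = proj₁ lifted
    fxs≡ys = proj₁ (proj₂ lifted)
    Pxs = proj₂ (proj₂ lifted)
    back : ∀ x → P x → x ∈ xs
    back x px =
      let x′ , x′∈xs , fx≡fx′ = ∈-map⁻ f (subst (f x ∈_) (sym fxs≡ys) (from (ys⇔Q (f x)) (P⇒Q x px)))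
      in subst (_∈ xs) (sym (inj x x′ px (All.lookup Pxs x′∈xs) fx≡fx′)) x′∈xs

  total : ∀ {l} → (Fin l → ℕ) → Vec ℕ l → ℕ
  total w []       = 0
  total w (y ∷ ys) = w zero * y + total (w ∘ suc) ys

  Sol : ∀ {l} → (Fin l → ℕ) → ℕ → Vec ℕ l → Set
  Sol w n y = total w y ≡ n

  -- The coin-change recursion: a solution for `w zero + n` either uses the first weight, and then
  -- one copy is removed, or does not use it, and then the first coordinate is dropped.
  Count-Sol-+ : ∀ {l} (w : Fin (suc l) → ℕ) n {a b} → Count (Sol w n) a →
    Count (Sol (w ∘ suc) (w zero + n)) b → Count (Sol w (w zero + n)) (a + b)
  Count-Sol-+ {l} w n ca cb =
    Count-resp join split (Count-⊎ disjoint (Count-bijection lower lower-Sol lift-Sol lower-injective ca)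
      (Count-bijection V.tail tail-Sol cons-Sol tail-injective cb))
    where
    PosHead ZeroHead : Vec ℕ (suc l) → Set
    PosHead (zero ∷ ys)   = ⊥
    PosHead (suc y ∷ ys)  = Sol w n (y ∷ ys)
    ZeroHead (zero ∷ ys)  = Sol (w ∘ suc) (w zero + n) ys
    ZeroHead (suc y ∷ ys) = ⊥

    lower : Vec ℕ (suc l) → Vec ℕ (suc l)
    lower (y ∷ ys) = pred y ∷ ys
    lower-Sol : ∀ y → PosHead y → Sol w n (lower y)
    lower-Sol (suc y ∷ ys) p = p
    lift-Sol : ∀ y → Sol w n y → ∃ λ x → PosHead x × lower x ≡ y
    lift-Sol (y ∷ ys) p = suc y ∷ ys , p , refl
    lower-injective : ∀ x x′ → PosHead x → PosHead x′ → lower x ≡ lower x′ → x ≡ x′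
    lower-injective (suc x ∷ xs) (suc .x ∷ .xs) p p′ refl = refl

    tail-Sol : ∀ y → ZeroHead y → Sol (w ∘ suc) (w zero + n) (V.tail y)
    tail-Sol (zero ∷ ys) p = p
    cons-Sol : ∀ y → Sol (w ∘ suc) (w zero + n) y → ∃ λ x → ZeroHead x × V.tail x ≡ y
    cons-Sol y p = zero ∷ y , p , refl
    tail-injective : ∀ x x′ → ZeroHead x → ZeroHead x′ → V.tail x ≡ V.tail x′ → x ≡ x′
    tail-injective (zero ∷ xs) (zero ∷ .xs) p p′ refl = refl

    disjoint : ∀ x → PosHead x → ZeroHead x → ⊥
    disjoint (suc x ∷ xs) p ()

    head-suc : ∀ y (ys : Vec ℕ l) → total w (suc y ∷ ys) ≡ w zero + total w (y ∷ ys)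
    head-suc y ys = trans (cong (_+ total (w ∘ suc) ys) (NP.*-suc (w zero) y)) (NP.+-assoc (w zero) _ _)
    head-zero : ∀ (ys : Vec ℕ l) → total w (zero ∷ ys) ≡ total (w ∘ suc) ys
    head-zero ys = cong (_+ total (w ∘ suc) ys) (NP.*-zeroʳ (w zero))

    join : ∀ x → PosHead x ⊎ ZeroHead x → Sol w (w zero + n) x
    join (suc x ∷ xs) (inj₁ p) = trans (head-suc x xs) (cong (λ s → w zero + s) p)
    join (zero ∷ xs)  (inj₂ p) = trans (head-zero xs) p
    split : ∀ x → Sol w (w zero + n) x → PosHead x ⊎ ZeroHead x
    split (suc x ∷ xs) p = inj₁ (NP.+-cancelˡ-≡ (w zero) _ _ (trans (sym (head-suc x xs)) p))
    split (zero ∷ xs)  p = inj₂ (trans (sym (head-zero xs)) p)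

  Count-Sol-< : ∀ {l} (w : Fin (suc l) → ℕ) n {c} → n < w zero →
    Count (Sol (w ∘ suc) n) c → Count (Sol w n) c
  Count-Sol-< w n n<w = Count-bijection V.tail tail-Sol cons-Sol tail-injective
    where
    head≡0 : ∀ y ys → Sol w n (y ∷ ys) → y ≡ 0
    head≡0 zero    ys p = refl
    head≡0 (suc y) ys p = contradiction
      (subst (w zero ≤_) p (NP.≤-trans (NP.m≤m*n (w zero) (suc y)) (NP.m≤m+n _ _))) (NP.<⇒≱ n<w)
    tail-Sol : ∀ y → Sol w n y → Sol (w ∘ suc) n (V.tail y)
    tail-Sol (y ∷ ys) p with head≡0 y ys p
    ... | refl = trans (sym (cong (_+ total (w ∘ suc) ys) (NP.*-zeroʳ (w zero)))) p
    cons-Sol : ∀ y → Sol (w ∘ suc) n y → ∃ λ x → Sol w n x × V.tail x ≡ y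
    cons-Sol y p = zero ∷ y , trans (cong (_+ total (w ∘ suc) y) (NP.*-zeroʳ (w zero))) p , refl
    tail-injective : ∀ x x′ → Sol w n x → Sol w n x′ → V.tail x ≡ V.tail x′ → x ≡ x′
    tail-injective (x ∷ xs) (x′ ∷ .xs) p p′ refl = cong (_∷ xs) (trans (head≡0 x xs p) (sym (head≡0 x′ xs p′)))

  -- Recursion on the number of weights and, inside, well-founded recursion on `n`, which decreases
  -- because `w zero` is positive.
  Count-Sol-exists : ∀ {l} (w : Fin l → ℕ) → (∀ i → 0 < w i) → ∀ n → ∃ (Count (Sol w n))
  Count-Sol-exists {zero}  w 0<w zero    =
    1 , [] ∷ [] , [] ∷ [] , refl , λ { [] → mk⇔ (λ _ → refl) (λ _ → here refl) }
  Count-Sol-exists {zero}  w 0<w (suc n) =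
    0 , [] , [] , refl , λ { [] → mk⇔ (λ ()) (λ ()) }
  Count-Sol-exists {suc l} w 0<w = <-rec (λ n → ∃ (Count (Sol w n))) step
    where
    step : ∀ n → (∀ {n′} → n′ < n → ∃ (Count (Sol w n′))) → ∃ (Count (Sol w n))
    step n rec with w zero ≤? n
    ... | no w≰n = _ , Count-Sol-< w n (NP.≰⇒> w≰n) (proj₂ (Count-Sol-exists (w ∘ suc) (0<w ∘ suc) n))
    ... | yes w≤n = subst (λ n → ∃ (Count (Sol w n))) (NP.m+[n∸m]≡n w≤n)
      (_ , Count-Sol-+ w (n ∸ w zero) (proj₂ (rec (NP.∸-monoʳ-< (0<w zero) w≤n)))
        (proj₂ (Count-Sol-exists (w ∘ suc) (0<w ∘ suc) (w zero + (n ∸ w zero)))))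

  -- Opaque, so that type checking never unfolds the enumeration; `Count-unique` recovers every
  -- needed value from `count-Count`.
  abstract
    count : ∀ {l} (w : Fin l → ℕ) → (∀ i → 0 < w i) → ℕ → ℕ
    count w 0<w n = proj₁ (Count-Sol-exists w 0<w n)

    count-Count : ∀ {l} (w : Fin l → ℕ) (0<w : ∀ i → 0 < w i) n → Count (Sol w n) (count w 0<w n)
    count-Count w 0<w n = proj₂ (Count-Sol-exists w 0<w n)

  count-+ : ∀ {l} (w : Fin (suc l) → ℕ) (0<w : ∀ i → 0 < w i) n →
    count w 0<w (w zero + n) ≡ count w 0<w n + count (w ∘ suc) (0<w ∘ suc) (w zero + n)
  count-+ w 0<w n = Count-unique (count-Count w 0<w (w zero + n))
    (Count-Sol-+ w n (count-Count w 0<w n) (count-Count (w ∘ suc) (0<w ∘ suc) (w zero + n)))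

  count-zero : ∀ {l} (w : Fin l → ℕ) (0<w : ∀ i → 0 < w i) → count w 0<w 0 ≡ 1
  count-zero {zero}  w 0<w = Count-unique (count-Count w 0<w 0) (proj₂ (Count-Sol-exists w 0<w 0))
  count-zero {suc l} w 0<w = trans (Count-unique (count-Count w 0<w 0)
    (Count-Sol-< w 0 (0<w zero) (count-Count (w ∘ suc) (0<w ∘ suc) 0))) (count-zero (w ∘ suc) (0<w ∘ suc))

  swap₀₁ : ∀ {l} {X : Set} → (Fin (2 + l) → X) → Fin (2 + l) → X
  swap₀₁ w zero          = w (suc zero)
  swap₀₁ w (suc zero)    = w zero
  swap₀₁ w (suc (suc i)) = w (suc (suc i))

  count-swap : ∀ {l} (w : Fin (2 + l) → ℕ) (0<w : ∀ i → 0 < w i) (0<w′ : ∀ i → 0 < swap₀₁ w i) n →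
    count (swap₀₁ w) 0<w′ n ≡ count w 0<w n
  count-swap {l} w 0<w 0<w′ n = Count-unique (count-Count (swap₀₁ w) 0<w′ n)
    (Count-bijection swap swap-Sol
      (λ y p → swap y , trans (total-swap w y) p , swap-swap y)
      (λ x x′ _ _ eq → trans (sym (swap-swap x)) (trans (cong swap eq) (swap-swap x′)))
      (count-Count w 0<w n))
    where
    swap : Vec ℕ (2 + l) → Vec ℕ (2 + l)
    swap (x ∷ y ∷ ys) = y ∷ x ∷ ys
    swap-swap : ∀ y → swap (swap y) ≡ y
    swap-swap (x ∷ y ∷ ys) = refl
    total-swap : ∀ w (y : Vec ℕ (2 + l)) → total (swap₀₁ w) (swap y) ≡ total w y
    total-swap w (x ∷ y ∷ ys) = x∙yz≈y∙xz (w (suc zero) * y) (w zero * x) _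
      where open import Algebra.Properties.CommutativeSemigroup NP.+-commutativeSemigroup using (x∙yz≈y∙xz)
    swap-Sol : ∀ y → Sol (swap₀₁ w) n y → Sol w n (swap y)
    swap-Sol (x ∷ y ∷ ys) p = trans (sym (total-swap w (y ∷ x ∷ ys))) p

  -- For a single weight the count is the indicator function of its multiples; `count-single⁻` is
  -- the opposite direction.
  count-single : ∀ (w : Fin 1 → ℕ) (0<w : ∀ i → 0 < w i) q → count w 0<w (w zero * q) ≡ 1
  count-single w 0<w q = Count-unique (count-Count w 0<w (w zero * q))
    ((q ∷ []) ∷ [] , [] ∷ [] , refl , λ { (y ∷ []) → mk⇔
      (λ { (here refl) → NP.+-identityʳ (w zero * q) })
      (λ p → here (cong (_∷ []) (NP.*-cancelˡ-≡ y q (w zero) {{>-nonZero (0<w zero)}}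
        (trans (sym (NP.+-identityʳ (w zero * y))) p)))) })

  count-single⁻ : ∀ (w : Fin 1 → ℕ) (0<w : ∀ i → 0 < w i) n → count w 0<w n ≡ 1 → w zero ∣ n
  count-single⁻ w 0<w n c≡1 with count-Count w 0<w n
  ... | [] , _ , len , _ = contradiction (trans len c≡1) λ ()
  ... | (y ∷ []) ∷ _ , _ , _ , xs⇔ = divides y
    (trans (sym (to (xs⇔ (y ∷ [])) (here refl))) (trans (NP.+-identityʳ (w zero * y)) (NP.*-comm (w zero) y)))

-- Polynomial functions

ℕtoℚ : ℕ → ℚ
ℕtoℚ n = ℤtoℚ (+ n)

module _ where
  open Q

  ℕtoℚ-+ : ∀ a b → ℕtoℚ (a N.+ b) ≡ ℕtoℚ a + ℕtoℚ b
  ℕtoℚ-+ a b = ℤtoℚ-+ (+ a) (+ b)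

  ℕtoℚ-* : ∀ a b → ℕtoℚ (a N.* b) ≡ ℕtoℚ a * ℕtoℚ b
  ℕtoℚ-* a b = trans (cong ℤtoℚ (ZP.pos-* a b)) (ℤtoℚ-* (+ a) (+ b))

  ℕtoℚ-injective : ∀ {a b} → ℕtoℚ a ≡ ℕtoℚ b → a ≡ b
  ℕtoℚ-injective eq = ZP.+-injective (ℤtoℚ-injective eq)

  horner : List ℚ → ℚ → ℚ
  horner []       x = 0ℚ
  horner (c ∷ cs) x = c + x * horner cs x

  -- The coefficients of (p(x) − p(a)) / (x − a) for p = c ∷ cs; they do not depend on c.
  quotient : ℚ → List ℚ → List ℚ
  quotient a []       = []
  quotient a (d ∷ ds) = horner (d ∷ ds) a ∷ quotient a ds

  length-quotient : ∀ a cs → length (quotient a cs) ≡ length cs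
  length-quotient a []       = refl
  length-quotient a (d ∷ ds) = cong suc (length-quotient a ds)

  horner-quotient : ∀ a c cs y →
    horner (c ∷ cs) y ≡ (y - a) * horner (quotient a cs) y + horner (c ∷ cs) a
  horner-quotient a c [] y = eq a c y
    where
    eq : ∀ a c y → c + y * 0ℚ ≡ (y - a) * 0ℚ + (c + a * 0ℚ)
    eq = solve-∀ ℚring
  horner-quotient a c cs@(d ∷ ds) y = begin
    c + y * horner cs y
      ≡⟨ cong (λ h → c + y * h) (horner-quotient a d ds y) ⟩
    c + y * ((y - a) * horner (quotient a ds) y + horner cs a)
      ≡⟨ eq a c y (horner (quotient a ds) y) (horner cs a) ⟩
    (y - a) * (horner cs a + y * horner (quotient a ds) y) + (c + a * horner cs a) ∎
    where
    open ≡-Reasoning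
    eq : ∀ a c y q h → c + y * ((y - a) * q + h) ≡ (y - a) * (h + y * q) + (c + a * h)
    eq = solve-∀ ℚring

  -- Divide by the root `x 0`: the quotient has one coefficient fewer and vanishes at the other,
  -- distinct, roots. The length is a separate argument because the quotient is no sublist of `cs`
  -- on which to recurse.
  infinitely-many-roots : ∀ n cs → length cs ≡ n → (x : ℕ → ℚ) → (∀ {i j} → x i ≡ x j → i ≡ j) →
    (∀ i → horner cs (x i) ≡ 0ℚ) → ∀ y → horner cs y ≡ 0ℚ
  infinitely-many-roots n       []       len  x inj roots y = refl
  infinitely-many-roots (suc n) (c ∷ cs) refl x inj roots y = begin
    horner (c ∷ cs) y
      ≡⟨ horner-quotient (x 0) c cs y ⟩
    (y - x 0) * horner (quotient (x 0) cs) y + horner (c ∷ cs) (x 0)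
      ≡⟨ cong₂ (λ p q → (y - x 0) * p + q)
           (infinitely-many-roots n (quotient (x 0) cs) (length-quotient (x 0) cs) (λ i → x (suc i))
             (λ eq → NP.suc-injective (inj eq)) roots′ y) (roots 0) ⟩
    (y - x 0) * 0ℚ + 0ℚ
      ≡⟨ simp (y - x 0) ⟩
    0ℚ ∎
    where
    open ≡-Reasoning
    simp : ∀ z → z * 0ℚ + 0ℚ ≡ 0ℚ
    simp = solve-∀ ℚring
    recover : ∀ a b → a ≡ a - b + b
    recover = solve-∀ ℚring
    x≢x₀ : ∀ i → x (suc i) - x 0 ≢ 0ℚ
    x≢x₀ i eq = contradiction (inj (trans (recover (x (suc i)) (x 0))
      (trans (cong (_+ x 0) eq) (QP.+-identityˡ (x 0))))) λ ()
    roots′ : ∀ i → horner (quotient (x 0) cs) (x (suc i)) ≡ 0ℚ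
    roots′ i = *-cancelˡ-0 (x≢x₀ i) (begin
      (x (suc i) - x 0) * horner (quotient (x 0) cs) (x (suc i))
        ≡⟨ QP.+-identityʳ _ ⟨
      (x (suc i) - x 0) * horner (quotient (x 0) cs) (x (suc i)) + 0ℚ
        ≡⟨ cong (λ q → (x (suc i) - x 0) * horner (quotient (x 0) cs) (x (suc i)) + q) (roots 0) ⟨
      (x (suc i) - x 0) * horner (quotient (x 0) cs) (x (suc i)) + horner (c ∷ cs) (x 0)
        ≡⟨ horner-quotient (x 0) c cs (x (suc i)) ⟨
      horner (c ∷ cs) (x (suc i))
        ≡⟨ roots (suc i) ⟩
      0ℚ ∎)

  _⊞_ : List ℚ → List ℚ → List ℚ
  []       ⊞ ds       = ds
  (c ∷ cs) ⊞ []       = c ∷ cs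
  (c ∷ cs) ⊞ (d ∷ ds) = (c + d) ∷ (cs ⊞ ds)

  horner-⊞ : ∀ cs ds x → horner (cs ⊞ ds) x ≡ horner cs x + horner ds x
  horner-⊞ []       ds       x = sym (QP.+-identityˡ (horner ds x))
  horner-⊞ (c ∷ cs) []       x = sym (QP.+-identityʳ (horner (c ∷ cs) x))
  horner-⊞ (c ∷ cs) (d ∷ ds) x = trans (cong (λ h → c + d + x * h) (horner-⊞ cs ds x))
    (eq c d x (horner cs x) (horner ds x))
    where
    eq : ∀ c d x h h′ → c + d + x * (h + h′) ≡ c + x * h + (d + x * h′)
    eq = solve-∀ ℚring

  horner-map : ∀ a cs x → horner (map (a *_) cs) x ≡ a * horner cs x
  horner-map a []       x = sym (QP.*-zeroʳ a)
  horner-map a (c ∷ cs) x = trans (cong (λ h → a * c + x * h) (horner-map a cs x)) (eq a c x (horner cs x))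
    where
    eq : ∀ a c x h → a * c + x * (a * h) ≡ a * (c + x * h)
    eq = solve-∀ ℚring

  _⊠_ : List ℚ → List ℚ → List ℚ
  []       ⊠ ds = []
  (c ∷ cs) ⊠ ds = map (c *_) ds ⊞ (0ℚ ∷ (cs ⊠ ds))

  horner-⊠ : ∀ cs ds x → horner (cs ⊠ ds) x ≡ horner cs x * horner ds x
  horner-⊠ []       ds x = sym (QP.*-zeroˡ (horner ds x))
  horner-⊠ (c ∷ cs) ds x = begin
    horner (map (c *_) ds ⊞ (0ℚ ∷ (cs ⊠ ds))) x
      ≡⟨ horner-⊞ (map (c *_) ds) (0ℚ ∷ (cs ⊠ ds)) x ⟩
    horner (map (c *_) ds) x + (0ℚ + x * horner (cs ⊠ ds) x)
      ≡⟨ cong₂ (λ p q → p + (0ℚ + x * q)) (horner-map c ds x) (horner-⊠ cs ds x) ⟩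
    c * horner ds x + (0ℚ + x * (horner cs x * horner ds x))
      ≡⟨ eq c x (horner cs x) (horner ds x) ⟩
    (c + x * horner cs x) * horner ds x ∎
    where
    open ≡-Reasoning
    eq : ∀ c x h h′ → c * h′ + (0ℚ + x * (h * h′)) ≡ (c + x * h) * h′
    eq = solve-∀ ℚring

  PolyFn : (ℕ → ℚ) → Set
  PolyFn f = ∃ λ cs → ∀ t → f t ≡ horner cs (ℕtoℚ t)

  PolyFn-resp : ∀ {f g} → (∀ t → f t ≡ g t) → PolyFn f → PolyFn g
  PolyFn-resp f≡g (cs , f≡cs) = cs , λ t → trans (sym (f≡g t)) (f≡cs t)

  PolyFn-linear : ∀ a b → PolyFn (λ t → a + ℕtoℚ t * b)
  PolyFn-linear a b = a ∷ b ∷ [] , λ t → eq a b (ℕtoℚ t)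
    where
    eq : ∀ a b t → a + t * b ≡ a + t * (b + t * 0ℚ)
    eq = solve-∀ ℚring

  PolyFn-const : ∀ a → PolyFn (λ _ → a)
  PolyFn-const a = a ∷ [] , λ t → eq a (ℕtoℚ t)
    where
    eq : ∀ a t → a ≡ a + t * 0ℚ
    eq = solve-∀ ℚring

  PolyFn-+ : ∀ {f g} → PolyFn f → PolyFn g → PolyFn (λ t → f t + g t)
  PolyFn-+ (cs , f≡) (ds , g≡) = cs ⊞ ds , λ t → trans (cong₂ _+_ (f≡ t) (g≡ t)) (sym (horner-⊞ cs ds (ℕtoℚ t)))

  PolyFn-* : ∀ {f g} → PolyFn f → PolyFn g → PolyFn (λ t → f t * g t)
  PolyFn-* (cs , f≡) (ds , g≡) = cs ⊠ ds , λ t → trans (cong₂ _*_ (f≡ t) (g≡ t)) (sym (horner-⊠ cs ds (ℕtoℚ t)))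

  -- The polynomial `f - v` vanishes at all multiples of `a`, hence identically.
  PolyFn-constant : ∀ {f v} → PolyFn f → ∀ a → 0 N.< a → (∀ t → f (a N.* t) ≡ v) → ∀ t → f t ≡ v
  PolyFn-constant {f} {v} pf a 0<a f≡v t = begin
    f t                 ≡⟨ recover (f t) v ⟩
    f t + - v + v       ≡⟨ cong (_+ v) (trans (g≡ t) (infinitely-many-roots (length cs) cs refl x x-injective roots (ℕtoℚ t))) ⟩
    0ℚ + v              ≡⟨ QP.+-identityˡ v ⟩
    v                   ∎
    where
    open ≡-Reasoning
    recover : ∀ a b → a ≡ a + - b + b
    recover = solve-∀ ℚring
    g = PolyFn-+ pf (PolyFn-const (- v))
    cs = proj₁ g
    g≡ = proj₂ g
    x : ℕ → ℚ
    x i = ℕtoℚ (a N.* i)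
    x-injective : ∀ {i j} → x i ≡ x j → i ≡ j
    x-injective {i} {j} eq = NP.*-cancelˡ-≡ i j a {{N.>-nonZero 0<a}} (ℕtoℚ-injective eq)
    roots : ∀ i → horner cs (x i) ≡ 0ℚ
    roots i = trans (sym (g≡ (a N.* i))) (trans (cong (_+ - v) (f≡v i)) (QP.+-inverseʳ v))

  -- `S` stands for the values that ι takes on `γ ∩ S(A)`: only from such starting points is the
  -- count known to be polynomial along a line.
  PolyAlong : ∀ {l} (w : Fin l → ℕ) → (∀ i → 0 N.< w i) → ℕ → (ℕ → Set) → Set
  PolyAlong w 0<w s S = ∀ n → S n → PolyFn (λ t → ℕtoℚ (count w 0<w (n N.+ t N.* s)))

  -- Differencing n ↦ count w n with step w 0 removes the weight w 0 from the count, so that only the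
  -- weight w u remains in the end: a polynomial in t then tells whether w u divides n + t s.
  PolyAlong⇒∣ : ∀ l (w : Fin (suc l) → ℕ) (0<w : ∀ i → 0 N.< w i) u s (S : ℕ → Set) n₀ →
    (∀ i n → S n → S (w i N.+ n)) → (∀ q → S (suc q N.* n₀)) → PolyAlong w 0<w s S → w u ∣ s
  PolyAlong⇒∣ zero w 0<w zero s S n₀ S-+ S-n₀ poly = ∣m+n∣m⇒∣n
    (subst (w zero ∣_) (cong (w zero N.* n₀ N.+_) (NP.*-identityˡ s))
      (count-single⁻ w 0<w (w zero N.* n₀ N.+ 1 N.* s)
        (ℕtoℚ-injective (PolyFn-constant (poly (w zero N.* n₀) S-wn₀) (w zero) (0<w zero) one 1))))
    (m∣m*n n₀)
    where
    S-wn₀ : S (w zero N.* n₀)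
    S-wn₀ = subst (λ a → S (a N.* n₀)) (NP.suc-pred (w zero) {{N.>-nonZero (0<w zero)}}) (S-n₀ (N.pred (w zero)))
    eq : ∀ a n t s → a N.* n N.+ a N.* t N.* s ≡ a N.* (n N.+ t N.* s)
    eq = ℕSolver.solve-∀
    -- At parameters `w zero * t` the argument is a multiple of the only weight, so the polynomial
    -- is the constant 1; its value at `t = 1` gives the divisibility.
    one : ∀ t → ℕtoℚ (count w 0<w (w zero N.* n₀ N.+ w zero N.* t N.* s)) ≡ 1ℚ
    one t = cong ℕtoℚ (trans (cong (count w 0<w) (eq (w zero) n₀ t s)) (count-single w 0<w (n₀ N.+ t N.* s)))
  PolyAlong⇒∣ (suc l) w 0<w u s S n₀ S-+ S-n₀ poly = by-position u
    where
    drop-head : (w : Fin (2 N.+ l) → ℕ) (0<w : ∀ i → 0 N.< w i) → (∀ i n → S n → S (w i N.+ n)) →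
      PolyAlong w 0<w s S → ∀ u → w (suc u) ∣ s
    drop-head w 0<w S-+ poly u = PolyAlong⇒∣ l (w ∘ suc) (0<w ∘ suc) u s S′ (w zero N.+ n₀)
      (λ { i _ (n , refl , Sn) → w (suc i) N.+ n , swap (w (suc i)) (w zero) n , S-+ (suc i) n Sn })
      -- The base point grows to `w zero + n₀`, so that both ends of the difference stay in `S`.
      -- Only positive multiples are claimed: 0 is not in the shifted set `S′`, whose elements are
      -- at least `w zero`.
      (λ q → q N.* w zero N.+ suc q N.* n₀ , expand q (w zero) n₀ , add-head q (S-n₀ q))
      (λ { _ (n , refl , Sn) → PolyFn-resp (difference n)
        (PolyFn-+ (poly (w zero N.+ n) (S-+ zero n Sn)) (PolyFn-* (PolyFn-const (- 1ℚ)) (poly n Sn))) })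
      where
      S′ : ℕ → Set
      S′ n = ∃ λ n′ → n ≡ w zero N.+ n′ × S n′
      swap : ∀ a b n → a N.+ (b N.+ n) ≡ b N.+ (a N.+ n)
      swap = ℕSolver.solve-∀
      expand : ∀ q a n → suc q N.* (a N.+ n) ≡ a N.+ (q N.* a N.+ suc q N.* n)
      expand = ℕSolver.solve-∀
      add-head : ∀ q {n} → S n → S (q N.* w zero N.+ n)
      add-head zero    Sn = Sn
      add-head (suc q) {n} Sn = subst S (sym (NP.+-assoc (w zero) (q N.* w zero) n)) (S-+ zero _ (add-head q Sn))
      cancel : ∀ a b → a + b + - 1ℚ * a ≡ b
      cancel = solve-∀ ℚring
      difference : ∀ n t →
        ℕtoℚ (count w 0<w (w zero N.+ n N.+ t N.* s)) + - 1ℚ * ℕtoℚ (count w 0<w (n N.+ t N.* s)) ≡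
        ℕtoℚ (count (w ∘ suc) (0<w ∘ suc) (w zero N.+ n N.+ t N.* s))
      difference n t = begin
        ℕtoℚ (count w 0<w (w zero N.+ n N.+ t N.* s)) + - 1ℚ * ℕtoℚ a
          ≡⟨ cong (λ c → ℕtoℚ c + - 1ℚ * ℕtoℚ a)
               (trans (cong (count w 0<w) (NP.+-assoc (w zero) n (t N.* s))) (count-+ w 0<w (n N.+ t N.* s))) ⟩
        ℕtoℚ (a N.+ b) + - 1ℚ * ℕtoℚ a
          ≡⟨ cong (_+ - 1ℚ * ℕtoℚ a) (ℕtoℚ-+ a b) ⟩
        ℕtoℚ a + ℕtoℚ b + - 1ℚ * ℕtoℚ a
          ≡⟨ cancel (ℕtoℚ a) (ℕtoℚ b) ⟩
        ℕtoℚ b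
          ≡⟨ cong (λ n → ℕtoℚ (count (w ∘ suc) (0<w ∘ suc) n)) (NP.+-assoc (w zero) n (t N.* s)) ⟨
        ℕtoℚ (count (w ∘ suc) (0<w ∘ suc) (w zero N.+ n N.+ t N.* s)) ∎
        where
        open ≡-Reasoning
        a = count w 0<w (n N.+ t N.* s)
        b = count (w ∘ suc) (0<w ∘ suc) (w zero N.+ (n N.+ t N.* s))
    all-swap : ∀ {P : ℕ → Set} → (∀ i → P (w i)) → ∀ i → P (swap₀₁ w i)
    all-swap Pw zero          = Pw (suc zero)
    all-swap Pw (suc zero)    = Pw zero
    all-swap Pw (suc (suc i)) = Pw (suc (suc i))
    0<w′ = all-swap {0 N.<_} 0<w
    by-position : ∀ u → w u ∣ s
    by-position (suc u) = drop-head w 0<w S-+ poly u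
    -- The weight to be kept is at the head, where it would be removed; exchanging the first two
    -- weights protects it.
    by-position zero    = drop-head (swap₀₁ w) 0<w′ (all-swap {λ a → ∀ n → S n → S (a N.+ n)} S-+)
      (λ n Sn → PolyFn-resp (λ t → cong ℕtoℚ (sym (count-swap w 0<w 0<w′ (n N.+ t N.* s)))) (poly n Sn)) zero

-- Binomial coefficients and polynomials in several variables

module _ where
  open Q

  -- Pascal's rule at a rational argument. Beyond ring identities it needs only that `v` and `v′`
  -- are the inverses of `r + 1` and `r + 2`, so the ring solver runs before and after a factor 1 is
  -- replaced by `v * (1ℚ + n)`.
  binomℚ-pascal : ∀ x r → binomℚ (x + 1ℚ) (suc r) ≡ binomℚ x r + binomℚ x (suc r)
  binomℚ-pascal x zero    = eq x
    where
    eq : ∀ x → 1ℚ * ((x + 1ℚ - 0ℚ) * 1ℚ) ≡ 1ℚ + 1ℚ * ((x - 0ℚ) * 1ℚ)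
    eq = solve-∀ ℚring
  binomℚ-pascal x (suc r) = begin
    binomℚ (x + 1ℚ) (suc r) * ((x + 1ℚ - ℕtoℚ (suc r)) * v′)
      ≡⟨ cong₂ (λ b n → b * ((x + 1ℚ - n) * v′)) (binomℚ-pascal x r) (ℕtoℚ-+ 1 r) ⟩
    (a + a * ((x - n) * v)) * ((x + 1ℚ - (1ℚ + n)) * v′)
      ≡⟨ ring₁ x n a v v′ ⟩
    a * (x - n) * v′ * 1ℚ + a * (x - n) * v * (x - n) * v′
      ≡⟨ cong (λ q → a * (x - n) * v′ * q + a * (x - n) * v * (x - n) * v′) (v-inverse r) ⟨
    a * (x - n) * v′ * (v * (1ℚ + n)) + a * (x - n) * v * (x - n) * v′
      ≡⟨ ring₂ x n a v v′ ⟩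
    a * ((x - n) * v) * (v′ * (1ℚ + (1ℚ + n))) + a * ((x - n) * v) * ((x - (1ℚ + n)) * v′)
      ≡⟨ cong₂ (λ p q → a * ((x - n) * v) * p + a * ((x - n) * v) * ((x - q) * v′))
           (trans (cong (λ q → v′ * (1ℚ + q)) (sym (ℕtoℚ-+ 1 r))) (v-inverse (suc r))) (sym (ℕtoℚ-+ 1 r)) ⟩
    a * ((x - n) * v) * 1ℚ + a * ((x - n) * v) * ((x - ℕtoℚ (suc r)) * v′)
      ≡⟨ cong (_+ a * ((x - n) * v) * ((x - ℕtoℚ (suc r)) * v′)) (QP.*-identityʳ (a * ((x - n) * v))) ⟩
    a * ((x - n) * v) + a * ((x - n) * v) * ((x - ℕtoℚ (suc r)) * v′) ∎
    where
    open ≡-Reasoning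
    a = binomℚ x r
    n = ℕtoℚ r
    v = + 1 / suc r
    v′ = + 1 / suc (suc r)
    v-inverse : ∀ r → (+ 1 / suc r) * (1ℚ + ℕtoℚ r) ≡ 1ℚ
    v-inverse r = trans (cong ((+ 1 / suc r) *_) (sym (ℕtoℚ-+ 1 r))) (/-*-cancel (+ 1) r)
    ring₁ : ∀ x n a v v′ → (a + a * ((x - n) * v)) * ((x + 1ℚ - (1ℚ + n)) * v′) ≡
      a * (x - n) * v′ * 1ℚ + a * (x - n) * v * (x - n) * v′
    ring₁ = solve-∀ ℚring
    ring₂ : ∀ x n a v v′ → a * (x - n) * v′ * (v * (1ℚ + n)) + a * (x - n) * v * (x - n) * v′ ≡
      a * ((x - n) * v) * (v′ * (1ℚ + (1ℚ + n))) + a * ((x - n) * v) * ((x - (1ℚ + n)) * v′)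
    ring₂ = solve-∀ ℚring

  ℕtoℚ-suc : ∀ n → ℕtoℚ (suc n) ≡ ℕtoℚ n + 1ℚ
  ℕtoℚ-suc n = trans (ℕtoℚ-+ 1 n) (QP.+-comm 1ℚ (ℕtoℚ n))

  binomℚ-diagonal : ∀ r → binomℚ (ℕtoℚ r) r ≡ 1ℚ
  binomℚ-diagonal zero    = refl
  binomℚ-diagonal (suc r) = begin
    binomℚ (ℕtoℚ (suc r)) (suc r)    ≡⟨ cong (λ x → binomℚ x (suc r)) (ℕtoℚ-suc r) ⟩
    binomℚ (ℕtoℚ r + 1ℚ) (suc r)     ≡⟨ binomℚ-pascal (ℕtoℚ r) r ⟩
    b + b * ((ℕtoℚ r - ℕtoℚ r) * (+ 1 / suc r)) ≡⟨ cancel b (ℕtoℚ r) (+ 1 / suc r) ⟩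
    b                                ≡⟨ binomℚ-diagonal r ⟩
    1ℚ                               ∎
    where
    open ≡-Reasoning
    b = binomℚ (ℕtoℚ r) r
    cancel : ∀ b n v → b + b * ((n - n) * v) ≡ b
    cancel = solve-∀ ℚring

  -- Stars and bars by double induction on `m` and `t`: for equal weights the recursion `count-+` is
  -- Pascal's rule.
  count-equal-weights : ∀ m β (0<β : 0 N.< β) t →
    ℕtoℚ (count {suc m} (λ _ → β) (λ _ → 0<β) (β N.* t)) ≡ binomℚ (ℕtoℚ t + ℕtoℚ m) m
  count-equal-weights zero β 0<β t = cong ℕtoℚ (count-single (λ _ → β) (λ _ → 0<β) t)
  count-equal-weights (suc m) β 0<β zero = begin
    ℕtoℚ (count {suc (suc m)} (λ _ → β) (λ _ → 0<β) (β N.* 0))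
      ≡⟨ cong (λ n → ℕtoℚ (count {suc (suc m)} (λ _ → β) (λ _ → 0<β) n)) (NP.*-zeroʳ β) ⟩
    ℕtoℚ (count {suc (suc m)} (λ _ → β) (λ _ → 0<β) 0)
      ≡⟨ cong ℕtoℚ (count-zero {suc (suc m)} (λ _ → β) (λ _ → 0<β)) ⟩
    1ℚ
      ≡⟨ binomℚ-diagonal (suc m) ⟨
    binomℚ (ℕtoℚ (suc m)) (suc m)
      ≡⟨ cong (λ x → binomℚ x (suc m)) (QP.+-identityˡ (ℕtoℚ (suc m))) ⟨
    binomℚ (ℕtoℚ 0 + ℕtoℚ (suc m)) (suc m) ∎
    where open ≡-Reasoning
  count-equal-weights (suc m) β 0<β (suc t) = begin
    ℕtoℚ (c (suc m) (β N.* suc t))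
      ≡⟨ cong (λ n → ℕtoℚ (c (suc m) n)) (NP.*-suc β t) ⟩
    ℕtoℚ (c (suc m) (β N.+ β N.* t))
      ≡⟨ cong ℕtoℚ (count-+ {suc m} (λ _ → β) (λ _ → 0<β) (β N.* t)) ⟩
    ℕtoℚ (c (suc m) (β N.* t) N.+ c m (β N.+ β N.* t))
      ≡⟨ cong (λ n → ℕtoℚ (c (suc m) (β N.* t) N.+ c m n)) (sym (NP.*-suc β t)) ⟩
    ℕtoℚ (c (suc m) (β N.* t) N.+ c m (β N.* suc t))
      ≡⟨ ℕtoℚ-+ (c (suc m) (β N.* t)) (c m (β N.* suc t)) ⟩
    ℕtoℚ (c (suc m) (β N.* t)) + ℕtoℚ (c m (β N.* suc t))
      ≡⟨ cong₂ _+_ (count-equal-weights (suc m) β 0<β t) (count-equal-weights m β 0<β (suc t)) ⟩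
    binomℚ x (suc m) + binomℚ (ℕtoℚ (suc t) + ℕtoℚ m) m
      ≡⟨ cong (λ y → binomℚ x (suc m) + binomℚ y m)
           (trans (cong (_+ ℕtoℚ m) (ℕtoℚ-suc t))
             (trans (shift (ℕtoℚ t) (ℕtoℚ m)) (cong (λ y → ℕtoℚ t + y) (sym (ℕtoℚ-suc m))))) ⟩
    binomℚ x (suc m) + binomℚ x m
      ≡⟨ QP.+-comm (binomℚ x (suc m)) (binomℚ x m) ⟩
    binomℚ x m + binomℚ x (suc m)
      ≡⟨ binomℚ-pascal x m ⟨
    binomℚ (x + 1ℚ) (suc m)
      ≡⟨ cong (λ y → binomℚ y (suc m))
           (trans (shift′ (ℕtoℚ t) (ℕtoℚ (suc m))) (cong (_+ ℕtoℚ (suc m)) (sym (ℕtoℚ-suc t)))) ⟩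
    binomℚ (ℕtoℚ (suc t) + ℕtoℚ (suc m)) (suc m) ∎
    where
    open ≡-Reasoning
    c : ∀ m → ℕ → ℕ
    c m = count {suc m} (λ _ → β) (λ _ → 0<β)
    x = ℕtoℚ t + ℕtoℚ (suc m)
    shift : ∀ t m → t + 1ℚ + m ≡ t + (m + 1ℚ)
    shift = solve-∀ ℚring
    shift′ : ∀ t m → t + m + 1ℚ ≡ t + 1ℚ + m
    shift′ = solve-∀ ℚring

  count-cong : ∀ {l} (w w′ : Fin l → ℕ) 0<w 0<w′ → (∀ i → w i ≡ w′ i) → ∀ n → count w 0<w n ≡ count w′ 0<w′ n
  count-cong w w′ 0<w 0<w′ w≡w′ n = Count-unique (count-Count w 0<w n)
    (Count-resp (λ y p → trans (total-cong w w′ w≡w′ y) p) (λ y p → trans (sym (total-cong w w′ w≡w′ y)) p)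
      (count-Count w′ 0<w′ n))
    where
    total-cong : ∀ {l} (w w′ : Fin l → ℕ) → (∀ i → w i ≡ w′ i) → ∀ y → total w y ≡ total w′ y
    total-cong w w′ w≡w′ []       = refl
    total-cong w w′ w≡w′ (y ∷ ys) = cong₂ (λ a b → a N.* y N.+ b) (w≡w′ zero)
      (total-cong (w ∘ suc) (w′ ∘ suc) (w≡w′ ∘ suc) ys)

  powℚ-+ : ∀ q a b → powℚ q (a N.+ b) ≡ powℚ q a * powℚ q b
  powℚ-+ q zero    b = sym (QP.*-identityˡ (powℚ q b))
  powℚ-+ q (suc a) b = trans (cong (q *_) (powℚ-+ q a b)) (sym (QP.*-assoc q (powℚ q a) (powℚ q b)))

  prodℚ-cong : ∀ {n} {f g : Fin n → ℚ} → (∀ i → f i ≡ g i) → prodℚ f ≡ prodℚ g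
  prodℚ-cong {zero}  f≡g = refl
  prodℚ-cong {suc n} f≡g = cong₂ _*_ (f≡g zero) (prodℚ-cong (λ i → f≡g (suc i)))

  prodℚ-one : ∀ {n} {f : Fin n → ℚ} → (∀ i → f i ≡ 1ℚ) → prodℚ f ≡ 1ℚ
  prodℚ-one {zero}  f≡1 = refl
  prodℚ-one {suc n} f≡1 = cong₂ _*_ (f≡1 zero) (prodℚ-one (λ i → f≡1 (suc i)))

  prodℚ-* : ∀ {n} (f g : Fin n → ℚ) → prodℚ (λ i → f i * g i) ≡ prodℚ f * prodℚ g
  prodℚ-* {zero}  f g = refl
  prodℚ-* {suc n} f g = trans (cong (f zero * g zero *_) (prodℚ-* (λ i → f (suc i)) (λ i → g (suc i))))
    (eq (f zero) (g zero) _ _)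
    where
    eq : ∀ a b c d → a * b * (c * d) ≡ a * c * (b * d)
    eq = solve-∀ ℚring

  -- Closure under sums and products produces a `Poly` for the binomial formula without writing out
  -- its monomials.
  PolyMap : ∀ {d} → ((Fin d → ℚ) → ℚ) → Set
  PolyMap f = ∃ λ p → ∀ x → evalPoly p x ≡ f x

  evalPoly-++ : ∀ {d} (p q : Poly d) x → evalPoly (p ++ q) x ≡ evalPoly p x + evalPoly q x
  evalPoly-++ []            q x = sym (QP.+-identityˡ (evalPoly q x))
  evalPoly-++ ((c , e) ∷ p) q x = trans (cong (λ s → c * prodℚ (λ r → powℚ (x r) (e r)) + s) (evalPoly-++ p q x))
    (sym (QP.+-assoc (c * prodℚ (λ r → powℚ (x r) (e r))) (evalPoly p x) (evalPoly q x)))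

  PolyMap-+ : ∀ {d} {f g : (Fin d → ℚ) → ℚ} → PolyMap f → PolyMap g → PolyMap (λ x → f x + g x)
  PolyMap-+ (p , p≡f) (q , q≡g) = p ++ q , λ x → trans (evalPoly-++ p q x) (cong₂ _+_ (p≡f x) (q≡g x))

  mulTerm : ∀ {d} → ℚ × (Fin d → ℕ) → Poly d → Poly d
  mulTerm (c , e) = map (λ (c′ , e′) → c * c′ , λ r → e r N.+ e′ r)

  evalPoly-mulTerm : ∀ {d} c (e : Fin d → ℕ) q x →
    evalPoly (mulTerm (c , e) q) x ≡ c * prodℚ (λ r → powℚ (x r) (e r)) * evalPoly q x
  evalPoly-mulTerm c e []              x = sym (QP.*-zeroʳ (c * prodℚ (λ r → powℚ (x r) (e r))))
  evalPoly-mulTerm c e ((c′ , e′) ∷ q) x = begin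
    c * c′ * prodℚ (λ r → powℚ (x r) (e r N.+ e′ r)) + evalPoly (mulTerm (c , e) q) x
      ≡⟨ cong₂ (λ a b → c * c′ * a + b)
           (trans (prodℚ-cong (λ r → powℚ-+ (x r) (e r) (e′ r))) (prodℚ-* (λ r → powℚ (x r) (e r)) (λ r → powℚ (x r) (e′ r))))
           (evalPoly-mulTerm c e q x) ⟩
    c * c′ * (a * a′) + c * a * evalPoly q x
      ≡⟨ eq c c′ a a′ (evalPoly q x) ⟩
    c * a * (c′ * a′ + evalPoly q x) ∎
    where
    open ≡-Reasoning
    a = prodℚ (λ r → powℚ (x r) (e r))
    a′ = prodℚ (λ r → powℚ (x r) (e′ r))
    eq : ∀ c c′ a a′ q → c * c′ * (a * a′) + c * a * q ≡ c * a * (c′ * a′ + q)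
    eq = solve-∀ ℚring

  mulPoly : ∀ {d} → Poly d → Poly d → Poly d
  mulPoly []      q = []
  mulPoly (t ∷ p) q = mulTerm t q ++ mulPoly p q

  evalPoly-mulPoly : ∀ {d} (p q : Poly d) x → evalPoly (mulPoly p q) x ≡ evalPoly p x * evalPoly q x
  evalPoly-mulPoly []            q x = sym (QP.*-zeroˡ (evalPoly q x))
  evalPoly-mulPoly ((c , e) ∷ p) q x = begin
    evalPoly (mulTerm (c , e) q ++ mulPoly p q) x
      ≡⟨ evalPoly-++ (mulTerm (c , e) q) (mulPoly p q) x ⟩
    evalPoly (mulTerm (c , e) q) x + evalPoly (mulPoly p q) x
      ≡⟨ cong₂ _+_ (evalPoly-mulTerm c e q x) (evalPoly-mulPoly p q x) ⟩
    c * a * evalPoly q x + evalPoly p x * evalPoly q x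
      ≡⟨ QP.*-distribʳ-+ (evalPoly q x) (c * a) (evalPoly p x) ⟨
    (c * a + evalPoly p x) * evalPoly q x ∎
    where
    open ≡-Reasoning
    a = prodℚ (λ r → powℚ (x r) (e r))

  PolyMap-* : ∀ {d} {f g : (Fin d → ℚ) → ℚ} → PolyMap f → PolyMap g → PolyMap (λ x → f x * g x)
  PolyMap-* (p , p≡f) (q , q≡g) = mulPoly p q , λ x → trans (evalPoly-mulPoly p q x) (cong₂ _*_ (p≡f x) (q≡g x))

  PolyMap-const : ∀ {d} c → PolyMap {d} (λ _ → c)
  PolyMap-const c = (c , λ _ → 0) ∷ [] ,
    λ x → trans (cong (λ q → c * q + 0ℚ) (prodℚ-one {f = λ r → powℚ (x r) 0} (λ _ → refl))) (eq c)
    where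
    eq : ∀ c → c * 1ℚ + 0ℚ ≡ c
    eq = solve-∀ ℚring

  PolyMap-coordinate : ∀ {d} (r : Fin d) → PolyMap (λ x → x r)
  PolyMap-coordinate r = (1ℚ , unit r) ∷ [] ,
    λ x → trans (cong (λ q → 1ℚ * q + 0ℚ) (prod-unit r x)) (eq (x r))
    where
    unit : ∀ {d} → Fin d → Fin d → ℕ
    unit zero    zero    = 1
    unit zero    (suc j) = 0
    unit (suc r) zero    = 0
    unit (suc r) (suc j) = unit r j
    prod-unit : ∀ {d} (r : Fin d) (x : Fin d → ℚ) → prodℚ (λ j → powℚ (x j) (unit r j)) ≡ x r
    prod-unit zero    x = trans (cong (x zero * 1ℚ *_) (prodℚ-one {f = λ j → powℚ (x (suc j)) 0} (λ _ → refl))) (one (x zero))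
      where
      one : ∀ q → q * 1ℚ * 1ℚ ≡ q
      one = solve-∀ ℚring
    prod-unit (suc r) x = trans (QP.*-identityˡ _) (prod-unit r (λ j → x (suc j)))
    eq : ∀ q → 1ℚ * q + 0ℚ ≡ q
    eq = solve-∀ ℚring

  PolyMap-sum : ∀ {d n} {f : Fin n → (Fin d → ℚ) → ℚ} → (∀ i → PolyMap (f i)) → PolyMap (λ x → sumℚ (λ i → f i x))
  PolyMap-sum {n = zero}  pf = PolyMap-const 0ℚ
  PolyMap-sum {n = suc n} pf = PolyMap-+ (pf zero) (PolyMap-sum (λ i → pf (suc i)))

  PolyMap-binomℚ : ∀ {d} {f : (Fin d → ℚ) → ℚ} → PolyMap f → ∀ r → PolyMap (λ x → binomℚ (f x) r)
  PolyMap-binomℚ pf zero    = PolyMap-const 1ℚ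
  PolyMap-binomℚ pf (suc r) = PolyMap-* (PolyMap-binomℚ pf r)
    (PolyMap-* (PolyMap-+ pf (PolyMap-const (- ℕtoℚ r))) (PolyMap-const (+ 1 / suc r)))

  PolyFn-pow : ∀ {f} → PolyFn f → ∀ e → PolyFn (λ t → powℚ (f t) e)
  PolyFn-pow pf zero    = PolyFn-const 1ℚ
  PolyFn-pow pf (suc e) = PolyFn-* pf (PolyFn-pow pf e)

  PolyFn-prod : ∀ {n} {f : Fin n → ℕ → ℚ} → (∀ i → PolyFn (f i)) → PolyFn (λ t → prodℚ (λ i → f i t))
  PolyFn-prod {zero}  pf = PolyFn-const 1ℚ
  PolyFn-prod {suc n} pf = PolyFn-* (pf zero) (PolyFn-prod (λ i → pf (suc i)))

  PolyFn-line : ∀ {d} (p : Poly d) (b e : Fin d → ℤ) →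
    PolyFn (λ t → evalPoly p (toℚv (λ r → b r Z.+ + t Z.* e r)))
  PolyFn-line []            b e = PolyFn-const 0ℚ
  PolyFn-line ((c , x) ∷ p) b e = PolyFn-+
    (PolyFn-* (PolyFn-const c) (PolyFn-prod (λ r → PolyFn-pow (coordinate r) (x r)))) (PolyFn-line p b e)
    where
    coordinate : ∀ r → PolyFn (λ t → ℤtoℚ (b r Z.+ + t Z.* e r))
    coordinate r = PolyFn-resp
      (λ t → sym (trans (ℤtoℚ-+ (b r) (+ t Z.* e r)) (cong (λ s → ℤtoℚ (b r) + s) (ℤtoℚ-* (+ t) (e r)))))
      (PolyFn-linear (ℤtoℚ (b r)) (ℤtoℚ (e r)))

-- Determinants

module _ where
  open Z using (_+_; _*_; -_)
  open ≡-Reasoning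

  alt : ℕ → ℤ
  alt zero    = + 1
  alt (suc n) = - alt n

  minor : ∀ {d} → (Fin (suc d) → Fin (suc d) → ℤ) → Fin (suc d) → Fin (suc d) → Fin d → Fin d → ℤ
  minor M i j r c = M (F.punchIn i r) (F.punchIn j c)

  mutual
    det-column : ∀ {d} (M : Fin (suc d) → Fin (suc d) → ℤ) →
      det M ≡ sumℤ (λ i → alt (F.toℕ i) * (M i zero * det (minor M i zero)))
    det-column M = cong (λ s → + 1 * (M zero zero * det (minor M zero zero)) + s) (Σℤ.sum-cong (det-column-term M))

    -- The left-hand side, left to unification, contains a local function of det that has no name here.
    det-column-term : ∀ {d} (M : Fin (suc d) → Fin (suc d) → ℤ) i →
      _ ≡ alt (suc (F.toℕ i)) * (M (suc i) zero * det (minor M (suc i) zero))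
    det-column-term M i with F.toℕ i
    ... | n = det-sign M i n

    -- The exponent `n` is detached from the row `i`, so that the induction can descend by two, as
    -- the sign in `det` does, while the entry and the minor stay fixed.
    det-sign : ∀ {d} (M : Fin (suc d) → Fin (suc d) → ℤ) i n →
      _ ≡ alt (suc n) * (M (suc i) zero * det (minor M (suc i) zero))
    det-sign M i zero          = refl
    det-sign M i (suc zero)    = refl
    det-sign M i (suc (suc n)) = trans (det-sign M i n)
      (cong (_* (M (suc i) zero * det (minor M (suc i) zero))) (sym (ZP.neg-involutive (alt (suc n)))))

  det-cong : ∀ {d} {M M′ : Fin d → Fin d → ℤ} → (∀ r c → M r c ≡ M′ r c) → det M ≡ det M′
  det-cong {zero}  eq = refl
  det-cong {suc d} {M} {M′} eq = begin
    det M
      ≡⟨ det-column M ⟩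
    sumℤ (λ i → alt (F.toℕ i) * (M i zero * det (minor M i zero)))
      ≡⟨ Σℤ.sum-cong (λ i → cong₂ (λ a b → alt (F.toℕ i) * (a * b)) (eq i zero)
           (det-cong (λ r c → eq (F.punchIn i r) (suc c)))) ⟩
    sumℤ (λ i → alt (F.toℕ i) * (M′ i zero * det (minor M′ i zero)))
      ≡⟨ det-column M′ ⟨
    det M′ ∎

  -- `det` expands along the first column, where an exchange of columns is hard to follow. Expanding
  -- the minors along their first row by induction and interchanging the double sum leaves the
  -- column expansions of the minors of the first row.
  det-row : ∀ {d} (M : Fin (suc d) → Fin (suc d) → ℤ) →
    det M ≡ sumℤ (λ j → alt (F.toℕ j) * (M zero j * det (minor M zero j)))
  det-row {zero}  M = det-column M
  det-row {suc d} M = trans (det-column M)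
    (cong (λ s → + 1 * (M zero zero * det (minor M zero zero)) + s) (begin
      sumℤ (λ i → alt (suc (F.toℕ i)) * (x i * det (minor M (suc i) zero)))
        ≡⟨ Σℤ.sum-cong (λ i → trans (cong (λ s → alt (suc (F.toℕ i)) * (x i * s)) (det-row (minor M (suc i) zero)))
             (spread (alt (F.toℕ i)) (x i) (λ j → alt (F.toℕ j) * (y j * D i j)))) ⟩
      sumℤ (λ i → sumℤ (λ j → - alt (F.toℕ i) * x i * (alt (F.toℕ j) * (y j * D i j))))
        ≡⟨ Σℤ.sum-comm (λ i j → - alt (F.toℕ i) * x i * (alt (F.toℕ j) * (y j * D i j))) ⟩
      sumℤ (λ j → sumℤ (λ i → - alt (F.toℕ i) * x i * (alt (F.toℕ j) * (y j * D i j))))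
        ≡⟨ Σℤ.sum-cong (λ j → Σℤ.sum-cong (λ i → exchange (alt (F.toℕ i)) (x i) (alt (F.toℕ j)) (y j) (D i j))) ⟩
      sumℤ (λ j → sumℤ (λ i → - alt (F.toℕ j) * y j * (alt (F.toℕ i) * (x i * D i j))))
        ≡⟨ Σℤ.sum-cong (λ j → trans (cong (λ s → alt (suc (F.toℕ j)) * (y j * s)) (det-column (minor M zero (suc j))))
             (spread (alt (F.toℕ j)) (y j) (λ i → alt (F.toℕ i) * (x i * D i j)))) ⟨
      sumℤ (λ j → alt (suc (F.toℕ j)) * (y j * det (minor M zero (suc j)))) ∎))
    where
    x y : Fin (suc d) → ℤ
    x i = M (suc i) zero
    y j = M zero (suc j)
    D : Fin (suc d) → Fin (suc d) → ℤ
    D i j = det (λ r c → M (suc (F.punchIn i r)) (suc (F.punchIn j c)))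
    spread : ∀ s a (f : Fin (suc d) → ℤ) → - s * (a * sumℤ f) ≡ sumℤ (λ i → - s * a * f i)
    spread s a f = trans (sym (ZP.*-assoc (- s) a (sumℤ f))) (sym (Σℤ.sum-* (- s * a) f))
    exchange : ∀ s a s′ b D → - s * a * (s′ * (b * D)) ≡ - s′ * b * (s * (a * D))
    exchange = ℤSolver.solve-∀

  -- In the row expansion the first two terms trade places and hence signs; in every other minor the
  -- first two columns are exchanged, and induction applies.
  det-swap : ∀ {d} (M : Fin (2 N.+ d) → Fin (2 N.+ d) → ℤ) → det (λ r → swap₀₁ (M r)) ≡ - det M
  det-swap {d} M = begin
    det M′
      ≡⟨ det-row M′ ⟩
    + 1 * (M zero (suc zero) * det (minor M′ zero zero)) +
      (- + 1 * (M zero zero * det (minor M′ zero (suc zero))) + sumℤ (λ j → tail-term M′ j))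
      ≡⟨ cong₂ (λ a b → + 1 * (M zero (suc zero) * a) + b) (det-cong minor₀)
           (cong₂ (λ a b → - + 1 * (M zero zero * a) + b) (det-cong minor₁)
             (trans (Σℤ.sum-cong tail) (Σℤ.sum-* (- + 1) (tail-term M)))) ⟩
    + 1 * (M zero (suc zero) * D₁) + (- + 1 * (M zero zero * D₀) + - + 1 * sumℤ (tail-term M))
      ≡⟨ negate (M zero zero) D₀ (M zero (suc zero)) D₁ (sumℤ (tail-term M)) ⟩
    - (+ 1 * (M zero zero * D₀) + (- + 1 * (M zero (suc zero) * D₁) + sumℤ (tail-term M)))
      ≡⟨ cong -_ (det-row M) ⟨
    - det M ∎
    where
    M′ : Fin (2 N.+ d) → Fin (2 N.+ d) → ℤ
    M′ r = swap₀₁ (M r)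
    D₀ = det (minor M zero zero)
    D₁ = det (minor M zero (suc zero))
    tail-term : (Fin (2 N.+ d) → Fin (2 N.+ d) → ℤ) → Fin d → ℤ
    tail-term M j = alt (F.toℕ (suc (suc j))) * (M zero (suc (suc j)) * det (minor M zero (suc (suc j))))
    minor₀ : ∀ r c → minor M′ zero zero r c ≡ minor M zero (suc zero) r c
    minor₀ r zero    = refl
    minor₀ r (suc c) = refl
    minor₁ : ∀ r c → minor M′ zero (suc zero) r c ≡ minor M zero zero r c
    minor₁ r zero    = refl
    minor₁ r (suc c) = refl
    negate : ∀ a D₀ b D₁ t → + 1 * (b * D₁) + (- + 1 * (a * D₀) + - + 1 * t) ≡
      - (+ 1 * (a * D₀) + (- + 1 * (b * D₁) + t))
    negate = ℤSolver.solve-∀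
    pull : ∀ s a D → s * (a * - D) ≡ - + 1 * (s * (a * D))
    pull = ℤSolver.solve-∀
    swap-minor : ∀ {d} (M : Fin (2 N.+ d) → Fin (2 N.+ d) → ℤ) (j : Fin d) →
      det (minor (λ r → swap₀₁ (M r)) zero (suc (suc j))) ≡ - det (minor M zero (suc (suc j)))
    swap-minor {suc d} M j = trans (det-cong commute) (det-swap (minor M zero (suc (suc j))))
      where
      commute : ∀ r c → minor (λ r → swap₀₁ (M r)) zero (suc (suc j)) r c ≡ swap₀₁ (minor M zero (suc (suc j)) r) c
      commute r zero          = refl
      commute r (suc zero)    = refl
      commute r (suc (suc c)) = refl
    tail : ∀ j → tail-term M′ j ≡ - + 1 * tail-term M j
    tail j = trans (cong (λ D → alt (F.toℕ (suc (suc j))) * (M zero (suc (suc j)) * D)) (swap-minor M j))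
      (pull (alt (F.toℕ (suc (suc j)))) (M zero (suc (suc j))) (det (minor M zero (suc (suc j)))))

  *-cancel-alt : ∀ n x → alt n * x ≡ + 0 → x ≡ + 0
  *-cancel-alt zero    x eq = trans (sym (ZP.*-identityˡ x)) eq
  *-cancel-alt (suc n) x eq = *-cancel-alt n x (ZP.neg-injective (trans (ZP.neg-distribˡ-* (alt n) x) eq))

  self-negative : ∀ z → z ≡ - z → z ≡ + 0
  self-negative (+ zero)   eq = refl
  self-negative (+ suc n)  ()
  self-negative (-[1+ n ]) ()

  -- Equal first and second columns make the determinant its own negative. If both columns come
  -- after the first, each minor of the column expansion has equal columns. If only one is the
  -- first, exchanging the first two columns leads back to that case.
  det-equal-columns : ∀ {d} (M : Fin d → Fin d → ℤ) i j → i ≢ j → (∀ r → M r i ≡ M r j) → det M ≡ + 0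
  det-equal-columns {suc d} M = cases
    where
    later : (M : Fin (suc d) → Fin (suc d) → ℤ) → ∀ i j → i ≢ j → (∀ r → M r (suc i) ≡ M r (suc j)) → det M ≡ + 0
    later M i j i≢j eq = trans (det-column M) (Σℤ.sum-zero (λ l →
      trans (cong (λ D → alt (F.toℕ l) * (M l zero * D))
              (det-equal-columns (minor M l zero) i j i≢j (λ r → eq (F.punchIn l r))))
        (vanish (alt (F.toℕ l)) (M l zero))))
      where
      vanish : ∀ s a → s * (a * + 0) ≡ + 0
      vanish = ℤSolver.solve-∀
    first : ∀ {d′} → d ≡ d′ → ∀ j → (∀ r → M r zero ≡ M r (suc j)) → det M ≡ + 0
    first {suc d′} refl zero    eq = self-negative (det M) (trans (det-cong same) (det-swap M))
      where
      same : ∀ r c → M r c ≡ swap₀₁ (M r) c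
      same r zero          = eq r
      same r (suc zero)    = sym (eq r)
      same r (suc (suc c)) = refl
    first {suc d′} refl (suc j) eq = begin
      det M                             ≡⟨ ZP.neg-involutive (det M) ⟨
      - - det M                         ≡⟨ cong -_ (det-swap M) ⟨
      - det (λ r → swap₀₁ (M r))        ≡⟨ cong -_ (later (λ r → swap₀₁ (M r)) zero (suc j) (λ ()) eq) ⟩
      - + 0                             ∎
    cases : ∀ i j → i ≢ j → (∀ r → M r i ≡ M r j) → det M ≡ + 0
    cases zero    zero    i≢j eq = contradiction refl i≢j
    cases zero    (suc j) i≢j eq = first refl j eq
    cases (suc i) zero    i≢j eq = first refl i (λ r → sym (eq r))
    cases (suc i) (suc j) i≢j eq = later M i j (λ i≡j → i≢j (cong suc i≡j)) eq

  cofactor : ∀ {d} → (Fin (suc d) → Fin (suc d) → ℤ) → Fin (suc d) → ℤ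
  cofactor M i = alt (F.toℕ i) * det (minor M i zero)

  -- Expanding, along the first column, the matrix in which column c has replaced the first one.
  cofactor-orthogonal : ∀ {d} (M : Fin (suc d) → Fin (suc d) → ℤ) → det M ≡ + 0 →
    ∀ c → dotℤ (cofactor M) (λ r → M r c) ≡ + 0
  cofactor-orthogonal {d} M det≡0 c = trans (sym expansion) (vanish c)
    where
    M′ : Fin (suc d) → Fin (suc d) → Fin (suc d) → ℤ
    M′ c r zero     = M r c
    M′ c r (suc c′) = M r (suc c′)
    reorder : ∀ s D m → s * (m * D) ≡ s * D * m
    reorder = ℤSolver.solve-∀
    expansion : det (M′ c) ≡ dotℤ (cofactor M) (λ r → M r c)
    expansion = trans (det-column (M′ c))
      (Σℤ.sum-cong (λ i → reorder (alt (F.toℕ i)) (det (minor M i zero)) (M i c)))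
    vanish : ∀ c → det (M′ c) ≡ + 0
    vanish zero    = trans (det-cong {M = M′ zero} {M′ = M} (λ { r zero → refl ; r (suc c) → refl })) det≡0
    vanish (suc c) = det-equal-columns (M′ (suc c)) zero (suc c) (λ ()) (λ r → refl)

-- If the determinant were 0, the cofactor vector would be orthogonal to a basis, so all minors
-- along the first column would vanish. One of them, however, still has independent columns, against
-- the induction hypothesis: the one omitting a row `i` where a normal `n` of the other columns has
-- a nonzero entry.
LinIndep⇒det≢0 : ∀ {d} (M : Fin d → Fin d → ℤ) → LinIndep (λ c → toℚv (λ r → M r c)) → det M ≢ + 0
LinIndep⇒det≢0 {zero}  M indep ()
LinIndep⇒det≢0 {suc d} M indep det≡0 = LinIndep⇒det≢0 (minor M i zero) minor-indep minor≡0
  where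
  open Q
  column : Fin (suc d) → Fin (suc d) → ℚ
  column c = toℚv (λ r → M r c)
  cofactor≡0 : ∀ r → ℤtoℚ (cofactor M r) ≡ 0ℚ
  cofactor≡0 = dot-basis-zero (toℚv (cofactor M)) column indep
    (λ c → trans (sym (ℤtoℚ-dot (cofactor M) (λ r → M r c))) (cong ℤtoℚ (cofactor-orthogonal M det≡0 c)))
  -- The rows of the last `d` columns are `d + 1` vectors with `d` entries; a dependence among them
  -- is a nonzero vector orthogonal to those columns.
  normal = dependent d (λ r c → ℤtoℚ (M r (suc c)))
  n = proj₁ normal
  i = proj₁ (proj₁ (proj₂ normal))
  nᵢ≢0 = proj₂ (proj₁ (proj₂ normal))
  n⊥ = proj₂ (proj₂ normal)
  minor≡0 : det (minor M i zero) ≡ + 0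
  minor≡0 = *-cancel-alt (F.toℕ i) (det (minor M i zero)) (ℤtoℚ-injective (cofactor≡0 i))
  -- The coordinate i of a combination x of the last columns is determined by the others, as n · x = 0 and n i ≢ 0.
  minor-indep : LinIndep (λ c → toℚv (λ r → minor M i zero r c))
  minor-indep c rel j = indep (0ℚ VF.∷ c) rel′ (suc j)
    where
    open ≡-Reasoning
    x : Fin (suc d) → ℚ
    x = lincomb c (λ j → column (suc j))
    n·x≡0 : dotℚ n x ≡ 0ℚ
    n·x≡0 = trans (dot-lincomb n c (λ j → column (suc j)) (λ _ → refl))
      (Σℚ.sum-zero (λ j → trans (cong (c j *_) (n⊥ j)) (QP.*-zeroʳ (c j))))
    xᵢ≡0 : x i ≡ 0ℚ
    xᵢ≡0 = *-cancelˡ-0 nᵢ≢0 (begin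
      n i * x i
        ≡⟨ QP.+-identityʳ (n i * x i) ⟨
      n i * x i + 0ℚ
        ≡⟨ cong (λ s → n i * x i + s) (Σℚ.sum-zero (λ r → trans (cong (n (F.punchIn i r) *_) (rel r)) (QP.*-zeroʳ (n (F.punchIn i r))))) ⟨
      n i * x i + sumℚ (λ r → n (F.punchIn i r) * x (F.punchIn i r))
        ≡⟨ Σℚ.sum-remove i (λ r → n r * x r) ⟨
      dotℚ n x
        ≡⟨ n·x≡0 ⟩
      0ℚ ∎)
    x≡0 : ∀ r → x r ≡ 0ℚ
    x≡0 r = by-cases (i FP.≟ r)
      where
      by-cases : Dec (i ≡ r) → x r ≡ 0ℚ
      by-cases (yes i≡r) = trans (cong x (sym i≡r)) xᵢ≡0
      by-cases (no i≢r)  = trans (cong x (sym (FP.punchIn-punchOut i≢r))) (rel (F.punchOut i≢r))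
    rel′ : ∀ r → lincomb (0ℚ VF.∷ c) column r ≡ 0ℚ
    rel′ r = cong₂ _+_ (QP.*-zeroˡ (column zero r)) (x≡0 r)

module _ where
  open Z using (_+_; _*_; -_)
  open ≡-Reasoning

  colsMatrix : ∀ {k} → (Fin k → Fin (suc k) → ℤ) → (Fin (suc k) → ℤ) → Fin (suc k) → Fin (suc k) → ℤ
  colsMatrix u v r c = Maybe.maybe (λ c′ → u c′ r) (v r) (lastSplit c)

  -- The variable column stands last, whereas `det` expands along the first: induction peels off the
  -- fixed columns until only `v` is left.
  detCols-linear : ∀ {k} (u : Fin k → Fin (suc k) → ℤ) → ∃ λ δ → ∀ v → detCols u v ≡ dotℤ δ v
  detCols-linear {zero}  u = (λ _ → + 1) , λ v → trans (det-column (colsMatrix u v)) (eq (v zero))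
    where
    eq : ∀ x → + 1 * (x * + 1) + + 0 ≡ + 1 * x + + 0
    eq = ℤSolver.solve-∀
  detCols-linear {suc k} u = δ , λ v → begin
    detCols u v
      ≡⟨ det-column (colsMatrix u v) ⟩
    sumℤ (λ i → alt (F.toℕ i) * (u zero i * det (minor (colsMatrix u v) i zero)))
      ≡⟨ Σℤ.sum-cong (λ i → trans (cong (λ D → alt (F.toℕ i) * (u zero i * D)) (det-minor i v))
           (sym (ZP.*-assoc (alt (F.toℕ i)) (u zero i) (dotℤ (δ′ i) v)))) ⟩
    sumℤ (λ i → a i * dotℤ (δ′ i) v)
      ≡⟨ Σℤ.sum-cong (λ i → cong (a i *_) (Σℤ.sum-cong (λ r → ZP.*-comm (δ′ i r) (v r)))) ⟩
    sumℤ (λ i → a i * sumℤ (λ r → v r * δ′ i r))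
      ≡⟨ Σℤ.dot-comb v a δ′ ⟨
    sumℤ (λ r → v r * sumℤ (λ i → a i * δ′ i r))
      ≡⟨ Σℤ.sum-cong (λ r → ZP.*-comm (v r) (δ r)) ⟩
    dotℤ δ v ∎
    where
    u′ : Fin (suc (suc k)) → Fin k → Fin (suc k) → ℤ
    u′ i c r = u (suc c) (F.punchIn i r)
    ih : ∀ i → ∃ λ δ → ∀ v → detCols (u′ i) v ≡ dotℤ δ v
    ih i = detCols-linear (u′ i)
    a : Fin (suc (suc k)) → ℤ
    a i = alt (F.toℕ i) * u zero i
    -- The minor at `i` does not see row `i`, so its functional gets the coefficient 0 there.
    δ′ : Fin (suc (suc k)) → Fin (suc (suc k)) → ℤ
    δ′ i = VF.insertAt (proj₁ (ih i)) i (+ 0)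
    δ : Fin (suc (suc k)) → ℤ
    δ r = sumℤ (λ i → a i * δ′ i r)
    maybe-map : ∀ {k} {X : Set} (x : Maybe (Fin k)) (f : Fin (suc k) → X) y →
      Maybe.maybe {B = λ _ → X} f y (Maybe.map suc x) ≡ Maybe.maybe (f ∘ suc) y x
    maybe-map (just _) f y = refl
    maybe-map nothing  f y = refl
    extend : ∀ i v → dotℤ (proj₁ (ih i)) (v ∘ F.punchIn i) ≡ dotℤ (δ′ i) v
    extend i v = sym (begin
      dotℤ (δ′ i) v
        ≡⟨ Σℤ.sum-remove i (λ r → δ′ i r * v r) ⟩
      δ′ i i * v i + sumℤ (λ r → δ′ i (F.punchIn i r) * v (F.punchIn i r))
        ≡⟨ cong₂ (λ p q → p * v i + q) (VFP.insertAt-lookup (proj₁ (ih i)) i (+ 0))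
             (Σℤ.sum-cong (λ r → cong (_* v (F.punchIn i r)) (VFP.insertAt-punchIn (proj₁ (ih i)) i (+ 0) r))) ⟩
      + 0 * v i + dotℤ (proj₁ (ih i)) (v ∘ F.punchIn i)
        ≡⟨ ZP.+-identityˡ _ ⟩
      dotℤ (proj₁ (ih i)) (v ∘ F.punchIn i) ∎)
    det-minor : ∀ i v → det (minor (colsMatrix u v) i zero) ≡ dotℤ (δ′ i) v
    det-minor i v = begin
      det (minor (colsMatrix u v) i zero)
        ≡⟨ det-cong {M = minor (colsMatrix u v) i zero} {M′ = colsMatrix (u′ i) (v ∘ F.punchIn i)}
             (λ r c → maybe-map (lastSplit c) (λ c′ → u c′ (F.punchIn i r)) (v (F.punchIn i r))) ⟩
      detCols (u′ i) (v ∘ F.punchIn i)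
        ≡⟨ proj₂ (ih i) (v ∘ F.punchIn i) ⟩
      dotℤ (proj₁ (ih i)) (v ∘ F.punchIn i)
        ≡⟨ extend i v ⟩
      dotℤ (δ′ i) v ∎

  lastSplit-fromℕ : ∀ k → lastSplit (F.fromℕ k) ≡ nothing
  lastSplit-fromℕ zero    = refl
  lastSplit-fromℕ (suc k) = cong (Maybe.map suc) (lastSplit-fromℕ k)

  lastSplit-inject₁ : ∀ {k} (i : Fin k) → lastSplit (F.inject₁ i) ≡ just i
  lastSplit-inject₁ zero    = refl
  lastSplit-inject₁ (suc i) = cong (Maybe.map suc) (lastSplit-inject₁ i)

  lastJoin : ∀ {k} → Maybe (Fin k) → Fin (suc k)
  lastJoin {k} nothing = F.fromℕ k
  lastJoin (just i)    = F.inject₁ i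

  lastJoin-lastSplit : ∀ {k} (c : Fin (suc k)) → lastJoin (lastSplit c) ≡ c
  lastJoin-lastSplit {zero}  zero    = refl
  lastJoin-lastSplit {suc k} zero    = refl
  lastJoin-lastSplit {suc k} (suc c) with lastSplit c | lastJoin-lastSplit c
  ... | nothing | refl = refl
  ... | just i  | refl = refl

  detCols-repeated : ∀ {k} (u : Fin k → Fin (suc k) → ℤ) i → detCols u (u i) ≡ + 0
  detCols-repeated {k} u i = det-equal-columns (colsMatrix u (u i)) (F.inject₁ i) (F.fromℕ k)
    (λ eq → contradiction (trans (sym (lastSplit-inject₁ i)) (trans (cong lastSplit eq) (lastSplit-fromℕ k))) λ ())
    (λ r → trans (cong (Maybe.maybe (λ c → u c r) (u i r)) (lastSplit-inject₁ i))
      (sym (cong (Maybe.maybe (λ c → u c r) (u i r)) (lastSplit-fromℕ k))))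

  -- `v` is last in `detCols` but first in the frames; φ is the permutation between the two orders.
  LinIndep⇒detCols≢0 : ∀ {k} (u : Fin k → Fin (suc k) → ℤ) v → LinIndep (toℚv v VF.∷ (λ i → toℚv (u i))) →
    detCols u v ≢ + 0
  LinIndep⇒detCols≢0 {k} u v indep = LinIndep⇒det≢0 (colsMatrix u v)
    (LinIndep-resp {h = λ c → toℚv (λ r → colsMatrix u v r c)} (λ c → family (lastSplit c))
      (LinIndep-reindex (toℚv v VF.∷ (λ i → toℚv (u i))) φ φ-injective indep))
    where
    place : Maybe (Fin k) → Fin (suc k)
    place = Maybe.maybe suc zero
    φ : Fin (suc k) → Fin (suc k)
    φ c = place (lastSplit c)
    place-injective : ∀ x y → place x ≡ place y → x ≡ y
    place-injective nothing  nothing  eq   = refl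
    place-injective (just i) (just _) refl = refl
    φ-injective : Injective _≡_ _≡_ φ
    φ-injective {c} {c′} eq = trans (sym (lastJoin-lastSplit c))
      (trans (cong lastJoin (place-injective (lastSplit c) (lastSplit c′) eq)) (lastJoin-lastSplit c′))
    family : ∀ x r → (toℚv v VF.∷ (λ i → toℚv (u i))) (place x) r ≡ ℤtoℚ (Maybe.maybe (λ c → u c r) (v r) x)
    family nothing  r = refl
    family (just i) r = refl

-- External chambers

module _ where
  open Q

  -- The absolute value of the numerator is such a bound, the denominator being at least 1.
  archimedean : ∀ q → ∃ λ n → q ≤ ℕtoℚ n
  archimedean q@record{} = Z.∣ ↥ q ∣ , QP.toℚᵘ-cancel-≤ (UP.≤-respʳ-≃ (UP.≃-sym (ℤtoℚ≃ (+ Z.∣ ↥ q ∣)))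
    (U.*≤* (ZP.≤-trans (ZP.≤-reflexive (ZP.*-identityʳ (↥ q)))
      (ZP.≤-trans (i≤∣i∣ (↥ q)) (subst (+ Z.∣ ↥ q ∣ Z.≤_) (ZP.pos-* Z.∣ ↥ q ∣ (↧ₙ q)) (Z.+≤+ (NP.m≤m*n Z.∣ ↥ q ∣ (↧ₙ q))))))))
    where
    i≤∣i∣ : ∀ i → i Z.≤ + Z.∣ i ∣
    i≤∣i∣ (+ n)    = ZP.≤-refl
    i≤∣i∣ -[1+ n ] = Z.-≤+

  ℕtoℚ-suc≢0 : ∀ n → ℕtoℚ (suc n) ≢ 0ℚ
  ℕtoℚ-suc≢0 n eq = contradiction (ℕtoℚ-injective {suc n} {0} eq) λ ()

  *-cancelʳ-≢0 : ∀ {p q} r → r ≢ 0ℚ → p * r ≡ q * r → p ≡ q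
  *-cancelʳ-≢0 {p} {q} r r≢0 eq = begin
    p           ≡⟨ split p q ⟩
    p - q + q   ≡⟨ cong (_+ q) (*-cancelˡ-0 r≢0 (trans (expand p q r) (trans (cong (_- q * r) eq) (QP.+-inverseʳ (q * r))))) ⟩
    0ℚ + q      ≡⟨ QP.+-identityˡ q ⟩
    q           ∎
    where
    open ≡-Reasoning
    split : ∀ p q → p ≡ p - q + q
    split = solve-∀ ℚring
    expand : ∀ p q r → r * (p - q) ≡ p * r - q * r
    expand = solve-∀ ℚring

  *-suc-cancel-0 : ∀ q n → q * ℕtoℚ (suc n) ≡ 0ℚ → q ≡ 0ℚ
  *-suc-cancel-0 q n eq = *-cancelˡ-0 (ℕtoℚ-suc≢0 n) (trans (QP.*-comm (ℕtoℚ (suc n)) q) eq)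

  sum-nonNeg-zero : ∀ {l} (f : Fin l → ℚ) → (∀ i → 0ℚ ≤ f i) → sumℚ f ≡ 0ℚ → ∀ i → f i ≡ 0ℚ
  sum-nonNeg-zero f 0≤f Σf≡0 i = QP.≤-antisym (subst (f i ≤_) Σf≡0 (term≤sum i 0≤f)) (0≤f i)

  /-unique : ∀ z n {q} → q * ℕtoℚ (suc n) ≡ ℤtoℚ z → z / suc n ≡ q
  /-unique z n eq = *-cancelʳ-≢0 (ℕtoℚ (suc n)) (ℕtoℚ-suc≢0 n) (trans (/-*-cancel z n) (sym eq))

-- Here `k` is `d - 1` and `m` is `n - d`: the `k` external columns of γ come first, followed by
-- `m + 1` others.
module Chamber
  (k m : ℕ) (A : Mat (suc k) (k N.+ suc m))
  (basis : ∃ (Simplicial A)) (pointed : Pointed A)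
  (b₀ : Fin (suc k) → ℚ) (b₀-chamber : IsChamberPoint A b₀)
  (ext : ∀ i → External A (i ↑ˡ suc m))
  (ray : ∀ i → ChamberOf A b₀ (colsℚ A (i ↑ˡ suc m)))
  (ι : Fin (suc k) → ℤ)
  (ι⊥f : ∀ i → dotℤ ι (col A (i ↑ˡ suc m)) ≡ + 0)
  (ι≥0 : ∀ x → ChamberOf A b₀ x → 0ℚ Q.≤ dotℚ (toℚv ι) x)
  (ι-primitive : Primitive ι)
  (saturated : Saturated A (λ i → i ↑ˡ suc m))
  where

  open Q

  γ : (Fin (suc k) → ℚ) → Set
  γ = ChamberOf A b₀

  inner : Fin (suc m) → Fin (k N.+ suc m)
  inner u = k ↑ʳ u

  outer : Fin k → Fin (k N.+ suc m)
  outer i = i ↑ˡ suc m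

  outer≢inner : ∀ {i u} → outer i ≢ inner u
  outer≢inner {i} {u} eq with trans (sym (FP.splitAt-↑ˡ k i (suc m))) (trans (cong (F.splitAt k) eq) (FP.splitAt-↑ʳ k (suc m) u))
  ... | ()

  outer-or-inner : ∀ j → (∃ λ i → outer i ≡ j) ⊎ (∃ λ u → inner u ≡ j)
  outer-or-inner j with F.splitAt k j in eq
  ... | inj₁ i = inj₁ (i , FP.splitAt⁻¹-↑ˡ eq)
  ... | inj₂ u = inj₂ (u , FP.splitAt⁻¹-↑ʳ {k} eq)

  frame : Fin (suc m) → Fin (suc k) → Fin (k N.+ suc m)
  frame u zero    = inner u
  frame u (suc i) = outer i

  frame-injective : ∀ u → Injective _≡_ _≡_ (frame u)
  frame-injective u {zero}  {zero}  eq = refl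
  frame-injective u {zero}  {suc j} eq = contradiction (sym eq) outer≢inner
  frame-injective u {suc i} {zero}  eq = contradiction eq outer≢inner
  frame-injective u {suc i} {suc j} eq = cong suc (FP.↑ˡ-injective (suc m) i j eq)

  Framed : Fin (suc m) → Set
  Framed u = Simplicial A (frame u) × SimpCone A (frame u) b₀

  -- A simplicial cone containing b₀ contains γ, hence all external rays of γ, and so has them as generators.
  some-frame : ∃ Framed
  some-frame = from-simplicial (carathéodory A basis id c 0≤c)
    where
    c = proj₁ (proj₁ b₀-chamber)
    0≤c = proj₁ (proj₂ (proj₁ b₀-chamber))
    ca≈b₀ = proj₂ (proj₂ (proj₁ b₀-chamber))
    from-simplicial : (∃ λ s → Simplicial A s × SimpCone A s (lincomb c (colsℚ A))) → ∃ Framed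
    from-simplicial (s , indep , ca∈s) = u ,
      LinIndep-resp sφ≈ (LinIndep-reindex (λ i → colsℚ A (s i)) φ φ-injective indep) ,
      InCone-resp sφ≈ (InCone-reindex (λ i → colsℚ A (s i)) φ φ-injective b₀∈s)
      where
      b₀∈s : SimpCone A s b₀
      b₀∈s = InCone-resp-≈v {g = λ i → colsℚ A (s i)} ca≈b₀ ca∈s
      s-injective = LinIndep⇒injective (colsℚ A) s indep
      π : ∀ i → ∃ λ l → s l ≡ outer i
      π i = External⇒generator A s (ext i) (ray i s indep b₀∈s)
      -- The `k + 1` distinct columns of `s` cannot all be among the `k` outer ones.
      inner-exists : Dec (∃ λ q → ∃ λ u → inner u ≡ s q) → ∃ λ q → ∃ λ u → inner u ≡ s q
      inner-exists (yes e) = e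
      inner-exists (no none) = contradiction (FP.injective⇒≤ {f = λ q → proj₁ (f q)} f-injective) NP.1+n≰n
        where
        f : ∀ q → ∃ λ i → outer i ≡ s q
        f q with outer-or-inner (s q)
        ... | inj₁ e = e
        ... | inj₂ e = contradiction (q , e) none
        f-injective : Injective _≡_ _≡_ (λ q → proj₁ (f q))
        f-injective {q} {q′} eq = s-injective (trans (sym (proj₂ (f q))) (trans (cong outer eq) (proj₂ (f q′))))
      found = inner-exists (FP.any? (λ q → FP.any? (λ u → inner u FP.≟ s q)))
      u = proj₁ (proj₂ found)
      φ : Fin (suc k) → Fin (suc k)
      φ zero    = proj₁ found
      φ (suc i) = proj₁ (π i)
      sφ : ∀ i → s (φ i) ≡ frame u i
      sφ zero    = sym (proj₂ (proj₂ found))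
      sφ (suc i) = proj₂ (π i)
      φ-injective : Injective _≡_ _≡_ φ
      φ-injective {i} {j} eq = frame-injective u (trans (sym (sφ i)) (trans (cong s eq) (sφ j)))
      sφ≈ : ∀ i r → colsℚ A (s (φ i)) r ≡ colsℚ A (frame u i) r
      sφ≈ i r = cong (λ j → colsℚ A j r) (sφ i)

  -- Pivoting u into the frame u₀ can only drop u₀, since dropping an external column would expel it from γ.
  all-framed : ∀ u → Framed u
  all-framed u = result (pivot A (inner u) (proj₁ framed₀) (proj₂ framed₀))
    where
    u₀ = proj₁ some-frame
    framed₀ = proj₂ some-frame
    s′ : Fin (suc k) → Fin (suc k) → Fin (k N.+ suc m)
    s′ l = VF.updateAt (frame u₀) l (const (inner u))
    h : Fin (suc k) → Fin (suc k) → ℚ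
    h i = colsℚ A (frame u₀ i)
    expelled : ∀ i l → s′ (suc i) l ≢ outer i
    expelled i zero    eq = outer≢inner (sym eq)
    expelled i (suc l) eq with suc l FP.≟ suc i
    ... | yes refl = outer≢inner (sym (trans (sym (VFP.updateAt-updates (suc i) (frame u₀))) eq))
    ... | no l≢i   = l≢i (cong suc (FP.↑ˡ-injective (suc m) l i
      (trans (sym (VFP.updateAt-minimal (suc l) (suc i) (frame u₀) l≢i)) eq)))
    s′-zero : ∀ l → s′ zero l ≡ frame u l
    s′-zero zero    = refl
    s′-zero (suc l) = refl
    cancel : ∀ x → 1ℚ * x + - 1ℚ * x ≡ 0ℚ
    cancel = solve-∀ ℚring
    minus-one : ∀ q → - q ≡ - 1ℚ * q
    minus-one = solve-∀ ℚring
    result : (∃ λ p → lincomb p h ≈v colsℚ A (inner u) × (∀ i → p i ≤ 0ℚ)) ⊎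
             (∃ λ l → Simplicial A (s′ l) × SimpCone A (s′ l) b₀) → Framed u
    -- A column with only nonpositive coordinates gives the nonnegative relation `a_u - Σ p h = 0`
    -- with coefficient 1 at `a_u`, against pointedness.
    result (inj₁ (p , ph≈u , p≤0)) = contradiction
      (pointed-relation {A = A} pointed (inner u VF.∷ frame u₀) (1ℚ VF.∷ (λ i → - 1ℚ * p i))
        (λ { zero → ℤtoℚ-nonNeg 1 ; (suc i) → subst (0ℚ ≤_) (minus-one (p i)) (neg-nonNeg (p≤0 i)) })
        (λ r → trans (cong (λ q → 1ℚ * colsℚ A (inner u) r + q) (trans (lincomb-* (- 1ℚ) p h r) (cong (- 1ℚ *_) (ph≈u r))))
          (cancel (colsℚ A (inner u) r))) zero)
      λ ()
    result (inj₂ (zero , indep , b₀∈)) =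
      LinIndep-resp (λ i r → cong (λ j → colsℚ A j r) (s′-zero i)) indep ,
      InCone-resp (λ i r → cong (λ j → colsℚ A j r) (s′-zero i)) b₀∈
    result (inj₂ (suc i , indep , b₀∈)) =
      let l , eq = External⇒generator A (s′ (suc i)) (ext i) (ray i (s′ (suc i)) indep b₀∈)
      in contradiction eq (expelled i l)

  frame-indep : ∀ u → Simplicial A (frame u)
  frame-indep u = proj₁ (all-framed u)

  γ⊆frame : ∀ u {x} → γ x → SimpCone A (frame u) x
  γ⊆frame u x∈γ = x∈γ (frame u) (frame-indep u) (proj₂ (all-framed u))

  ι·outer : ∀ i → dotℚ (toℚv ι) (colsℚ A (outer i)) ≡ 0ℚ
  ι·outer i = trans (sym (ℤtoℚ-dot ι (col A (outer i)))) (cong ℤtoℚ (ι⊥f i))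

  ι·lincomb : ∀ u c {x} → lincomb c (λ i → colsℚ A (frame u i)) ≈v x →
    dotℚ (toℚv ι) x ≡ c zero * dotℚ (toℚv ι) (colsℚ A (inner u))
  ι·lincomb u c {x} cf≈x = begin
    dotℚ (toℚv ι) x
      ≡⟨ dot-lincomb (toℚv ι) c (λ i → colsℚ A (frame u i)) cf≈x ⟩
    c zero * dotℚ (toℚv ι) (colsℚ A (inner u)) + sumℚ (λ i → c (suc i) * dotℚ (toℚv ι) (colsℚ A (outer i)))
      ≡⟨ cong (λ q → c zero * dotℚ (toℚv ι) (colsℚ A (inner u)) + q)
           (Σℚ.sum-zero (λ i → trans (cong (c (suc i) *_) (ι·outer i)) (QP.*-zeroʳ (c (suc i))))) ⟩
    c zero * dotℚ (toℚv ι) (colsℚ A (inner u)) + 0ℚ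
      ≡⟨ QP.+-identityʳ _ ⟩
    c zero * dotℚ (toℚv ι) (colsℚ A (inner u)) ∎
    where open ≡-Reasoning

  -- ι is nonnegative on a basis of vectors in γ. If it were positive on none of them it would be
  -- the zero vector, which is not primitive.
  interior : ∃ λ v → γ v × 0ℚ < dotℚ (toℚv ι) v
  interior = find (FP.any? (λ i → 0ℚ QP.<? dotℚ (toℚv ι) (v i)))
    where
    v = proj₁ (proj₂ b₀-chamber)
    v-indep = proj₁ (proj₂ (proj₂ b₀-chamber))
    v∈γ = proj₂ (proj₂ (proj₂ b₀-chamber))
    find : Dec (∃ λ i → 0ℚ < dotℚ (toℚv ι) (v i)) → ∃ λ v → γ v × 0ℚ < dotℚ (toℚv ι) v
    find (yes (i , 0<ιv)) = v i , v∈γ i , 0<ιv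
    find (no none) = contradiction
      (λ r → ℤtoℚ-injective (dot-basis-zero (toℚv ι) v v-indep
        (λ i → QP.≤-antisym (QP.≮⇒≥ (λ 0<ιv → none (i , 0<ιv))) (ι≥0 (v i) (v∈γ i))) r))
      (Primitive⇒≢0 ι ι-primitive)

  -- On a point of γ off the facet, ι is positive and equals a nonnegative multiple of `ι · a_u`.
  ι·inner-pos : ∀ u → 0ℚ < dotℚ (toℚv ι) (colsℚ A (inner u))
  ι·inner-pos u = QP.≰⇒> λ ιu≤0 →
    let v , v∈γ , 0<ιv = interior
        c , 0≤c , cf≈v = γ⊆frame u v∈γ
    in QP.<-irrefl refl (QP.<-≤-trans 0<ιv (subst (_≤ 0ℚ) (sym (ι·lincomb u c cf≈v))
         (subst (c zero * dotℚ (toℚv ι) (colsℚ A (inner u)) ≤_) (QP.*-zeroʳ (c zero))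
           (QP.*-monoˡ-≤-nonNeg (c zero) {{nonNegative (0≤c zero)}} ιu≤0))))

  weight-exists : ∀ u → ∃ λ n → dotℤ ι (col A (inner u)) ≡ + suc n
  weight-exists u = ℤtoℚ-pos⁻ _ (subst (0ℚ <_) (sym (ℤtoℚ-dot ι (col A (inner u)))) (ι·inner-pos u))

  w : Fin (suc m) → ℕ
  w u = suc (proj₁ (weight-exists u))

  ι·inner : ∀ u → dotℤ ι (col A (inner u)) ≡ + w u
  ι·inner u = proj₂ (weight-exists u)

  ι·innerℚ : ∀ u → dotℚ (toℚv ι) (colsℚ A (inner u)) ≡ ℤtoℚ (+ w u)
  ι·innerℚ u = trans (sym (ℤtoℚ-dot ι (col A (inner u)))) (cong ℤtoℚ (ι·inner u))

  0<w : ∀ u → 0 N.< w u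
  0<w u = N.s≤s N.z≤n

  outer-indep : LinIndep (λ i → colsℚ A (outer i))
  outer-indep c rel i = frame-indep zero (0ℚ VF.∷ c)
    (λ r → cong₂ _+_ (QP.*-zeroˡ (colsℚ A (inner zero) r)) (rel r)) (suc i)

  inner∉facet : ∀ u → ¬ InCone (λ i → colsℚ A (outer i)) (colsℚ A (inner u))
  inner∉facet u (c , _ , ca≈u) = QP.<⇒≢ (ι·inner-pos u) (sym (trans
    (dot-lincomb (toℚv ι) c (λ i → colsℚ A (outer i)) ca≈u)
    (Σℚ.sum-zero (λ i → trans (cong (c i *_) (ι·outer i)) (QP.*-zeroʳ (c i))))))

  γ-resp : ∀ {x y} → x ≈v y → γ x → γ y
  γ-resp x≈y x∈γ s indep b₀∈s = InCone-resp-≈v {g = λ i → colsℚ A (s i)} x≈y (x∈γ s indep b₀∈s)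

  γ-+ : ∀ {x y} → γ x → γ y → γ (λ r → x r + y r)
  γ-+ x∈γ y∈γ s indep b₀∈s = InCone-+ (λ i → colsℚ A (s i)) (x∈γ s indep b₀∈s) (y∈γ s indep b₀∈s)

  γ-* : ∀ {t x} → 0ℚ ≤ t → γ x → γ (λ r → t * x r)
  γ-* 0≤t x∈γ s indep b₀∈s = InCone-* (λ i → colsℚ A (s i)) 0≤t (x∈γ s indep b₀∈s)

  γ-lincomb : ∀ {l} (c : Fin l → ℚ) x → (∀ i → 0ℚ ≤ c i) → (∀ i → γ (x i)) → γ (lincomb c x)
  γ-lincomb c x 0≤c x∈γ s indep b₀∈s =
    InCone-lincomb (λ i → colsℚ A (s i)) c x 0≤c (λ i → x∈γ i s indep b₀∈s)

  ι·A : ∀ (x : Fin (k N.+ suc m) → ℤ) {b} → (λ r → sumℤ (λ j → A r j Z.* x j)) ≈v b →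
    dotℤ ι b ≡ sumℤ (λ u → x (inner u) Z.* + w u)
  ι·A x {b} Ax≈b = begin
    sumℤ (λ r → ι r Z.* b r)
      ≡⟨ Σℤ.sum-cong (λ r → cong (ι r Z.*_) (trans (sym (Ax≈b r)) (Σℤ.sum-cong (λ j → ZP.*-comm (A r j) (x j))))) ⟩
    sumℤ (λ r → ι r Z.* sumℤ (λ j → x j Z.* A r j))
      ≡⟨ Σℤ.dot-comb ι x (col A) ⟩
    sumℤ (λ j → x j Z.* dotℤ ι (col A j))
      ≡⟨ Σℤ.sum-++ k (λ j → x j Z.* dotℤ ι (col A j)) ⟩
    sumℤ (λ i → x (outer i) Z.* dotℤ ι (col A (outer i))) Z.+ sumℤ (λ u → x (inner u) Z.* dotℤ ι (col A (inner u)))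
      ≡⟨ cong₂ Z._+_ (Σℤ.sum-zero (λ i → trans (cong (x (outer i) Z.*_) (ι⊥f i)) (ZP.*-zeroʳ (x (outer i)))))
           (Σℤ.sum-cong (λ u → cong (x (inner u) Z.*_) (ι·inner u))) ⟩
    + 0 Z.+ sumℤ (λ u → x (inner u) Z.* + w u)
      ≡⟨ ZP.+-identityˡ _ ⟩
    sumℤ (λ u → x (inner u) Z.* + w u) ∎
    where open ≡-Reasoning

  total-ℤ : ∀ {l} (w : Fin l → ℕ) y → + total w y ≡ sumℤ (λ u → + V.lookup y u Z.* + w u)
  total-ℤ w []       = refl
  total-ℤ w (y ∷ ys) = cong₂ Z._+_ (trans (ZP.pos-* (w zero) y) (ZP.*-comm (+ w zero) (+ y))) (total-ℤ (w ∘ suc) ys)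

  Ax-split : ∀ (x : Fin (k N.+ suc m) → ℤ) r → sumℤ (λ j → A r j Z.* x j) ≡
    sumℤ (λ i → A r (outer i) Z.* x (outer i)) Z.+ sumℤ (λ u → A r (inner u) Z.* x (inner u))
  Ax-split x r = Σℤ.sum-++ k (λ j → A r j Z.* x j)

  A-++ : ∀ (p : Fin k → ℤ) (q : Fin (suc m) → ℤ) r → sumℤ (λ j → A r j Z.* (p VF.++ q) j) ≡
    sumℤ (λ i → A r (outer i) Z.* p i) Z.+ sumℤ (λ u → A r (inner u) Z.* q u)
  A-++ p q r = trans (Ax-split (p VF.++ q) r) (cong₂ Z._+_
    (Σℤ.sum-cong (λ i → cong (A r (outer i) Z.*_) (VFP.lookup-++ˡ p q i)))
    (Σℤ.sum-cong (λ u → cong (A r (inner u) Z.*_) (VFP.lookup-++ʳ p q u))))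

  pos-++ : ∀ (p : Fin k → ℕ) (q : Fin (suc m) → ℕ) j → + (p VF.++ q) j ≡ ((λ i → + p i) VF.++ (λ u → + q u)) j
  pos-++ p q j with F.splitAt k j
  ... | inj₁ _ = refl
  ... | inj₂ _ = refl

  A-++ℕ : ∀ (p : Fin k → ℕ) (q : Fin (suc m) → ℕ) r → sumℤ (λ j → A r j Z.* + (p VF.++ q) j) ≡
    sumℤ (λ i → A r (outer i) Z.* + p i) Z.+ sumℤ (λ u → A r (inner u) Z.* + q u)
  A-++ℕ p q r = trans (Σℤ.sum-cong (λ j → cong (A r j Z.*_) (pos-++ p q j))) (A-++ (λ i → + p i) (λ u → + q u) r)

  ℤtoℚ-lincomb : ∀ {l} (f : Fin l → Fin (k N.+ suc m)) (x : Fin l → ℕ) r →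
    ℤtoℚ (sumℤ (λ i → A r (f i) Z.* + x i)) ≡ lincomb (λ i → ℕtoℚ (x i)) (λ i → colsℚ A (f i)) r
  ℤtoℚ-lincomb f x r = trans (ℤtoℚ-sum (λ i → A r (f i) Z.* + x i))
    (Σℚ.sum-cong (λ i → trans (ℤtoℚ-* (A r (f i)) (+ x i)) (QP.*-comm (ℤtoℚ (A r (f i))) (ℕtoℚ (x i)))))

  -- The solutions over one point of γ

  module Fibre (b : Fin (suc k) → ℤ) (b∈γ : γ (toℚv b)) (b∈S : InSemigroup A b) (n : ℕ) (ιb≡n : dotℤ ι b ≡ + n) where

    ιbℚ : dotℚ (toℚv ι) (toℚv b) ≡ ℕtoℚ n
    ιbℚ = trans (sym (ℤtoℚ-dot ι b)) (cong ℤtoℚ ιb≡n)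

    coeff : Fin (suc m) → Fin (suc k) → ℚ
    coeff u = proj₁ (γ⊆frame u b∈γ)

    facetPart : Fin (suc m) → Fin (suc k) → ℚ
    facetPart u = lincomb (λ i → coeff u (suc i)) (λ i → colsℚ A (outer i))

    facetPart∈facet : ∀ u → InCone (λ i → colsℚ A (outer i)) (facetPart u)
    facetPart∈facet u = (λ i → coeff u (suc i)) , (λ i → proj₁ (proj₂ (γ⊆frame u b∈γ)) (suc i)) , λ r → refl

    b-decomposed : ∀ u r → coeff u zero * colsℚ A (inner u) r + facetPart u r ≡ ℤtoℚ (b r)
    b-decomposed u = proj₂ (proj₂ (γ⊆frame u b∈γ))

    coeff-zero : ∀ u → coeff u zero * ℕtoℚ (w u) ≡ ℕtoℚ n
    coeff-zero u = trans (cong (coeff u zero *_) (sym (ι·innerℚ u)))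
      (trans (sym (ι·lincomb u (coeff u) (b-decomposed u))) ιbℚ)

    module Lift (y : Vec ℕ (suc m)) (y-Sol : Sol w n y) where

      Y : Fin (suc m) → ℚ
      Y u = ℕtoℚ (V.lookup y u)

      residue : Fin (suc k) → ℤ
      residue r = b r Z.- sumℤ (λ u → A r (inner u) Z.* + V.lookup y u)

      residueℚ : ∀ r → ℤtoℚ (residue r) ≡ ℤtoℚ (b r) - lincomb Y (λ u → colsℚ A (inner u)) r
      residueℚ r = begin
        ℤtoℚ (b r Z.+ Z.- σ)
          ≡⟨ cong (λ z → ℤtoℚ (b r Z.+ z)) (sym (ZP.-1*i≡-i σ)) ⟩
        ℤtoℚ (b r Z.+ Z.-1ℤ Z.* σ)
          ≡⟨ trans (ℤtoℚ-+ (b r) (Z.-1ℤ Z.* σ)) (cong (λ q → ℤtoℚ (b r) + q) (ℤtoℚ-* Z.-1ℤ σ)) ⟩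
        ℤtoℚ (b r) + - 1ℚ * ℤtoℚ σ
          ≡⟨ cong (λ q → ℤtoℚ (b r) + - 1ℚ * q) (ℤtoℚ-lincomb inner (V.lookup y) r) ⟩
        ℤtoℚ (b r) + - 1ℚ * lincomb Y (λ u → colsℚ A (inner u)) r
          ≡⟨ minus (ℤtoℚ (b r)) _ ⟩
        ℤtoℚ (b r) - lincomb Y (λ u → colsℚ A (inner u)) r ∎
        where
        open ≡-Reasoning
        σ = sumℤ (λ u → A r (inner u) Z.* + V.lookup y u)
        minus : ∀ p q → p + - 1ℚ * q ≡ p - q
        minus = solve-∀ ℚring

      -- Subtracting `y` from a semigroup representation of `b` may produce negative entries, so
      -- this gives lattice membership only; saturation restores nonnegativity.
      residue∈lattice : InLattice A residue
      residue∈lattice = z , λ r → begin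
        sumℤ (λ j → A r j Z.* (+ x₀ j Z.+ Z.-1ℤ Z.* e j))
          ≡⟨ Σℤ.sum-cong (λ j → expand (A r j) (+ x₀ j) (e j)) ⟩
        sumℤ (λ j → A r j Z.* + x₀ j Z.+ Z.-1ℤ Z.* (A r j Z.* e j))
          ≡⟨ Σℤ.sum-+ (λ j → A r j Z.* + x₀ j) (λ j → Z.-1ℤ Z.* (A r j Z.* e j)) ⟩
        sumℤ (λ j → A r j Z.* + x₀ j) Z.+ sumℤ (λ j → Z.-1ℤ Z.* (A r j Z.* e j))
          ≡⟨ cong₂ Z._+_ (proj₂ b∈S r) (trans (Σℤ.sum-* Z.-1ℤ (λ j → A r j Z.* e j))
               (cong (Z.-1ℤ Z.*_) (A-++ (λ _ → + 0) (λ u → + V.lookup y u) r))) ⟩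
        b r Z.+ Z.-1ℤ Z.* (sumℤ (λ i → A r (outer i) Z.* + 0) Z.+ σ r)
          ≡⟨ cong (λ s → b r Z.+ Z.-1ℤ Z.* (s Z.+ σ r)) (Σℤ.sum-zero (λ i → ZP.*-zeroʳ (A r (outer i)))) ⟩
        b r Z.+ Z.-1ℤ Z.* (+ 0 Z.+ σ r)
          ≡⟨ simp (b r) (σ r) ⟩
        b r Z.- σ r ∎
        where
        open ≡-Reasoning
        x₀ = proj₁ b∈S
        e : Fin (k N.+ suc m) → ℤ
        e = (λ _ → + 0) VF.++ (λ u → + V.lookup y u)
        z : Fin (k N.+ suc m) → ℤ
        z j = + x₀ j Z.+ Z.-1ℤ Z.* e j
        σ : Fin (suc k) → ℤ
        σ r = sumℤ (λ u → A r (inner u) Z.* + V.lookup y u)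
        expand : ∀ a x e → a Z.* (x Z.+ Z.-1ℤ Z.* e) ≡ a Z.* x Z.+ Z.-1ℤ Z.* (a Z.* e)
        expand = ℤSolver.solve-∀
        simp : ∀ b s → b Z.+ Z.-1ℤ Z.* (+ 0 Z.+ s) ≡ b Z.- s
        simp = ℤSolver.solve-∀

      YW : Fin (suc m) → ℚ
      YW u = Y u * ℕtoℚ (w u)

      0≤YW : ∀ u → 0ℚ ≤ YW u
      0≤YW u = *-nonNeg (ℤtoℚ-nonNeg (V.lookup y u)) (ℤtoℚ-nonNeg (w u))

      sum-YW : sumℚ YW ≡ ℕtoℚ n
      sum-YW = begin
        sumℚ YW
          ≡⟨ Σℚ.sum-cong (λ u → ℤtoℚ-* (+ V.lookup y u) (+ w u)) ⟨
        sumℚ (λ u → ℤtoℚ (+ V.lookup y u Z.* + w u))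
          ≡⟨ ℤtoℚ-sum (λ u → + V.lookup y u Z.* + w u) ⟨
        ℤtoℚ (sumℤ (λ u → + V.lookup y u Z.* + w u))
          ≡⟨ cong ℤtoℚ (trans (sym (total-ℤ w y)) (cong +_ y-Sol)) ⟩
        ℕtoℚ n ∎
        where open ≡-Reasoning

      -- Every u gives b = t_u a_u + f_u with t_u w_u = n and f_u in the facet; the residue is the average
      -- of the f_u with weights y_u w_u / n.
      scaled-residue : ∀ r → lincomb YW facetPart r ≡ ℕtoℚ n * ℤtoℚ (residue r)
      scaled-residue r = begin
        sumℚ (λ u → YW u * facetPart u r)
          ≡⟨ Σℚ.sum-cong term ⟩
        sumℚ (λ u → ℤtoℚ (b r) * YW u + (- ℕtoℚ n) * (Y u * colsℚ A (inner u) r))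
          ≡⟨ Σℚ.sum-+ (λ u → ℤtoℚ (b r) * YW u) (λ u → (- ℕtoℚ n) * (Y u * colsℚ A (inner u) r)) ⟩
        sumℚ (λ u → ℤtoℚ (b r) * YW u) + sumℚ (λ u → (- ℕtoℚ n) * (Y u * colsℚ A (inner u) r))
          ≡⟨ cong₂ _+_ (trans (Σℚ.sum-* (ℤtoℚ (b r)) YW) (cong (ℤtoℚ (b r) *_) sum-YW))
               (Σℚ.sum-* (- ℕtoℚ n) (λ u → Y u * colsℚ A (inner u) r)) ⟩
        ℤtoℚ (b r) * ℕtoℚ n + (- ℕtoℚ n) * lincomb Y (λ u → colsℚ A (inner u)) r
          ≡⟨ factor (ℤtoℚ (b r)) (ℕtoℚ n) _ ⟩
        ℕtoℚ n * (ℤtoℚ (b r) - lincomb Y (λ u → colsℚ A (inner u)) r)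
          ≡⟨ cong (ℕtoℚ n *_) (residueℚ r) ⟨
        ℕtoℚ n * ℤtoℚ (residue r) ∎
        where
        open ≡-Reasoning
        factor : ∀ b n l → b * n + (- n) * l ≡ n * (b - l)
        factor = solve-∀ ℚring
        rearrange : ∀ y w t a f → y * w * f ≡ (t * a + f) * (y * w) + (- (t * w)) * (y * a)
        rearrange = solve-∀ ℚring
        term : ∀ u → YW u * facetPart u r ≡ ℤtoℚ (b r) * YW u + (- ℕtoℚ n) * (Y u * colsℚ A (inner u) r)
        term u = trans (rearrange (Y u) (ℕtoℚ (w u)) (coeff u zero) (colsℚ A (inner u) r) (facetPart u r))
          (cong₂ (λ p q → p * YW u + (- q) * (Y u * colsℚ A (inner u) r)) (b-decomposed u r) (coeff-zero u))

      -- Dividing `scaled-residue` by `n` requires `n` to be nonzero. For `n = 0` the positive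
      -- weights force `y = 0` and the coefficient of `a_u` in `b` to be 0, so the residue is `b`,
      -- which is its own facet part.
      residue∈facet : InCone (λ i → colsℚ A (outer i)) (toℚv residue)
      residue∈facet = by-cases n refl
        where
        open ≡-Reasoning
        by-cases : ∀ n′ → n ≡ n′ → InCone (λ i → colsℚ A (outer i)) (toℚv residue)
        by-cases (suc n′) n≡ = InCone-resp-≈v {g = λ i → colsℚ A (outer i)} rescale
          (InCone-* (λ i → colsℚ A (outer i)) (QP.<⇒≤ 0<t)
            (InCone-lincomb (λ i → colsℚ A (outer i)) YW facetPart 0≤YW facetPart∈facet))
          where
          inv : ∃ λ t → (0ℚ < t) × (ℕtoℚ n * t ≡ 1ℚ)
          inv = inverse-pos {ℕtoℚ n} (QP.≰⇒> (λ n≤0 → ℕtoℚ-suc≢0 n′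
            (trans (cong ℕtoℚ (sym n≡)) (QP.≤-antisym n≤0 (ℤtoℚ-nonNeg n)))))
          t = proj₁ inv
          0<t = proj₁ (proj₂ inv)
          assoc : ∀ t n x → t * (n * x) ≡ n * t * x
          assoc = solve-∀ ℚring
          rescale : ∀ r → t * lincomb YW facetPart r ≡ ℤtoℚ (residue r)
          rescale r = begin
            t * lincomb YW facetPart r         ≡⟨ cong (t *_) (scaled-residue r) ⟩
            t * (ℕtoℚ n * ℤtoℚ (residue r))    ≡⟨ assoc t (ℕtoℚ n) (ℤtoℚ (residue r)) ⟩
            ℕtoℚ n * t * ℤtoℚ (residue r)      ≡⟨ cong (_* ℤtoℚ (residue r)) (proj₂ (proj₂ inv)) ⟩
            1ℚ * ℤtoℚ (residue r)              ≡⟨ QP.*-identityˡ (ℤtoℚ (residue r)) ⟩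
            ℤtoℚ (residue r)                   ∎
        by-cases zero n≡0 = InCone-resp-≈v {g = λ i → colsℚ A (outer i)} same (facetPart∈facet zero)
          where
          n≡0ℚ : ℕtoℚ n ≡ 0ℚ
          n≡0ℚ = cong ℕtoℚ n≡0
          Y≡0 : ∀ u → Y u ≡ 0ℚ
          Y≡0 u = *-suc-cancel-0 (Y u) (proj₁ (weight-exists u)) (sum-nonNeg-zero YW 0≤YW (trans sum-YW n≡0ℚ) u)
          t≡0 : coeff zero zero ≡ 0ℚ
          t≡0 = *-suc-cancel-0 (coeff zero zero) (proj₁ (weight-exists zero)) cw≡0
            where
            cw≡0 : coeff zero zero * ℕtoℚ (w zero) ≡ 0ℚ
            cw≡0 = trans (coeff-zero zero) n≡0ℚ
          pad : ∀ a f → f ≡ 0ℚ * a + f - 0ℚ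
          pad = solve-∀ ℚring
          same : ∀ r → facetPart zero r ≡ ℤtoℚ (residue r)
          same r = begin
            facetPart zero r
              ≡⟨ pad (colsℚ A (inner zero) r) (facetPart zero r) ⟩
            0ℚ * colsℚ A (inner zero) r + facetPart zero r - 0ℚ
              ≡⟨ cong₂ (λ t s → t * colsℚ A (inner zero) r + facetPart zero r - s) t≡0
                   (lincomb-zero (λ u → colsℚ A (inner u)) Y≡0 r) ⟨
            coeff zero zero * colsℚ A (inner zero) r + facetPart zero r - lincomb Y (λ u → colsℚ A (inner u)) r
              ≡⟨ cong (_- lincomb Y (λ u → colsℚ A (inner u)) r) (b-decomposed zero r) ⟩
            ℤtoℚ (b r) - lincomb Y (λ u → colsℚ A (inner u)) r
              ≡⟨ residueℚ r ⟨
            ℤtoℚ (residue r) ∎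

      residue∈S : InSemigroup (λ r i → A r (outer i)) residue
      residue∈S = Equivalence.from (saturated residue) (residue∈lattice , residue∈facet)

      solution : Fin (k N.+ suc m) → ℕ
      solution = proj₁ residue∈S VF.++ V.lookup y

      solution-solves : (λ r → sumℤ (λ j → A r j Z.* + solution j)) ≈v b
      solution-solves r = trans (A-++ℕ (proj₁ residue∈S) (V.lookup y) r)
        (trans (cong (Z._+ sumℤ (λ u → A r (inner u) Z.* + V.lookup y u)) (proj₂ residue∈S r))
          (recover (b r) (sumℤ (λ u → A r (inner u) Z.* + V.lookup y u))))
        where
        recover : ∀ b s → b Z.- s Z.+ s ≡ b
        recover = ℤSolver.solve-∀

      tabulated-solves : SolvesVec A b (V.tabulate solution)
      tabulated-solves r = trans
        (Σℤ.sum-cong (λ j → cong (λ n → A r j Z.* + n) (VP.lookup∘tabulate solution j))) (solution-solves r)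

    innerPart : Vec ℕ (k N.+ suc m) → Vec ℕ (suc m)
    innerPart x = V.tabulate (λ u → V.lookup x (inner u))

    innerPart-Sol : ∀ x → SolvesVec A b x → Sol w n (innerPart x)
    innerPart-Sol x solves = ZP.+-injective (begin
      + total w (innerPart x)
        ≡⟨ total-ℤ w (innerPart x) ⟩
      sumℤ (λ u → + V.lookup (innerPart x) u Z.* + w u)
        ≡⟨ Σℤ.sum-cong (λ u → cong (λ n → + n Z.* + w u) (VP.lookup∘tabulate (λ u → V.lookup x (inner u)) u)) ⟩
      sumℤ (λ u → + V.lookup x (inner u) Z.* + w u)
        ≡⟨ ι·A (λ j → + V.lookup x j) solves ⟨
      dotℤ ι b
        ≡⟨ ιb≡n ⟩
      + n ∎)
      where open ≡-Reasoning

    innerPart-surjective : ∀ y → Sol w n y → ∃ λ x → SolvesVec A b x × innerPart x ≡ y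
    innerPart-surjective y y-Sol = V.tabulate solution , tabulated-solves ,
      trans (VP.tabulate-cong (λ u → trans (VP.lookup∘tabulate solution (inner u))
        (VFP.lookup-++ʳ (proj₁ residue∈S) (V.lookup y) u))) (VP.tabulate∘lookup y)
      where open Lift y y-Sol

    -- With the inner coordinates equal, the outer columns contribute equal sums, and these columns
    -- are independent.
    innerPart-injective : ∀ x x′ → SolvesVec A b x → SolvesVec A b x′ → innerPart x ≡ innerPart x′ → x ≡ x′
    innerPart-injective x x′ solves solves′ eq = begin
      x                           ≡⟨ VP.tabulate∘lookup x ⟨
      V.tabulate (V.lookup x)     ≡⟨ VP.tabulate-cong same ⟩
      V.tabulate (V.lookup x′)    ≡⟨ VP.tabulate∘lookup x′ ⟩
      x′                          ∎
      where
      open ≡-Reasoning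
      open import Algebra.Properties.Group (AbelianGroup.group ZP.+-0-abelianGroup) using (∙-cancelʳ)
      same-inner : ∀ u → V.lookup x (inner u) ≡ V.lookup x′ (inner u)
      same-inner u = trans (sym (VP.lookup∘tabulate (λ u → V.lookup x (inner u)) u))
        (trans (cong (λ z → V.lookup z u) eq) (VP.lookup∘tabulate (λ u → V.lookup x′ (inner u)) u))
      outerSum : Vec ℕ (k N.+ suc m) → Fin (suc k) → ℤ
      outerSum x r = sumℤ (λ i → A r (outer i) Z.* + V.lookup x (outer i))
      innerSum : Vec ℕ (k N.+ suc m) → Fin (suc k) → ℤ
      innerSum x r = sumℤ (λ u → A r (inner u) Z.* + V.lookup x (inner u))
      same-outerSum : ∀ r → outerSum x r ≡ outerSum x′ r
      same-outerSum r = ∙-cancelʳ (innerSum x′ r) (outerSum x r) (outerSum x′ r) (begin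
        outerSum x r Z.+ innerSum x′ r
          ≡⟨ cong (λ s → outerSum x r Z.+ s) (Σℤ.sum-cong (λ u → cong (λ n → A r (inner u) Z.* + n) (same-inner u))) ⟨
        outerSum x r Z.+ innerSum x r
          ≡⟨ Ax-split (λ j → + V.lookup x j) r ⟨
        sumℤ (λ j → A r j Z.* + V.lookup x j)
          ≡⟨ trans (solves r) (sym (solves′ r)) ⟩
        sumℤ (λ j → A r j Z.* + V.lookup x′ j)
          ≡⟨ Ax-split (λ j → + V.lookup x′ j) r ⟩
        outerSum x′ r Z.+ innerSum x′ r ∎)
      same-outer : ∀ i → V.lookup x (outer i) ≡ V.lookup x′ (outer i)
      same-outer i = ℕtoℚ-injective (LinIndep⇒unique (λ i → colsℚ A (outer i)) outer-indep
        (λ i → ℕtoℚ (V.lookup x (outer i))) (λ i → ℕtoℚ (V.lookup x′ (outer i)))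
        (λ r → trans (sym (ℤtoℚ-lincomb outer (λ i → V.lookup x (outer i)) r))
          (trans (cong ℤtoℚ (same-outerSum r)) (ℤtoℚ-lincomb outer (λ i → V.lookup x′ (outer i)) r))) i)
      same : ∀ j → V.lookup x j ≡ V.lookup x′ j
      same j = by-part (outer-or-inner j)
        where
        by-part : (∃ λ i → outer i ≡ j) ⊎ (∃ λ u → inner u ≡ j) → V.lookup x j ≡ V.lookup x′ j
        by-part (inj₁ (i , refl)) = same-outer i
        by-part (inj₂ (u , refl)) = same-inner u

    CountSol-count : CountSol A b (count w 0<w n)
    CountSol-count = Count-bijection innerPart innerPart-Sol innerPart-surjective innerPart-injective (count-Count w 0<w n)

  value : ∀ {b} (b∈S : InSemigroup A b) → dotℤ ι b ≡ + total w (V.tabulate (λ u → proj₁ b∈S (inner u)))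
  value (x , Ax≈b) = trans (ι·A (λ j → + x j) Ax≈b) (sym (trans (total-ℤ w (V.tabulate (λ u → x (inner u))))
    (Σℤ.sum-cong (λ u → cong (λ n → + n Z.* + w u) (VP.lookup∘tabulate (λ u → x (inner u)) u)))))

  Point : (Fin (suc k) → ℤ) → Set
  Point b = γ (toℚv b) × InSemigroup A b

  CountSol-count : ∀ {b n} → Point b → dotℤ ι b ≡ + n → CountSol A b (count w 0<w n)
  CountSol-count {b} {n} (b∈γ , b∈S) ιb≡n = Fibre.CountSol-count b b∈γ b∈S n ιb≡n

  Value : ℕ → Set
  Value n = ∃ λ b → Point b × dotℤ ι b ≡ + n

  dot-+* : ∀ (b e : Fin (suc k) → ℤ) t → dotℤ ι (λ r → b r Z.+ t Z.* e r) ≡ dotℤ ι b Z.+ t Z.* dotℤ ι e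
  dot-+* b e t = trans (Σℤ.sum-cong (λ r → expand (ι r) (b r) t (e r)))
    (trans (Σℤ.sum-+ (λ r → ι r Z.* b r) (λ r → t Z.* (ι r Z.* e r)))
      (cong (λ s → dotℤ ι b Z.+ s) (Σℤ.sum-* t (λ r → ι r Z.* e r))))
    where
    expand : ∀ i b t e → i Z.* (b Z.+ t Z.* e) ≡ i Z.* b Z.+ t Z.* (i Z.* e)
    expand = ℤSolver.solve-∀

  Point-+* : ∀ {b e} t → Point b → Point e → Point (λ r → b r Z.+ + t Z.* e r)
  Point-+* {b} {e} t (b∈γ , x , Ax≈b) (e∈γ , x′ , Ax′≈e) =
    γ-resp (λ r → sym (trans (ℤtoℚ-+ (b r) (+ t Z.* e r)) (cong (λ q → ℤtoℚ (b r) + q) (ℤtoℚ-* (+ t) (e r)))))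
      (γ-+ b∈γ (γ-* (ℤtoℚ-nonNeg t) e∈γ)) ,
    (λ j → x j N.+ t N.* x′ j) , λ r → begin
      sumℤ (λ j → A r j Z.* + (x j N.+ t N.* x′ j))
        ≡⟨ Σℤ.sum-cong (λ j → trans (cong (λ n → A r j Z.* (+ x j Z.+ n)) (ZP.pos-* t (x′ j)))
             (expand (A r j) (+ x j) (+ t) (+ x′ j))) ⟩
      sumℤ (λ j → A r j Z.* + x j Z.+ + t Z.* (A r j Z.* + x′ j))
        ≡⟨ Σℤ.sum-+ (λ j → A r j Z.* + x j) (λ j → + t Z.* (A r j Z.* + x′ j)) ⟩
      sumℤ (λ j → A r j Z.* + x j) Z.+ sumℤ (λ j → + t Z.* (A r j Z.* + x′ j))
        ≡⟨ cong₂ Z._+_ (Ax≈b r) (trans (Σℤ.sum-* (+ t) (λ j → A r j Z.* + x′ j)) (cong (+ t Z.*_) (Ax′≈e r))) ⟩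
      b r Z.+ + t Z.* e r ∎
    where
    open ≡-Reasoning
    expand : ∀ a x t x′ → a Z.* (x Z.+ t Z.* x′) ≡ a Z.* x Z.+ t Z.* (a Z.* x′)
    expand = ℤSolver.solve-∀

  Point-0 : Point (λ _ → + 0)
  Point-0 = γ-resp (lincomb-zero (λ i → colsℚ A (outer i)) (λ _ → refl))
      (γ-lincomb (λ _ → 0ℚ) (λ i → colsℚ A (outer i)) (λ _ → QP.≤-refl) ray) ,
    (λ _ → 0) , λ r → Σℤ.sum-zero (λ j → ZP.*-zeroʳ (A r j))

  -- Scale a point of γ off the facet so that its a_u-coordinate is 1, then round the others up.
  translate : ∀ u → ∃ λ e → Point e × dotℤ ι e ≡ + w u
  translate u = e , (e∈γ , x , Ax≈e) , ιe
    where
    v = proj₁ interior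
    c = proj₁ (γ⊆frame u (proj₁ (proj₂ interior)))
    0≤c = proj₁ (proj₂ (γ⊆frame u (proj₁ (proj₂ interior))))
    cf≈v = proj₂ (proj₂ (γ⊆frame u (proj₁ (proj₂ interior))))
    0<c₀ : 0ℚ < c zero
    0<c₀ = QP.≰⇒> (λ c₀≤0 → QP.<⇒≢ (proj₂ (proj₂ interior)) (sym (trans (ι·lincomb u c cf≈v)
      (trans (cong (_* dotℚ (toℚv ι) (colsℚ A (inner u))) (QP.≤-antisym c₀≤0 (0≤c zero)))
        (QP.*-zeroˡ (dotℚ (toℚv ι) (colsℚ A (inner u))))))))
    inv : ∃ λ t → (0ℚ < t) × (c zero * t ≡ 1ℚ)
    inv = inverse-pos 0<c₀
    t = proj₁ inv
    0≤t = QP.<⇒≤ (proj₁ (proj₂ inv))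
    M : Fin k → ℕ
    M i = proj₁ (archimedean (t * c (suc i)))
    δ : Fin (suc m) → ℕ
    δ u′ = 1≡ (u′ FP.≟ u)
      where
      1≡ : ∀ {P : Set} → Dec P → ℕ
      1≡ (yes _) = 1
      1≡ (no _)  = 0
    δ-on : δ u ≡ 1
    δ-on with u FP.≟ u
    ... | yes _ = refl
    ... | no ≢  = contradiction refl ≢
    δ-off : ∀ u′ → u′ ≢ u → δ u′ ≡ 0
    δ-off u′ u′≢u with u′ FP.≟ u
    ... | yes ≡u = contradiction ≡u u′≢u
    ... | no _   = refl
    x : Fin (k N.+ suc m) → ℕ
    x = M VF.++ δ
    e : Fin (suc k) → ℤ
    e r = sumℤ (λ i → A r (outer i) Z.* + M i) Z.+ A r (inner u)
    δ-sum : ∀ (f : Fin (suc m) → ℤ) → sumℤ (λ u′ → f u′ Z.* + δ u′) ≡ f u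
    δ-sum f = trans (Σℤ.sum-single u (λ u′ u′≢u → trans (cong (λ n → f u′ Z.* + n) (δ-off u′ u′≢u)) (ZP.*-zeroʳ (f u′))))
      (trans (cong (λ n → f u Z.* + n) δ-on) (ZP.*-identityʳ (f u)))
    Ax≈e : ∀ r → sumℤ (λ j → A r j Z.* + x j) ≡ e r
    Ax≈e r = trans (A-++ℕ M δ r) (cong (λ s → sumℤ (λ i → A r (outer i) Z.* + M i) Z.+ s) (δ-sum (λ u → A r (inner u))))
    ιe : dotℤ ι e ≡ + w u
    ιe = trans (ι·A (λ j → + x j) Ax≈e) (trans
      (Σℤ.sum-cong (λ u′ → trans (cong (λ n → + n Z.* + w u′) (VFP.lookup-++ʳ M δ u′)) (ZP.*-comm (+ δ u′) (+ w u′))))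
      (δ-sum (λ u → + w u)))
    a : Fin k → Fin (suc k) → ℚ
    a i = colsℚ A (outer i)
    -- Since `c zero * t` is 1, `e` differs from `t v` by outer columns alone, with the nonnegative
    -- coefficients `M i - t c (suc i)`; the outer columns lie in γ.
    eℚ : ∀ r → t * v r + lincomb (λ i → ℕtoℚ (M i) + - t * c (suc i)) a r ≡ ℤtoℚ (e r)
    eℚ r = begin
      t * v r + lincomb (λ i → ℕtoℚ (M i) + - t * c (suc i)) a r
        ≡⟨ cong₂ (λ p q → t * p + q) (sym (cf≈v r)) (lincomb-linear (- t) (λ i → ℕtoℚ (M i)) (λ i → c (suc i)) a r) ⟩
      t * (c zero * aᵤ + L) + (S + - t * L)
        ≡⟨ simp t (c zero) aᵤ L S ⟩
      S + c zero * t * aᵤ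
        ≡⟨ cong (λ q → S + q * aᵤ) (proj₂ (proj₂ inv)) ⟩
      S + 1ℚ * aᵤ
        ≡⟨ cong₂ _+_ (sym (ℤtoℚ-lincomb outer M r)) (QP.*-identityˡ aᵤ) ⟩
      ℤtoℚ (sumℤ (λ i → A r (outer i) Z.* + M i)) + aᵤ
        ≡⟨ ℤtoℚ-+ (sumℤ (λ i → A r (outer i) Z.* + M i)) (A r (inner u)) ⟨
      ℤtoℚ (e r) ∎
      where
      open ≡-Reasoning
      aᵤ = colsℚ A (inner u) r
      L = lincomb (λ i → c (suc i)) a r
      S = lincomb (λ i → ℕtoℚ (M i)) a r
      simp : ∀ t c a L S → t * (c * a + L) + (S + - t * L) ≡ S + c * t * a
      simp = solve-∀ ℚring
    e∈γ : γ (toℚv e)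
    e∈γ = γ-resp eℚ (γ-+ (γ-* 0≤t (proj₁ (proj₂ interior)))
      (γ-lincomb (λ i → ℕtoℚ (M i) + - t * c (suc i)) a
        (λ i → subst (0ℚ ≤_) (minus (ℕtoℚ (M i)) t (c (suc i))) (≤⇒0≤- (proj₂ (archimedean (t * c (suc i)))))) ray))
      where
      minus : ∀ n t c → n - t * c ≡ n + - t * c
      minus = solve-∀ ℚring

  Value-+* : ∀ {n} u t → Value n → Value (n N.+ t N.* w u)
  Value-+* {n} u t (b , b∈P , ιb) =
    let e , e∈P , ιe = translate u in
    (λ r → b r Z.+ + t Z.* e r) , Point-+* t b∈P e∈P ,
    trans (dot-+* b e (+ t)) (trans (cong₂ (λ p q → p Z.+ + t Z.* q) ιb ιe) (cong (λ z → + n Z.+ z) (sym (ZP.pos-* t (w u)))))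

  -- The weights divide one another. The lines run in the direction `translate v`, along which ι
  -- grows by `w v`, and the origin provides the base value 0, all of whose multiples are again 0.
  equal-weights : PolyOnPts A Point → ∀ u v → w u ≡ w v
  equal-weights (p , p≡count) u v = ∣-antisym (w∣w u v) (w∣w v u)
    where
    w∣w : ∀ u v → w u ∣ w v
    w∣w u v = PolyAlong⇒∣ m w 0<w u (w v) Value 0 add-weight zero-value along
      where
      add-weight : ∀ i n → Value n → Value (w i N.+ n)
      add-weight i n val = subst Value (trans (cong (n N.+_) (NP.*-identityˡ (w i))) (NP.+-comm n (w i))) (Value-+* i 1 val)
      zero-value : ∀ q → Value (suc q N.* 0)
      zero-value q = subst Value (sym (NP.*-zeroʳ (suc q)))
        ((λ _ → + 0) , Point-0 , Σℤ.sum-zero (λ r → ZP.*-zeroʳ (ι r)))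
      along : PolyAlong w 0<w (w v) Value
      along n (b , b∈P , ιb) = PolyFn-resp
        (λ t → let _ , P , ι≡ = Value-+* v t (b , b∈P , ιb) in p≡count _ _ P (CountSol-count P ι≡))
        (PolyFn-line p b (proj₁ (translate v)))

  -- The common weight β is `suc β′`, which makes it positive and division by it well-formed.
  module Uniform (β′ : ℕ) (w≡β : ∀ u → w u ≡ suc β′) where

    multiple : ∀ {l} (y : Vec ℕ l) (w : Fin l → ℕ) → (∀ u → w u ≡ suc β′) → ∃ λ t → total w y ≡ suc β′ N.* t
    multiple []       w w≡β = 0 , sym (NP.*-zeroʳ (suc β′))
    multiple (y ∷ ys) w w≡β =
      let t , eq = multiple ys (w ∘ suc) (w≡β ∘ suc) in
      y N.+ t , trans (cong₂ (λ a b → a N.* y N.+ b) (w≡β zero) eq) (sym (NP.*-distribˡ-+ (suc β′) y t))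

    formula : ∀ {b c} → Point b → CountSol A b c →
      ℤtoℚ (+ c) ≡ binomℚ ((dotℤ ι b / suc β′) + ℤtoℚ (+ m)) m
    formula {b} {c} P@(_ , b∈S) cnt = begin
      ℕtoℚ c
        ≡⟨ cong ℕtoℚ (Count-unique cnt (CountSol-count P ιb≡βt)) ⟩
      ℕtoℚ (count w 0<w (suc β′ N.* t))
        ≡⟨ cong ℕtoℚ (count-cong w (λ _ → suc β′) 0<w (λ _ → 0<β) w≡β (suc β′ N.* t)) ⟩
      ℕtoℚ (count {suc m} (λ _ → suc β′) (λ _ → 0<β) (suc β′ N.* t))
        ≡⟨ count-equal-weights m (suc β′) 0<β t ⟩
      binomℚ (ℕtoℚ t + ℕtoℚ m) m
        ≡⟨ cong (λ q → binomℚ (q + ℕtoℚ m) m) quotient≡t ⟨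
      binomℚ ((dotℤ ι b / suc β′) + ℕtoℚ m) m ∎
      where
      open ≡-Reasoning
      0<β : 0 N.< suc β′
      0<β = N.s≤s N.z≤n
      mult = multiple (V.tabulate (λ u → proj₁ b∈S (inner u))) w w≡β
      t = proj₁ mult
      ιb≡βt : dotℤ ι b ≡ + (suc β′ N.* t)
      ιb≡βt = trans (value b∈S) (cong +_ (proj₂ mult))
      quotient≡t : dotℤ ι b / suc β′ ≡ ℕtoℚ t
      quotient≡t = /-unique (dotℤ ι b) β′ (trans (QP.*-comm (ℕtoℚ t) (ℕtoℚ (suc β′)))
        (trans (sym (ℕtoℚ-* (suc β′) t)) (cong ℤtoℚ (sym ιb≡βt))))

    polynomial : PolyOnPts A Point
    polynomial = proj₁ poly , λ b c P cnt →
      trans (proj₂ poly (toℚv b)) (trans (cong (λ q → binomℚ (q + ℕtoℚ m) m) (scaled b)) (sym (formula P cnt)))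
      where
      poly : PolyMap (λ x → binomℚ (dotℚ (toℚv ι) x * (+ 1 / suc β′) + ℕtoℚ m) m)
      poly = PolyMap-binomℚ (PolyMap-+ (PolyMap-* (PolyMap-sum (λ r → PolyMap-* (PolyMap-const (ℤtoℚ (ι r))) (PolyMap-coordinate r)))
        (PolyMap-const (+ 1 / suc β′))) (PolyMap-const (ℕtoℚ m))) m
      scaled : ∀ b → dotℚ (toℚv ι) (toℚv b) * (+ 1 / suc β′) ≡ dotℤ ι b / suc β′
      scaled b = sym (/-unique (dotℤ ι b) β′ (begin
        dotℚ (toℚv ι) (toℚv b) * (+ 1 / suc β′) * ℕtoℚ (suc β′)
          ≡⟨ QP.*-assoc (dotℚ (toℚv ι) (toℚv b)) (+ 1 / suc β′) (ℕtoℚ (suc β′)) ⟩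
        dotℚ (toℚv ι) (toℚv b) * ((+ 1 / suc β′) * ℕtoℚ (suc β′))
          ≡⟨ cong (dotℚ (toℚv ι) (toℚv b) *_) (/-*-cancel (+ 1) β′) ⟩
        dotℚ (toℚv ι) (toℚv b) * 1ℚ
          ≡⟨ QP.*-identityʳ (dotℚ (toℚv ι) (toℚv b)) ⟩
        dotℚ (toℚv ι) (toℚv b)
          ≡⟨ ℤtoℚ-dot ι b ⟨
        ℤtoℚ (dotℤ ι b) ∎))
        where open ≡-Reasoning

    -- Both ι and the determinant in its last argument are linear and vanish on the outer columns.
    -- Writing `b` in the frame of `u`, each takes on `b` its value at `a_u` times `c zero`, and
    -- `c zero` is `ι · b / β`. The product form avoids a division, which `det≢0` makes legitimate.
    det-formula : ∀ {b} u → γ (toℚv b) → ℤtoℚ (detCols (λ i → col A (outer i)) b) ≡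
      (dotℤ ι b / suc β′) * ℤtoℚ (detCols (λ i → col A (outer i)) (col A (inner u)))
    det-formula {b} u b∈γ = begin
      ℤtoℚ (detCols a b)
        ≡⟨ detℚ b ⟩
      dotℚ (toℚv δ) (toℚv b)
        ≡⟨ dot-lincomb (toℚv δ) c (λ i → colsℚ A (frame u i)) cf≈b ⟩
      c zero * dotℚ (toℚv δ) (colsℚ A (inner u)) + sumℚ (λ i → c (suc i) * dotℚ (toℚv δ) (colsℚ A (outer i)))
        ≡⟨ cong (λ s → c zero * dotℚ (toℚv δ) (colsℚ A (inner u)) + s) (Σℚ.sum-zero (λ i →
             trans (cong (c (suc i) *_) (trans (sym (detℚ (a i))) (cong ℤtoℚ (detCols-repeated a i)))) (QP.*-zeroʳ (c (suc i))))) ⟩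
      c zero * dotℚ (toℚv δ) (colsℚ A (inner u)) + 0ℚ
        ≡⟨ QP.+-identityʳ (c zero * dotℚ (toℚv δ) (colsℚ A (inner u))) ⟩
      c zero * dotℚ (toℚv δ) (colsℚ A (inner u))
        ≡⟨ cong₂ _*_ (sym quotient≡c) (sym (detℚ (col A (inner u)))) ⟩
      (dotℤ ι b / suc β′) * ℤtoℚ (detCols a (col A (inner u))) ∎
      where
      open ≡-Reasoning
      a : Fin k → Fin (suc k) → ℤ
      a i = col A (outer i)
      δ = proj₁ (detCols-linear a)
      detℚ : ∀ v → ℤtoℚ (detCols a v) ≡ dotℚ (toℚv δ) (toℚv v)
      detℚ v = trans (cong ℤtoℚ (proj₂ (detCols-linear a) v)) (ℤtoℚ-dot δ v)
      c = proj₁ (γ⊆frame u b∈γ)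
      cf≈b = proj₂ (proj₂ (γ⊆frame u b∈γ))
      quotient≡c : dotℤ ι b / suc β′ ≡ c zero
      quotient≡c = /-unique (dotℤ ι b) β′ (begin
        c zero * ℕtoℚ (suc β′)
          ≡⟨ cong (λ n → c zero * ℕtoℚ n) (sym (w≡β u)) ⟩
        c zero * ℕtoℚ (w u)
          ≡⟨ cong (c zero *_) (sym (ι·innerℚ u)) ⟩
        c zero * dotℚ (toℚv ι) (colsℚ A (inner u))
          ≡⟨ ι·lincomb u c cf≈b ⟨
        dotℚ (toℚv ι) (toℚv b)
          ≡⟨ ℤtoℚ-dot ι b ⟨
        ℤtoℚ (dotℤ ι b) ∎)

  det≢0 : ∀ u → detCols (λ i → col A (outer i)) (col A (inner u)) ≢ + 0
  det≢0 u = LinIndep⇒detCols≢0 (λ i → col A (outer i)) (col A (inner u))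
    (LinIndep-resp {g = λ i → colsℚ A (frame u i)}
      {h = toℚv (col A (inner u)) VF.∷ (λ i → toℚv (col A (outer i)))} (λ { zero r → refl ; (suc i) r → refl }) (frame-indep u))

  SplitsByFacet : ℕ → Set
  SplitsByFacet β′ = ∀ j →
    (InCone (λ i → colsℚ A (outer i)) (colsℚ A j) → dotℤ ι (col A j) ≡ + 0) ×
    (¬ InCone (λ i → colsℚ A (outer i)) (colsℚ A j) → dotℤ ι (col A j) ≡ + suc β′)

  splits⇒uniform : ∀ {β′} → SplitsByFacet β′ → ∀ u → w u ≡ suc β′
  splits⇒uniform splits u = ZP.+-injective (trans (sym (ι·inner u)) (proj₂ (splits (inner u)) (inner∉facet u)))

  outer∈facet : ∀ i → InCone (λ i → colsℚ A (outer i)) (colsℚ A (outer i))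
  outer∈facet i = (λ j → when (i FP.≟ j) 1ℚ) , (λ j → 0≤when (i FP.≟ j)) ,
    λ r → trans (Σℚ.sum-single i (λ j j≢i → off j r j≢i (i FP.≟ j))) (on r (i FP.≟ i))
    where
    0≤when : ∀ {P : Set} (e : Dec P) → 0ℚ ≤ when e 1ℚ
    0≤when (yes _) = ℤtoℚ-nonNeg 1
    0≤when (no _)  = QP.≤-refl
    off : ∀ j r → j ≢ i → (e : Dec (i ≡ j)) → when e 1ℚ * colsℚ A (outer j) r ≡ 0ℚ
    off j r j≢i (yes i≡j) = contradiction (sym i≡j) j≢i
    off j r j≢i (no _)    = QP.*-zeroˡ (colsℚ A (outer j) r)
    on : ∀ r (e : Dec (i ≡ i)) → when e 1ℚ * colsℚ A (outer i) r ≡ colsℚ A (outer i) r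
    on r (yes _) = QP.*-identityˡ (colsℚ A (outer i) r)
    on r (no ≢)  = contradiction refl ≢

  -- Membership in the facet is settled by position: outer columns generate it, and inner ones have
  -- positive ι-value. The common value is read off at the first inner column.
  polynomial⇒splits : PolyOnPts A Point → ∃ SplitsByFacet
  polynomial⇒splits poly = proj₁ (weight-exists zero) , λ j → by-part j (outer-or-inner j)
    where
    by-part : ∀ j → (∃ λ i → outer i ≡ j) ⊎ (∃ λ u → inner u ≡ j) →
      (InCone (λ i → colsℚ A (outer i)) (colsℚ A j) → dotℤ ι (col A j) ≡ + 0) ×
      (¬ InCone (λ i → colsℚ A (outer i)) (colsℚ A j) → dotℤ ι (col A j) ≡ + w zero)
    by-part j (inj₁ (i , refl)) = (λ _ → ι⊥f i) , (λ ∉f → contradiction (outer∈facet i) ∉f)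
    by-part j (inj₂ (u , refl)) = (λ ∈f → contradiction ∈f (inner∉facet u)) ,
      (λ _ → trans (ι·inner u) (cong +_ (equal-weights poly u zero)))

open import Data.Nat using (_+_)
open import Data.Rational using (_≤_; _*_; _/_) renaming (_+_ to _+ℚ_)

theorem5p4 : (k m : ℕ) (A : Mat (suc k) (k + suc m)) →
    (∃ λ s → Simplicial A s) →
    (∀ (x : Fin (k + suc m) → ℚ) → (∀ j → 0ℚ ≤ x j) →
    (λ r → sumℚ (λ j → ℤtoℚ (A r j) * x j)) ≈v (λ _ → 0ℚ) → ∀ j → x j ≡ 0ℚ) →
    (b₀ : Fin (suc k) → ℚ) → IsChamberPoint A b₀ →
    (∀ i → External A (i ↑ˡ suc m)) →
    (∀ i → ExtremeRay (ChamberOf A b₀) (colsℚ A (i ↑ˡ suc m))) →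
    (r₀ : Fin (suc k) → ℚ) → ExtremeRay (ChamberOf A b₀) r₀ →
    (∀ j → External A j → ¬ SameRay r₀ (colsℚ A j)) →
    (∀ v → ExtremeRay (ChamberOf A b₀) v →
    (∃ λ i → SameRay v (colsℚ A (i ↑ˡ suc m))) ⊎ SameRay v r₀) →
    (∀ j → External A j → ExtremeRay (ChamberOf A b₀) (colsℚ A j) →
    ∃ λ i → j ≡ i ↑ˡ suc m) →
    (ι : Fin (suc k) → ℤ) →
    (∀ i → dotℤ ι (col A (i ↑ˡ suc m)) ≡ + 0) →
    (∀ x → ChamberOf A b₀ x → 0ℚ ≤ dotℚ (toℚv ι) x) →
    Primitive ι →
    (ℓ : Fin (suc m)) →
    Saturated A (λ i → i ↑ˡ suc m) →
    (PolyOnPts A (λ b → ChamberOf A b₀ (toℚv b) × InSemigroup A b) ⇔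
    (∃ λ β′ → ∀ j →
    (InCone (λ i → colsℚ A (i ↑ˡ suc m)) (colsℚ A j) →
    dotℤ ι (col A j) ≡ + 0)
    × (¬ InCone (λ i → colsℚ A (i ↑ˡ suc m)) (colsℚ A j) →
    dotℤ ι (col A j) ≡ + suc β′)))
    × (PolyOnPts A (λ b → ChamberOf A b₀ (toℚv b) × InSemigroup A b) →
    ∀ β′ → (∀ j →
    (InCone (λ i → colsℚ A (i ↑ˡ suc m)) (colsℚ A j) →
    dotℤ ι (col A j) ≡ + 0)
    × (¬ InCone (λ i → colsℚ A (i ↑ˡ suc m)) (colsℚ A j) →
    dotℤ ι (col A j) ≡ + suc β′)) →
    ∀ b → ChamberOf A b₀ (toℚv b) → InSemigroup A b →
    (∀ c → CountSol A b c →
    ℤtoℚ (+ c) ≡ binomℚ ((dotℤ ι b / suc β′) +ℚ ℤtoℚ (+ m)) m)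
    × (¬ InCone (λ i → colsℚ A (i ↑ˡ suc m)) (colsℚ A (k ↑ʳ ℓ)) →
    (detCols (λ i → col A (i ↑ˡ suc m)) (col A (k ↑ʳ ℓ)) ≢ + 0)
    × (ℤtoℚ (detCols (λ i → col A (i ↑ˡ suc m)) b)
    ≡ (dotℤ ι b / suc β′)
    * ℤtoℚ (detCols (λ i → col A (i ↑ˡ suc m)) (col A (k ↑ʳ ℓ))))))
theorem5p4 k m A basis pointed b₀ b₀-chamber ext rays r₀ _ _ _ _ ι ι⊥f ι≥0 ι-primitive ℓ saturated =
  mk⇔ polynomial⇒splits (λ (β′ , splits) → Uniform.polynomial β′ (splits⇒uniform splits)) ,
  λ _ β′ splits b b∈γ b∈S →
    (λ c → Uniform.formula β′ (splits⇒uniform splits) {b} (b∈γ , b∈S)) ,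
    λ _ → det≢0 ℓ , Uniform.det-formula β′ (splits⇒uniform splits) {b} ℓ b∈γ
  where
  open Chamber k m A basis pointed b₀ b₀-chamber ext (λ i → proj₁ (rays i)) ι ι⊥f ι≥0 ι-primitive saturated
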